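{- There exists a local computation algorithm (LCA) for the set cover problem with query complexity $s^{O(\log s)}\, t^{O(\log s\cdot(\log\log s+\log\log t))}$ that produces a set cover whose expected size (over the random tape) is $O(\log s)\cdot \mathrm{OPT}$, where $\mathrm{OPT}$ denotes the value of an optimal fractional set cover of the input instance.
   Context: An instance of set cover consists of a universe $\mathcal{E}$ of $n$ elements and a family $\mathcal{S}\subseteq 2^{\mathcal{E}}$ of $m$ sets whose union is $\mathcal{E}$; a set cover is a subfamily of $\mathcal{S}$ whose union is $\mathcal{E}$. In the LCA setting it is assumed that every set in $\mathcal{S}$ has at most $s$ elements and every element of $\mathcal{E}$ is contained in at most $t$ sets. The instance is accessed only through neighbor queries: "what is the $i$-th element of a given set $S$?" and "what is the $i$-th set containing a given element $e$?". An LCA for set cover is a randomized algorithm with access to neighbor queries, a tape of random bits and local working memory which, given a set $S\in\mathcal{S}$, answers whether $S$ belongs to the set cover; the answer may depend only on $S$, the instance $(\mathcal{S},\mathcal{E})$ and the random tape, and for every fixed random tape the answers given to all sets must be consistent with a single valid set cover. The query complexity is the maximum number of queries the algorithm makes to answer a single query. The expected size of the cover is taken over the random tape. -}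

module Defs where

open import Data.Nat using (ℕ; zero; suc; _+_; _*_; _^_; _≤_)
open import Data.Nat.Logarithm using (⌈log₂_⌉)
open import Data.Bool using (Bool; true; false; if_then_else_)
open import Data.Maybe using (Maybe; just; nothing)
open import Data.Fin using (Fin)
open import Data.List using (List; []; _∷_; length; allFin; map; foldr)
open import Data.List.Membership.Propositional using (_∈_)
open import Data.List.Relation.Unary.Unique.Propositional using (Unique)
open import Data.Vec using (Vec; []; _∷_)
open import Data.Integer using (+_)
open import Data.Rational as ℚ using (ℚ; 0ℚ; 1ℚ)
open import Data.Product using (Σ; _×_; _,_)
open import Function.Bundles using (_⇔_)

nth : ∀ {A : Set} → List A → ℕ → Maybe A
nth []       _       = nothing
nth (x ∷ xs) zero    = just x
nth (x ∷ xs) (suc i) = nth xs i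

record Instance (n m s t : ℕ) : Set where
  field
    elemsOf : Fin m → List (Fin n)
    setsOf  : Fin n → List (Fin m)
    elemsOf-unique : ∀ S → Unique (elemsOf S)
    setsOf-unique  : ∀ e → Unique (setsOf e)
    incidence : ∀ S e → (e ∈ elemsOf S) ⇔ (S ∈ setsOf e)
    setSize  : ∀ S → length (elemsOf S) ≤ s
    elemFreq : ∀ e → length (setsOf e) ≤ t
    covers   : ∀ e → Σ (Fin m) λ S → e ∈ elemsOf S
open Instance public

-- Local (query) computations: adaptive query trees with unbounded local
-- memory.  A leaf returns the answer; internal nodes are neighbour queries.

data QTree (n m : ℕ) : Set where
  answer  : Bool → QTree n m
  askElem : Fin m → ℕ → (Maybe (Fin n) → QTree n m) → QTree n m
  askSet  : Fin n → ℕ → (Maybe (Fin m) → QTree n m) → QTree n m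

run : ∀ {n m s t} → Instance n m s t → QTree n m → Bool
run I (answer b)      = b
run I (askElem S i k) = run I (k (nth (elemsOf I S) i))
run I (askSet e i k)  = run I (k (nth (setsOf I e) i))

queries : ∀ {n m s t} → Instance n m s t → QTree n m → ℕ
queries I (answer b)      = 0
queries I (askElem S i k) = suc (queries I (k (nth (elemsOf I S) i)))
queries I (askSet e i k)  = suc (queries I (k (nth (setsOf I e) i)))

record LCA : Set where
  field
    tapeLen : ℕ → ℕ → ℕ → ℕ → ℕ
    algo    : (n m s t : ℕ) → Vec Bool (tapeLen n m s t) → Fin m → QTree n m
open LCA public

sumℕ : List ℕ → ℕ
sumℕ = foldr _+_ 0

sumℚ : List ℚ → ℚ
sumℚ = foldr ℚ._+_ 0ℚ

toℚ : ℕ → ℚ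
toℚ k = + k ℚ./ 1

sumTapes : (L : ℕ) → (Vec Bool L → ℕ) → ℕ
sumTapes zero    f = f []
sumTapes (suc L) f = sumTapes L (λ r → f (true ∷ r)) + sumTapes L (λ r → f (false ∷ r))

inCover : ∀ {n m s t} (A : LCA) (I : Instance n m s t) →
          Vec Bool (tapeLen A n m s t) → Fin m → Bool
inCover {n} {m} {s} {t} A I r S = run I (algo A n m s t r S)

IsSetCover : ∀ {n m s t} → Instance n m s t → (Fin m → Bool) → Set
IsSetCover {n} {m} I chosen = ∀ (e : Fin n) → Σ (Fin m) λ S → (e ∈ elemsOf I S) × (chosen S ≡ true)
  where open import Relation.Binary.PropositionalEquality using (_≡_)

coverSize : ∀ {m} → (Fin m → Bool) → ℕ
coverSize {m} chosen = sumℕ (map (λ S → if chosen S then 1 else 0) (allFin m))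

record FractionalCover {n m s t : ℕ} (I : Instance n m s t) : Set where
  field
    weight   : Fin m → ℚ
    nonneg   : ∀ S → 0ℚ ℚ.≤ weight S
    feasible : ∀ e → 1ℚ ℚ.≤ sumℚ (map weight (setsOf I e))
open FractionalCover public

fracValue : ∀ {n m s t} {I : Instance n m s t} → FractionalCover I → ℚ
fracValue {m = m} x = sumℚ (map (weight x) (allFin m))

-- logarithm conventions (natural-number surrogates, ≥ 1, for O-bounds)
lg : ℕ → ℕ
lg x = ⌈log₂ (x + 2) ⌉

lglg : ℕ → ℕ
lglg x = lg (lg x)

{-# OPTIONS --safe #-}
module Submission where

-- Run the greedy algorithm by scales: stage i starts with every residual set of size at most 2^(i+1) and adds sets of
-- residual size about 2^i until none is left. Summing a fractional cover x over the uncovered elements U gives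
-- |U| ≤ 2^(i+1) · OPT, so it suffices that a stage adds O(|U| / 2^i) sets in expectation; there are O(log s) stages.
-- A stage has log t rounds with joining probabilities 1/t, 2/t, …, 1/2, in which every set that is still heavy joins
-- independently. A supermartingale shows that the expected number of heavy sets joining around a fixed element is O(1).
-- To keep the number of queries small, heaviness is tested on polylog(t) random elements only, with error about 1/(t log t),
-- and an element around which too many active sets have coins for a later round gives up. The latter has probability at most
-- 1/(2^i log² t), so the elements lost in this way can afterwards be covered one by one, each by its first set. The recursion
-- for the status of an element then has branching polylog(st) per round and poly(st) per stage.

open import Defs
open import Data.Nat using (ℕ; zero; suc; _+_; _*_; _^_; _∸_; _≤_; _<_; z≤n; s≤s; _≤?_; _≤ᵇ_; NonZero; >-nonZero; ⌊_/2⌋; ⌈_/2⌉)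
open import Data.Nat.Properties
open import Data.Nat.Induction using (<-wellFounded)
open import Data.Nat.Logarithm using (⌈log₂_⌉)
open import Data.Nat.Logarithm.Core using (⌈log2⌉)
open import Data.Nat.Tactic.RingSolver using (solve-∀)
import Data.Integer as ℤ
import Data.Integer.Properties as ℤP
open import Data.Rational as ℚ using (ℚ; mkℚ; 0ℚ; 1ℚ; toℚᵘ)
import Data.Rational.Properties as ℚP
open import Data.Rational.Unnormalised as ℚᵘ using (mkℚᵘ; *≡*; *≤*)
import Data.Rational.Unnormalised.Properties as ℚᵘP
open import Data.Bool using (Bool; true; false; if_then_else_; _∧_; _∨_; not; T; T?)
open import Data.Bool.Properties using (∧-assoc; ∧-identityʳ; ∧-zeroʳ; ∨-zeroʳ)
open import Data.Maybe using (Maybe; just; nothing)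
open import Data.Fin as Fin using (Fin)
open import Data.List using (List; []; _∷_; length; allFin; map; foldr; _++_; filterᵇ; null; take; drop)
open import Data.List.Properties using (map-∘; map-tabulate; length-map; length-++; length-take; length-drop; length-filter; take++drop≡id)
open import Data.List.Membership.Propositional using (_∈_)
open import Data.List.Relation.Unary.Any using (here; there)
open import Data.List.Relation.Unary.All as All using ([]; _∷_)
open import Data.List.Relation.Unary.AllPairs using ([]; _∷_)
open import Data.List.Relation.Unary.Unique.Propositional using (Unique)
open import Data.Vec using (Vec; []; _∷_; lookup; replicate)
open import Data.Product using (Σ; _×_; _,_; proj₁; proj₂)
open import Data.Sum using (_⊎_; inj₁; inj₂)
open import Data.Empty using (⊥-elim)
open import Data.Unit using (⊤; tt)
open import Function.Bundles using (Equivalence)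
open import Induction.WellFounded using (Acc; acc)
open import Relation.Nullary using (yes; no; does)
open import Relation.Binary.PropositionalEquality using (_≡_; _≢_; refl; sym; trans; cong; cong₂; subst; module ≡-Reasoning)
open import Algebra.Properties.CommutativeSemigroup *-commutativeSemigroup using (x∙yz≈y∙xz)
open import Algebra.Bundles using (CommutativeMonoid)
open import Level using (0ℓ)

-- Finite sums

-- The obstacle is the cost of simulation. The status of an element after round `j` depends on the
-- sets that may join around it in round `j`, and their activity depends on sampled elements in all
-- earlier rounds. Following up to t sets per round would cost about t^(log t) queries per stage.
-- The tape shows without queries which sets have a successful coin in round `j`, and only these are
-- followed. Such a coin is 2^(j-l) times as likely as one of round `l`; hence an element that saw
-- no success in round `l` is unlikely to see more than 2^(j-l) B successes in round `j`, however
-- many active sets surround it. This is the cutoff for giving up. The factors 2^(j-l) are large,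
-- but descending from round `j` to round `l` pays only one factor 2 per round in total.
-- Probabilities are cleared of denominators throughout: an expectation of at most b/a is written as
-- `a * ∑ f ≤ b * size`, the sum running over all outcomes. Conditioning is replaced by resampling
-- one or two rounds of the tape while the rest is frozen.

𝟙 : Bool → ℕ
𝟙 b = if b then 1 else 0

𝟙≤1 : ∀ b → 𝟙 b ≤ 1
𝟙≤1 true  = ≤-refl
𝟙≤1 false = z≤n

𝟙-mono : ∀ {a b} → (a ≡ true → b ≡ true) → 𝟙 a ≤ 𝟙 b
𝟙-mono {false} h = z≤n
𝟙-mono {true}  h rewrite h refl = ≤-refl

𝟙-∧ : ∀ a b → 𝟙 (a ∧ b) ≡ 𝟙 a * 𝟙 b
𝟙-∧ true  b = sym (+-identityʳ (𝟙 b))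
𝟙-∧ false b = refl

𝟙-∨ : ∀ a b → 𝟙 (a ∨ b) ≤ 𝟙 a + 𝟙 b
𝟙-∨ true  b = m≤m+n 1 (𝟙 b)
𝟙-∨ false b = ≤-refl

𝟙-not : ∀ b → 𝟙 b + 𝟙 (not b) ≡ 1
𝟙-not true  = refl
𝟙-not false = refl

∧-elim : ∀ {a b} → a ∧ b ≡ true → a ≡ true × b ≡ true
∧-elim {true} {true} _ = refl , refl

∧-intro : ∀ {a b} → a ≡ true → b ≡ true → a ∧ b ≡ true
∧-intro refl refl = refl

not-true : ∀ {b} → not b ≡ true → b ≡ false
not-true {false} _ = refl

false≢true : ∀ {A : Set} {b} → b ≡ false → b ≡ true → A
false≢true refl ()

bool-ext : ∀ {a b : Bool} → (a ≡ true → b ≡ true) → (b ≡ true → a ≡ true) → a ≡ b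
bool-ext {true}  {b}     f g = sym (f refl)
bool-ext {false} {true}  f g = g refl
bool-ext {false} {false} f g = refl

≤ᵇ-true : ∀ a b → (a ≤ᵇ b) ≡ true → a ≤ b
≤ᵇ-true a b h = ≤ᵇ⇒≤ a b (subst T (sym h) tt)

≤ᵇ-false : ∀ a b → (a ≤ᵇ b) ≡ false → b < a
≤ᵇ-false a b h = ≰⇒> (λ le → subst T h (≤⇒≤ᵇ le))

true-≤ᵇ : ∀ a b → a ≤ b → (a ≤ᵇ b) ≡ true
true-≤ᵇ a b le with a ≤ᵇ b | ≤⇒≤ᵇ le
... | true | _ = refl

count : ∀ {m} → (Fin m → Bool) → ℕ
count {zero}  f = 0
count {suc m} f = 𝟙 (f Fin.zero) + count (λ i → f (Fin.suc i))

-- Generic because the same double counting is done in ℕ for expected costs and in ℚ for fractional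
-- covers.
module ListSum {ℓ} (M : CommutativeMonoid 0ℓ ℓ) where
  open CommutativeMonoid M renaming (Carrier to C; refl to ≈-refl; sym to ≈-sym; trans to ≈-trans)
  open import Relation.Binary.Reasoning.Setoid setoid

  Sum : ∀ {A : Set} → List A → (A → C) → C
  Sum xs f = foldr _∙_ ε (map f xs)

  Sum-cong : ∀ {A : Set} (xs : List A) {f g : A → C} → (∀ x → f x ≈ g x) → Sum xs f ≈ Sum xs g
  Sum-cong []       h = ≈-refl
  Sum-cong (x ∷ xs) h = ∙-cong (h x) (Sum-cong xs h)

  Sum-ε : ∀ {A : Set} (xs : List A) → Sum xs (λ _ → ε) ≈ ε
  Sum-ε []       = ≈-refl
  Sum-ε (x ∷ xs) = ≈-trans (identityˡ _) (Sum-ε xs)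

  interchange : ∀ a b c d → (a ∙ b) ∙ (c ∙ d) ≈ (a ∙ c) ∙ (b ∙ d)
  interchange a b c d = begin
    (a ∙ b) ∙ (c ∙ d) ≈⟨ assoc a b (c ∙ d) ⟩
    a ∙ (b ∙ (c ∙ d)) ≈⟨ ∙-congˡ (≈-sym (assoc b c d)) ⟩
    a ∙ ((b ∙ c) ∙ d) ≈⟨ ∙-congˡ (∙-congʳ (comm b c)) ⟩
    a ∙ ((c ∙ b) ∙ d) ≈⟨ ∙-congˡ (assoc c b d) ⟩
    a ∙ (c ∙ (b ∙ d)) ≈⟨ ≈-sym (assoc a c (b ∙ d)) ⟩
    (a ∙ c) ∙ (b ∙ d) ∎

  Sum-∙ : ∀ {A : Set} (xs : List A) (f g : A → C) → Sum xs (λ x → f x ∙ g x) ≈ Sum xs f ∙ Sum xs g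
  Sum-∙ []       f g = ≈-sym (identityˡ ε)
  Sum-∙ (x ∷ xs) f g = ≈-trans (∙-congˡ (Sum-∙ xs f g)) (interchange (f x) (g x) _ _)

  Sum-swap : ∀ {A B : Set} (xs : List A) (ys : List B) (f : A → B → C) →
             Sum xs (λ x → Sum ys (f x)) ≈ Sum ys (λ y → Sum xs (λ x → f x y))
  Sum-swap []       ys f = ≈-sym (Sum-ε ys)
  Sum-swap (x ∷ xs) ys f = ≈-trans (∙-congˡ (Sum-swap xs ys f)) (≈-sym (Sum-∙ ys (f x) _))

  Sum-++ : ∀ {A : Set} (xs ys : List A) (f : A → C) → Sum (xs ++ ys) f ≈ Sum xs f ∙ Sum ys f
  Sum-++ []       ys f = ≈-sym (identityˡ _)
  Sum-++ (x ∷ xs) ys f = ≈-trans (∙-congˡ (Sum-++ xs ys f)) (≈-sym (assoc _ _ _))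

  Sum-map : ∀ {A B : Set} (h : A → B) (xs : List A) (f : B → C) → Sum (map h xs) f ≡ Sum xs (λ x → f (h x))
  Sum-map h xs f = cong (foldr _∙_ ε) (sym (map-∘ xs))

  Sum-allFin : ∀ m (f : Fin (suc m) → C) →
               Sum (allFin (suc m)) f ≡ f Fin.zero ∙ Sum (allFin m) (λ i → f (Fin.suc i))
  Sum-allFin m f = cong (f Fin.zero ∙_) (trans (cong (foldr _∙_ ε) (map-tabulate Fin.suc f))
                     (sym (cong (foldr _∙_ ε) (map-tabulate (λ i → i) (λ i → f (Fin.suc i))))))

  _∈ᵇ_ : ∀ {k} → Fin k → List (Fin k) → Bool
  i ∈ᵇ []       = false
  i ∈ᵇ (x ∷ xs) = does (i Fin.≟ x) ∨ (i ∈ᵇ xs)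

  ∈ᵇ⇒∈ : ∀ {k} {i : Fin k} xs → i ∈ᵇ xs ≡ true → i ∈ xs
  ∈ᵇ⇒∈ {i = i} (x ∷ xs) h with i Fin.≟ x
  ... | yes p = here p
  ... | no _  = there (∈ᵇ⇒∈ xs h)

  ∈⇒∈ᵇ : ∀ {k} {i : Fin k} xs → i ∈ xs → i ∈ᵇ xs ≡ true
  ∈⇒∈ᵇ {i = i} (x ∷ xs) p with i Fin.≟ x
  ∈⇒∈ᵇ {i = i} (x ∷ xs) p         | yes _ = refl
  ∈⇒∈ᵇ {i = i} (x ∷ xs) (here q)  | no ¬q = ⊥-elim (¬q q)
  ∈⇒∈ᵇ {i = i} (x ∷ xs) (there q) | no _  = ∈⇒∈ᵇ xs q

  Sum-single : ∀ k (x : Fin k) (g : Fin k → C) →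
               Sum (allFin k) (λ i → if does (i Fin.≟ x) then g i else ε) ≈ g x
  Sum-single (suc k) Fin.zero g = begin
    Sum (allFin (suc k)) (λ i → if does (i Fin.≟ Fin.zero) then g i else ε) ≡⟨ Sum-allFin k _ ⟩
    g Fin.zero ∙ Sum (allFin k) (λ _ → ε) ≈⟨ ∙-congˡ (Sum-ε (allFin k)) ⟩
    g Fin.zero ∙ ε                        ≈⟨ identityʳ _ ⟩
    g Fin.zero ∎
  Sum-single (suc k) (Fin.suc x) g = begin
    Sum (allFin (suc k)) (λ i → if does (i Fin.≟ Fin.suc x) then g i else ε) ≡⟨ Sum-allFin k _ ⟩
    ε ∙ Sum (allFin k) (λ i → if does (i Fin.≟ x) then g (Fin.suc i) else ε) ≈⟨ identityˡ _ ⟩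
    Sum (allFin k) (λ i → if does (i Fin.≟ x) then g (Fin.suc i) else ε)     ≈⟨ Sum-single k x (λ i → g (Fin.suc i)) ⟩
    g (Fin.suc x) ∎

  -- Once every list is an indicator on all indices, double counting becomes an exchange of two
  -- finite sums. Distinct entries ensure that no index is counted twice.
  Sum-unique : ∀ {k} (xs : List (Fin k)) → Unique xs → (g : Fin k → C) →
               Sum xs g ≈ Sum (allFin k) (λ i → if i ∈ᵇ xs then g i else ε)
  Sum-unique {k} []       u       g = ≈-sym (Sum-ε (allFin k))
  Sum-unique {k} (x ∷ xs) (d ∷ u) g = begin
    g x ∙ Sum xs g
      ≈⟨ ∙-cong (≈-sym (Sum-single k x g)) (Sum-unique xs u g) ⟩
    Sum (allFin k) (λ i → if does (i Fin.≟ x) then g i else ε) ∙ Sum (allFin k) (λ i → if i ∈ᵇ xs then g i else ε)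
      ≈⟨ ≈-sym (Sum-∙ (allFin k) _ _) ⟩
    Sum (allFin k) (λ i → (if does (i Fin.≟ x) then g i else ε) ∙ (if i ∈ᵇ xs then g i else ε))
      ≈⟨ Sum-cong (allFin k) step ⟩
    Sum (allFin k) (λ i → if i ∈ᵇ (x ∷ xs) then g i else ε) ∎
    where
    step : ∀ i → (if does (i Fin.≟ x) then g i else ε) ∙ (if i ∈ᵇ xs then g i else ε)
               ≈ (if i ∈ᵇ (x ∷ xs) then g i else ε)
    step i with i Fin.≟ x
    ... | no _     = identityˡ _
    ... | yes refl with i ∈ᵇ xs in eq
    ...   | false = identityʳ _
    ...   | true  = ⊥-elim (All.lookup d (∈ᵇ⇒∈ xs eq) refl)

  Sum-incidence : ∀ {n m s t} (I : Instance n m s t) (f : Fin m → Fin n → C) →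
    Sum (allFin m) (λ S → Sum (elemsOf I S) (λ e → f S e)) ≈ Sum (allFin n) (λ e → Sum (setsOf I e) (λ S → f S e))
  Sum-incidence {n} {m} I f = begin
    Sum (allFin m) (λ S → Sum (elemsOf I S) (f S))
      ≈⟨ Sum-cong (allFin m) (λ S → Sum-unique (elemsOf I S) (elemsOf-unique I S) (f S)) ⟩
    Sum (allFin m) (λ S → Sum (allFin n) (λ e → if e ∈ᵇ elemsOf I S then f S e else ε))
      ≈⟨ Sum-swap (allFin m) (allFin n) _ ⟩
    Sum (allFin n) (λ e → Sum (allFin m) (λ S → if e ∈ᵇ elemsOf I S then f S e else ε))
      ≈⟨ Sum-cong (allFin n) (λ e → Sum-cong (allFin m) (λ S → reflexive (cong (λ b → if b then f S e else ε) (same S e)))) ⟩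
    Sum (allFin n) (λ e → Sum (allFin m) (λ S → if S ∈ᵇ setsOf I e then f S e else ε))
      ≈⟨ Sum-cong (allFin n) (λ e → ≈-sym (Sum-unique (setsOf I e) (setsOf-unique I e) (λ S → f S e))) ⟩
    Sum (allFin n) (λ e → Sum (setsOf I e) (λ S → f S e)) ∎
    where
    same : ∀ S e → e ∈ᵇ elemsOf I S ≡ S ∈ᵇ setsOf I e
    same S e = bool-ext
      (λ h → ∈⇒∈ᵇ (setsOf I e) (Equivalence.to (incidence I S e) (∈ᵇ⇒∈ (elemsOf I S) h)))
      (λ h → ∈⇒∈ᵇ (elemsOf I S) (Equivalence.from (incidence I S e) (∈ᵇ⇒∈ (setsOf I e) h)))

module ℕSum = ListSum +-0-commutativeMonoid
open ℕSum public using (_∈ᵇ_; ∈ᵇ⇒∈; ∈⇒∈ᵇ) renaming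
  ( Sum to ∑; Sum-cong to ∑-cong; Sum-∙ to ∑-+; Sum-swap to ∑-swap; Sum-++ to ∑-++; Sum-map to ∑-map
  ; Sum-ε to ∑-0; Sum-allFin to ∑-allFin; Sum-incidence to ∑-incidence; Sum-unique to ∑-unique)

∑-mono : ∀ {A : Set} (xs : List A) {f g : A → ℕ} → (∀ x → f x ≤ g x) → ∑ xs f ≤ ∑ xs g
∑-mono []       h = z≤n
∑-mono (x ∷ xs) h = +-mono-≤ (h x) (∑-mono xs h)

∑-mono-∈ : ∀ {A : Set} (xs : List A) {f g : A → ℕ} → (∀ x → x ∈ xs → f x ≤ g x) → ∑ xs f ≤ ∑ xs g
∑-mono-∈ []       h = z≤n
∑-mono-∈ (x ∷ xs) h = +-mono-≤ (h x (here refl)) (∑-mono-∈ xs (λ y p → h y (there p)))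

∑-*ˡ : ∀ {A : Set} (xs : List A) c (f : A → ℕ) → ∑ xs (λ x → c * f x) ≡ c * ∑ xs f
∑-*ˡ []       c f = sym (*-zeroʳ c)
∑-*ˡ (x ∷ xs) c f = trans (cong (c * f x +_) (∑-*ˡ xs c f)) (sym (*-distribˡ-+ c (f x) _))

∑-*ʳ : ∀ {A : Set} (xs : List A) c (f : A → ℕ) → ∑ xs (λ x → f x * c) ≡ ∑ xs f * c
∑-*ʳ []       c f = refl
∑-*ʳ (x ∷ xs) c f = trans (cong (f x * c +_) (∑-*ʳ xs c f)) (sym (*-distribʳ-+ c (f x) _))

∑-const : ∀ {A : Set} (xs : List A) c → ∑ xs (λ _ → c) ≡ length xs * c
∑-const []       c = refl
∑-const (x ∷ xs) c = cong (c +_) (∑-const xs c)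

∑-count : ∀ m (f : Fin m → Bool) → ∑ (allFin m) (λ i → 𝟙 (f i)) ≡ count f
∑-count zero    f = refl
∑-count (suc m) f = trans (∑-allFin m (λ i → 𝟙 (f i))) (cong (𝟙 (f Fin.zero) +_) (∑-count m (λ i → f (Fin.suc i))))

∑-∈ : ∀ {A : Set} {x : A} (xs : List A) (f : A → ℕ) → x ∈ xs → f x ≤ ∑ xs f
∑-∈ (x ∷ xs) f (here refl) = m≤m+n (f x) _
∑-∈ (x ∷ xs) f (there p)   = ≤-trans (∑-∈ xs f p) (m≤n+m _ (f x))

length-filterᵇ : ∀ {A : Set} (p : A → Bool) xs → length (filterᵇ p xs) ≡ ∑ xs (λ x → 𝟙 (p x))
length-filterᵇ p []       = refl
length-filterᵇ p (x ∷ xs) with p x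
... | true  = cong suc (length-filterᵇ p xs)
... | false = length-filterᵇ p xs

filterᵇ-cong : ∀ {A : Set} {p q : A → Bool} → (∀ x → p x ≡ q x) → ∀ xs → filterᵇ p xs ≡ filterᵇ q xs
filterᵇ-cong         h []       = refl
filterᵇ-cong {p = p} {q} h (x ∷ xs) with p x | q x | h x
... | true  | .true  | refl = cong (x ∷_) (filterᵇ-cong h xs)
... | false | .false | refl = filterᵇ-cong h xs

filterᵇ-∧ : ∀ {A : Set} (p q : A → Bool) xs → filterᵇ q (filterᵇ p xs) ≡ filterᵇ (λ x → p x ∧ q x) xs
filterᵇ-∧ p q []       = refl
filterᵇ-∧ p q (x ∷ xs) with p x
... | false = filterᵇ-∧ p q xs
... | true  with q x
...   | true  = cong (x ∷_) (filterᵇ-∧ p q xs)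
...   | false = filterᵇ-∧ p q xs

∈-filterᵇ : ∀ {A : Set} (p : A → Bool) {x} xs → x ∈ xs → p x ≡ true → x ∈ filterᵇ p xs
∈-filterᵇ p (x ∷ xs) (here refl) px rewrite px = here refl
∈-filterᵇ p (y ∷ xs) (there i) px with p y
... | true  = there (∈-filterᵇ p xs i px)
... | false = ∈-filterᵇ p xs i px

filterᵇ-∈ : ∀ {A : Set} (p : A → Bool) {x} xs → x ∈ filterᵇ p xs → x ∈ xs × p x ≡ true
filterᵇ-∈ p (y ∷ xs) i with p y in eq
filterᵇ-∈ p (y ∷ xs) (here refl) | true  = here refl , eq
filterᵇ-∈ p (y ∷ xs) (there i)   | true  = there (proj₁ (filterᵇ-∈ p xs i)) , proj₂ (filterᵇ-∈ p xs i)
filterᵇ-∈ p (y ∷ xs) i           | false = there (proj₁ (filterᵇ-∈ p xs i)) , proj₂ (filterᵇ-∈ p xs i)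

-- Spaces of random outcomes

-- A uniformly random outcome read off a block of the random tape.
record Space : Set₁ where
  field
    Out    : Set
    bits   : ℕ
    decode : Vec Bool bits → Out
open Space public

tapes : ∀ L → List (Vec Bool L)
tapes zero    = [] ∷ []
tapes (suc L) = map (true ∷_) (tapes L) ++ map (false ∷_) (tapes L)

-- A multiset with one entry per block of bits, so that a sum over it is `size Ω` times an
-- expectation even where `decode` identifies blocks.
outs : (Ω : Space) → List (Out Ω)
outs Ω = map (decode Ω) (tapes (bits Ω))

size : Space → ℕ
size Ω = length (outs Ω)

∑-tapes-suc : ∀ L (f : Vec Bool (suc L) → ℕ) →
  ∑ (tapes (suc L)) f ≡ ∑ (tapes L) (λ v → f (true ∷ v)) + ∑ (tapes L) (λ v → f (false ∷ v))
∑-tapes-suc L f = trans (∑-++ (map (true ∷_) (tapes L)) _ f)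
  (cong₂ _+_ (∑-map (true ∷_) (tapes L) f) (∑-map (false ∷_) (tapes L) f))

sumTapes≡∑ : ∀ L f → sumTapes L f ≡ ∑ (tapes L) f
sumTapes≡∑ zero    f = sym (+-identityʳ (f []))
sumTapes≡∑ (suc L) f = trans (cong₂ _+_ (sumTapes≡∑ L _) (sumTapes≡∑ L _)) (sym (∑-tapes-suc L f))

length-tapes : ∀ L → length (tapes L) ≡ 2 ^ L
length-tapes zero    = refl
length-tapes (suc L) = trans (length-++ (map (true ∷_) (tapes L)))
  (trans (cong₂ _+_ (trans (length-map (true ∷_) (tapes L)) (length-tapes L))
                    (trans (length-map (false ∷_) (tapes L)) (length-tapes L)))
         (cong (2 ^ L +_) (sym (+-identityʳ (2 ^ L)))))

size≡2^ : ∀ Ω → size Ω ≡ 2 ^ bits Ω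
size≡2^ Ω = trans (length-map (decode Ω) (tapes (bits Ω))) (length-tapes (bits Ω))

size-nonZero : ∀ Ω → NonZero (size Ω)
size-nonZero Ω = subst NonZero (sym (size≡2^ Ω)) (m^n≢0 2 (bits Ω))

∑-outs : ∀ Ω (f : Out Ω → ℕ) → ∑ (outs Ω) f ≡ ∑ (tapes (bits Ω)) (λ v → f (decode Ω v))
∑-outs Ω f = ∑-map (decode Ω) (tapes (bits Ω)) f

split : ∀ {A : Set} a {b} → Vec A (a + b) → Vec A a × Vec A b
split zero    v       = [] , v
split (suc a) (x ∷ v) = x ∷ proj₁ (split a v) , proj₂ (split a v)

∑-tapes-split : ∀ a b (f : Vec Bool a × Vec Bool b → ℕ) →
  ∑ (tapes (a + b)) (λ v → f (split a v)) ≡ ∑ (tapes a) (λ u → ∑ (tapes b) (λ v → f (u , v)))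
∑-tapes-split zero    b f = sym (+-identityʳ _)
∑-tapes-split (suc a) b f = trans (∑-tapes-suc (a + b) (λ v → f (split (suc a) v)))
  (trans (cong₂ _+_ (∑-tapes-split a b (λ p → f (true ∷ proj₁ p , proj₂ p)))
                    (∑-tapes-split a b (λ p → f (false ∷ proj₁ p , proj₂ p))))
         (sym (∑-tapes-suc a (λ u → ∑ (tapes b) (λ v → f (u , v))))))

bitSpace : ℕ → Space
bitSpace L = record { Out = Vec Bool L ; bits = L ; decode = λ v → v }

unitSpace : Space
unitSpace = record { Out = ⊤ ; bits = 0 ; decode = λ _ → tt }

infixr 5 _⊗_
_⊗_ : Space → Space → Space
Ω ⊗ Ψ = record
  { Out    = Out Ω × Out Ψ
  ; bits   = bits Ω + bits Ψ
  ; decode = λ v → decode Ω (proj₁ (split (bits Ω) v)) , decode Ψ (proj₂ (split (bits Ω) v))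
  }

decodeVec : (Ω : Space) → ∀ m → Vec Bool (m * bits Ω) → Vec (Out Ω) m
decodeVec Ω zero    v = []
decodeVec Ω (suc m) v = decode Ω (proj₁ (split (bits Ω) v)) ∷ decodeVec Ω m (proj₂ (split (bits Ω) v))

power : Space → ℕ → Space
power Ω m = record { Out = Vec (Out Ω) m ; bits = m * bits Ω ; decode = decodeVec Ω m }

default : (Ω : Space) → Out Ω
default Ω = decode Ω (replicate (bits Ω) false)

∑-bitSpace-suc : ∀ L (f : Vec Bool (suc L) → ℕ) →
  ∑ (outs (bitSpace (suc L))) f ≡ ∑ (outs (bitSpace L)) (λ v → f (true ∷ v)) + ∑ (outs (bitSpace L)) (λ v → f (false ∷ v))
∑-bitSpace-suc L f = trans (∑-outs (bitSpace (suc L)) f) (trans (∑-tapes-suc L f)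
  (sym (cong₂ _+_ (∑-outs (bitSpace L) _) (∑-outs (bitSpace L) _))))

∑-⊗ : ∀ Ω Ψ (f : Out (Ω ⊗ Ψ) → ℕ) →
  ∑ (outs (Ω ⊗ Ψ)) f ≡ ∑ (outs Ω) (λ x → ∑ (outs Ψ) (λ y → f (x , y)))
∑-⊗ Ω Ψ f = begin
  ∑ (outs (Ω ⊗ Ψ)) f
    ≡⟨ ∑-outs (Ω ⊗ Ψ) f ⟩
  ∑ (tapes (bits Ω + bits Ψ)) (λ v → f (decode (Ω ⊗ Ψ) v))
    ≡⟨ ∑-tapes-split (bits Ω) (bits Ψ) (λ p → f (decode Ω (proj₁ p) , decode Ψ (proj₂ p))) ⟩
  ∑ (tapes (bits Ω)) (λ u → ∑ (tapes (bits Ψ)) (λ v → f (decode Ω u , decode Ψ v)))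
    ≡⟨ ∑-cong (tapes (bits Ω)) (λ u → sym (∑-outs Ψ (λ y → f (decode Ω u , y)))) ⟩
  ∑ (tapes (bits Ω)) (λ u → ∑ (outs Ψ) (λ y → f (decode Ω u , y)))
    ≡⟨ sym (∑-outs Ω _) ⟩
  ∑ (outs Ω) (λ x → ∑ (outs Ψ) (λ y → f (x , y))) ∎
  where open ≡-Reasoning

∑-power-suc : ∀ Ω m (f : Vec (Out Ω) (suc m) → ℕ) →
  ∑ (outs (power Ω (suc m))) f ≡ ∑ (outs Ω) (λ x → ∑ (outs (power Ω m)) (λ v → f (x ∷ v)))
∑-power-suc Ω m f = trans (∑-outs (power Ω (suc m)) f)
  (trans (sym (∑-outs (Ω ⊗ power Ω m) g)) (∑-⊗ Ω (power Ω m) g))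
  where
  g : Out (Ω ⊗ power Ω m) → ℕ
  g p = f (proj₁ p ∷ proj₂ p)

size-⊗ : ∀ Ω Ψ → size (Ω ⊗ Ψ) ≡ size Ω * size Ψ
size-⊗ Ω Ψ = trans (size≡2^ (Ω ⊗ Ψ)) (trans (^-distribˡ-+-* 2 (bits Ω) (bits Ψ))
  (sym (cong₂ _*_ (size≡2^ Ω) (size≡2^ Ψ))))

size-power-suc : ∀ Ω m → size (power Ω (suc m)) ≡ size Ω * size (power Ω m)
size-power-suc Ω m = trans (size≡2^ (power Ω (suc m))) (trans (^-distribˡ-+-* 2 (bits Ω) (m * bits Ω))
  (sym (cong₂ _*_ (size≡2^ Ω) (size≡2^ (power Ω m)))))

∑-lookup : ∀ Ω {m} (i : Fin m) (f : Out Ω → ℕ) →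
  ∑ (outs (power Ω m)) (λ v → f (lookup v i)) * size Ω ≡ size (power Ω m) * ∑ (outs Ω) f
∑-lookup Ω {suc m} Fin.zero f = begin
  ∑ (outs (power Ω (suc m))) (λ v → f (lookup v Fin.zero)) * size Ω
    ≡⟨ cong (_* size Ω) (∑-power-suc Ω m _) ⟩
  ∑ (outs Ω) (λ x → ∑ (outs (power Ω m)) (λ v → f x)) * size Ω
    ≡⟨ cong (_* size Ω) (∑-cong (outs Ω) (λ x → ∑-const (outs (power Ω m)) (f x))) ⟩
  ∑ (outs Ω) (λ x → size (power Ω m) * f x) * size Ω
    ≡⟨ cong (_* size Ω) (∑-*ˡ (outs Ω) (size (power Ω m)) f) ⟩
  size (power Ω m) * ∑ (outs Ω) f * size Ω
    ≡⟨ lem (size (power Ω m)) (∑ (outs Ω) f) (size Ω) ⟩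
  size Ω * size (power Ω m) * ∑ (outs Ω) f
    ≡⟨ cong (_* ∑ (outs Ω) f) (sym (size-power-suc Ω m)) ⟩
  size (power Ω (suc m)) * ∑ (outs Ω) f ∎
  where
  open ≡-Reasoning
  lem : ∀ a b c → a * b * c ≡ c * a * b
  lem = solve-∀
∑-lookup Ω {suc m} (Fin.suc i) f = begin
  ∑ (outs (power Ω (suc m))) (λ v → f (lookup v (Fin.suc i))) * size Ω
    ≡⟨ cong (_* size Ω) (∑-power-suc Ω m _) ⟩
  ∑ (outs Ω) (λ x → ∑ (outs (power Ω m)) (λ v → f (lookup v i))) * size Ω
    ≡⟨ cong (_* size Ω) (∑-const (outs Ω) _) ⟩
  size Ω * ∑ (outs (power Ω m)) (λ v → f (lookup v i)) * size Ω
    ≡⟨ *-assoc (size Ω) _ (size Ω) ⟩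
  size Ω * (∑ (outs (power Ω m)) (λ v → f (lookup v i)) * size Ω)
    ≡⟨ cong (size Ω *_) (∑-lookup Ω i f) ⟩
  size Ω * (size (power Ω m) * ∑ (outs Ω) f)
    ≡⟨ sym (*-assoc (size Ω) _ _) ⟩
  size Ω * size (power Ω m) * ∑ (outs Ω) f
    ≡⟨ cong (_* ∑ (outs Ω) f) (sym (size-power-suc Ω m)) ⟩
  size (power Ω (suc m)) * ∑ (outs Ω) f ∎
  where open ≡-Reasoning

-- A coordinate of a product is uniformly distributed, so a bound b/a on an expectation passes from
-- one factor to the product.
∑-lookup-≤ : ∀ Ω {m} (i : Fin m) (f : Out Ω → ℕ) {a b} → a * ∑ (outs Ω) f ≤ b * size Ω →
  a * ∑ (outs (power Ω m)) (λ v → f (lookup v i)) ≤ b * size (power Ω m)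
∑-lookup-≤ Ω {m} i f {a} {b} h = *-cancelʳ-≤ _ _ (size Ω) {{size-nonZero Ω}} (begin
  a * ∑ (outs (power Ω m)) (λ v → f (lookup v i)) * size Ω   ≡⟨ *-assoc a _ _ ⟩
  a * (∑ (outs (power Ω m)) (λ v → f (lookup v i)) * size Ω) ≡⟨ cong (a *_) (∑-lookup Ω i f) ⟩
  a * (size (power Ω m) * ∑ (outs Ω) f) ≡⟨ x∙yz≈y∙xz a (size (power Ω m)) _ ⟩
  size (power Ω m) * (a * ∑ (outs Ω) f) ≤⟨ *-monoʳ-≤ (size (power Ω m)) h ⟩
  size (power Ω m) * (b * size Ω) ≡⟨ lem2 (size (power Ω m)) b (size Ω) ⟩
  b * size (power Ω m) * size Ω ∎)
  where
  open ≤-Reasoning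
  lem2 : ∀ a b c → a * (b * c) ≡ b * a * c
  lem2 = solve-∀

-- Resampling single coordinates

at : ∀ {A : Set} {R} → A → Vec A R → ℕ → A
at d []      j       = d
at d (x ∷ v) zero    = x
at d (x ∷ v) (suc j) = at d v j

put : ∀ {A : Set} {R} → Vec A R → ℕ → A → Vec A R
put []      j       y = []
put (x ∷ v) zero    y = y ∷ v
put (x ∷ v) (suc j) y = x ∷ put v j y

at-put : ∀ {A : Set} {R} d (v : Vec A R) {j} y → j < R → at d (put v j y) j ≡ y
at-put d (x ∷ v) {zero}  y _       = refl
at-put d (x ∷ v) {suc j} y (s≤s h) = at-put d v y h

at-put-≢ : ∀ {A : Set} {R} d (v : Vec A R) {j l} y → l ≢ j → at d (put v j y) l ≡ at d v l
at-put-≢ d []      y h = refl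
at-put-≢ d (x ∷ v) {zero}  {zero}  y h = ⊥-elim (h refl)
at-put-≢ d (x ∷ v) {zero}  {suc l} y h = refl
at-put-≢ d (x ∷ v) {suc j} {zero}  y h = refl
at-put-≢ d (x ∷ v) {suc j} {suc l} y h = at-put-≢ d v y (λ q → h (cong suc q))

-- Overwriting one coordinate with a fresh independent sample leaves the distribution unchanged. An
-- expectation may therefore be computed with everything outside coordinate `j` frozen.
resample : ∀ Ω R {j} → j < R → (f : Vec (Out Ω) R → ℕ) →
  ∑ (outs (power Ω R)) (λ v → ∑ (outs Ω) (λ x → f (put v j x))) ≡ size Ω * ∑ (outs (power Ω R)) f
resample Ω (suc R) {zero} _ f = begin
  ∑ (outs (power Ω (suc R))) (λ v → ∑ (outs Ω) (λ x → f (put v 0 x)))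
    ≡⟨ ∑-power-suc Ω R _ ⟩
  ∑ (outs Ω) (λ _ → ∑ (outs (power Ω R)) (λ v → ∑ (outs Ω) (λ x → f (x ∷ v))))
    ≡⟨ ∑-const (outs Ω) _ ⟩
  size Ω * ∑ (outs (power Ω R)) (λ v → ∑ (outs Ω) (λ x → f (x ∷ v)))
    ≡⟨ cong (size Ω *_) (∑-swap (outs (power Ω R)) (outs Ω) _) ⟩
  size Ω * ∑ (outs Ω) (λ x → ∑ (outs (power Ω R)) (λ v → f (x ∷ v)))
    ≡⟨ cong (size Ω *_) (sym (∑-power-suc Ω R f)) ⟩
  size Ω * ∑ (outs (power Ω (suc R))) f ∎
  where open ≡-Reasoning
resample Ω (suc R) {suc j} (s≤s h) f = begin
  ∑ (outs (power Ω (suc R))) (λ v → ∑ (outs Ω) (λ x → f (put v (suc j) x)))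
    ≡⟨ ∑-power-suc Ω R _ ⟩
  ∑ (outs Ω) (λ y → ∑ (outs (power Ω R)) (λ v → ∑ (outs Ω) (λ x → f (y ∷ put v j x))))
    ≡⟨ ∑-cong (outs Ω) (λ y → resample Ω R h (λ v → f (y ∷ v))) ⟩
  ∑ (outs Ω) (λ y → size Ω * ∑ (outs (power Ω R)) (λ v → f (y ∷ v)))
    ≡⟨ ∑-*ˡ (outs Ω) (size Ω) _ ⟩
  size Ω * ∑ (outs Ω) (λ y → ∑ (outs (power Ω R)) (λ v → f (y ∷ v)))
    ≡⟨ cong (size Ω *_) (sym (∑-power-suc Ω R f)) ⟩
  size Ω * ∑ (outs (power Ω (suc R))) f ∎
  where open ≡-Reasoning

resample-≤ : ∀ Ω R {j} → j < R → (f g : Vec (Out Ω) R → ℕ) →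
  (∀ v → ∑ (outs Ω) (λ x → f (put v j x)) ≤ ∑ (outs Ω) (λ x → g (put v j x))) →
  ∑ (outs (power Ω R)) f ≤ ∑ (outs (power Ω R)) g
resample-≤ Ω R h f g H = *-cancelˡ-≤ (size Ω) {{size-nonZero Ω}} (begin
  size Ω * ∑ (outs (power Ω R)) f ≡⟨ sym (resample Ω R h f) ⟩
  ∑ (outs (power Ω R)) (λ v → ∑ (outs Ω) (λ x → f (put v _ x))) ≤⟨ ∑-mono (outs (power Ω R)) H ⟩
  ∑ (outs (power Ω R)) (λ v → ∑ (outs Ω) (λ x → g (put v _ x))) ≡⟨ resample Ω R h g ⟩
  size Ω * ∑ (outs (power Ω R)) g ∎)
  where open ≤-Reasoning

-- Freezes all but two coordinates; needed where the independence of the coins of two rounds is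
-- used.
resample₂-≤ : ∀ Ω R {l j} → l < R → j < R → (f g : Vec (Out Ω) R → ℕ) →
  (∀ v → ∑ (outs Ω) (λ x → ∑ (outs Ω) (λ y → f (put (put v l x) j y)))
       ≤ ∑ (outs Ω) (λ x → ∑ (outs Ω) (λ y → g (put (put v l x) j y)))) →
  ∑ (outs (power Ω R)) f ≤ ∑ (outs (power Ω R)) g
resample₂-≤ Ω R {l} {j} hl hj f g H = *-cancelˡ-≤ (size Ω) {{size-nonZero Ω}} (begin
  size Ω * ∑ (outs (power Ω R)) f ≡⟨ sym (resample Ω R hj f) ⟩
  ∑ (outs (power Ω R)) (λ v → ∑ (outs Ω) (λ y → f (put v j y)))
    ≤⟨ resample-≤ Ω R hl (λ v → ∑ (outs Ω) (λ y → f (put v j y))) (λ v → ∑ (outs Ω) (λ y → g (put v j y))) H ⟩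
  ∑ (outs (power Ω R)) (λ v → ∑ (outs Ω) (λ y → g (put v j y))) ≡⟨ resample Ω R hj g ⟩
  size Ω * ∑ (outs (power Ω R)) g ∎)
  where open ≤-Reasoning

-- Coins and threshold gates

hits : ∀ {A : Set} {m} → (Fin m → Bool) → (A → Bool) → Vec A m → ℕ
hits sel c v = count (λ i → sel i ∧ c (lookup v i))

∑-not : ∀ {A : Set} (xs : List A) (c : A → Bool) → ∑ xs (λ x → 𝟙 (c x)) + ∑ xs (λ x → 𝟙 (not (c x))) ≡ length xs
∑-not xs c = trans (sym (∑-+ xs _ _)) (trans (∑-cong xs (λ x → 𝟙-not (c x)))
  (trans (∑-const xs 1) (*-identityʳ (length xs))))

∑-𝟙≤ : ∀ {A : Set} (xs : List A) (c : A → Bool) → ∑ xs (λ x → 𝟙 (c x)) ≤ length xs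
∑-𝟙≤ xs c = ≤-trans (m≤m+n (∑ xs (λ x → 𝟙 (c x))) _) (≤-reflexive (∑-not xs c))

∑-∑-* : ∀ {A B : Set} (xs : List A) (ys : List B) (f : A → ℕ) (g : B → ℕ) →
  ∑ xs (λ x → ∑ ys (λ y → f x * g y)) ≡ ∑ xs f * ∑ ys g
∑-∑-* xs ys f g = trans (∑-cong xs (λ x → ∑-*ˡ ys (f x) g)) (∑-*ʳ xs (∑ ys g) f)

-- By independence every selected coin contributes the failure probability p/(p+1), and every other
-- coin integrates out.
none-≤ : ∀ Ω (c : Out Ω → Bool) p → suc p * ∑ (outs Ω) (λ x → 𝟙 (c x)) ≡ size Ω →
  ∀ m (sel : Fin m → Bool) →
  suc p ^ count sel * ∑ (outs (power Ω m)) (λ v → 𝟙 (hits sel c v ≤ᵇ 0)) ≤ p ^ count sel * size (power Ω m)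
none-≤ Ω c p prob zero    sel = ≤-refl
none-≤ Ω c p prob (suc m) sel with sel Fin.zero
... | false = begin
  suc p ^ N * ∑ (outs (power Ω (suc m))) (λ v → 𝟙 (count (λ i → tail i ∧ c (lookup v (Fin.suc i))) ≤ᵇ 0))
    ≡⟨ cong (suc p ^ N *_) (trans (∑-power-suc Ω m _) (∑-const (outs Ω) H)) ⟩
  suc p ^ N * (size Ω * H) ≡⟨ lem (suc p ^ N) (size Ω) H ⟩
  size Ω * (suc p ^ N * H) ≤⟨ *-monoʳ-≤ (size Ω) (none-≤ Ω c p prob m tail) ⟩
  size Ω * (p ^ N * size (power Ω m)) ≡⟨ lem (size Ω) (p ^ N) _ ⟩
  p ^ N * (size Ω * size (power Ω m)) ≡⟨ cong (p ^ N *_) (sym (size-power-suc Ω m)) ⟩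
  p ^ N * size (power Ω (suc m)) ∎
  where
  open ≤-Reasoning
  tail : Fin m → Bool
  tail i = sel (Fin.suc i)
  N H : ℕ
  N = count tail
  H = ∑ (outs (power Ω m)) (λ v → 𝟙 (hits tail c v ≤ᵇ 0))
  lem : ∀ a b c → a * (b * c) ≡ b * (a * c)
  lem = solve-∀
... | true = begin
  suc p ^ suc N * ∑ (outs (power Ω (suc m))) (λ v → 𝟙 (𝟙 (c (lookup v Fin.zero)) + count (λ i → tail i ∧ c (lookup v (Fin.suc i))) ≤ᵇ 0))
    ≡⟨ cong (suc p ^ suc N *_) (trans (∑-power-suc Ω m _)
         (trans (∑-cong (outs Ω) (λ x → ∑-cong (outs (power Ω m)) (λ v → factor (c x) (hits tail c v))))
                (∑-∑-* (outs Ω) (outs (power Ω m)) (λ x → 𝟙 (not (c x))) _))) ⟩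
  suc p ^ suc N * (off * H) ≡⟨ lem (suc p) (suc p ^ N) off H ⟩
  (suc p * off) * (suc p ^ N * H) ≡⟨ cong (_* (suc p ^ N * H)) off≡ ⟩
  (p * size Ω) * (suc p ^ N * H) ≤⟨ *-monoʳ-≤ (p * size Ω) (none-≤ Ω c p prob m tail) ⟩
  (p * size Ω) * (p ^ N * size (power Ω m)) ≡⟨ lem2 p (size Ω) (p ^ N) _ ⟩
  p ^ suc N * (size Ω * size (power Ω m))   ≡⟨ cong (p ^ suc N *_) (sym (size-power-suc Ω m)) ⟩
  p ^ suc N * size (power Ω (suc m)) ∎
  where
  open ≤-Reasoning
  tail : Fin m → Bool
  tail i = sel (Fin.suc i)
  N H on off : ℕ
  N = count tail
  H = ∑ (outs (power Ω m)) (λ v → 𝟙 (hits tail c v ≤ᵇ 0))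
  on = ∑ (outs Ω) (λ x → 𝟙 (c x))
  off = ∑ (outs Ω) (λ x → 𝟙 (not (c x)))
  factor : ∀ b h → 𝟙 (𝟙 b + h ≤ᵇ 0) ≡ 𝟙 (not b) * 𝟙 (h ≤ᵇ 0)
  factor true  h = refl
  factor false h = sym (+-identityʳ _)
  off≡ : suc p * off ≡ p * size Ω
  off≡ = +-cancelˡ-≡ (suc p * on) _ _ (trans (sym (*-distribˡ-+ (suc p) on off))
    (trans (cong (suc p *_) (∑-not (outs Ω) c)) (cong (_+ p * size Ω) (sym prob))))
  lem : ∀ a b c d → a * b * (c * d) ≡ a * c * (b * d)
  lem = solve-∀
  lem2 : ∀ a b c d → a * b * (c * d) ≡ a * c * (b * d)
  lem2 = solve-∀

-- With P = p + 1 this is (1 - 1/P)^N ≤ 1 / (1 + N/P).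
bernoulli-down : ∀ p N → p ^ N * (suc p + N) ≤ suc p ^ suc N
bernoulli-down p zero    = ≤-reflexive (lem p)
  where
  lem : ∀ p → 1 * (suc p + 0) ≡ suc p * 1
  lem = solve-∀
bernoulli-down p (suc N) = begin
  p * p ^ N * (suc p + suc N) ≤⟨ m≤m+n _ (p ^ N * suc N) ⟩
  p * p ^ N * (suc p + suc N) + p ^ N * suc N ≡⟨ lem p (p ^ N) N ⟩
  suc p * (p ^ N * (suc p + N)) ≤⟨ *-monoʳ-≤ (suc p) (bernoulli-down p N) ⟩
  suc p ^ suc (suc N) ∎
  where
  open ≤-Reasoning
  lem : ∀ p x N → p * x * (suc p + suc N) + x * suc N ≡ suc p * (x * (suc p + N))
  lem = solve-∀

-- Bernoulli's inequality 1 + k/Q ≤ (1 + 1/Q)^k.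
bernoulli-up : ∀ Q k → Q ^ k * (Q + k) ≤ suc Q ^ k * Q
bernoulli-up Q zero    = ≤-reflexive (cong (1 *_) (+-identityʳ Q))
bernoulli-up Q (suc k) = begin
  Q * Q ^ k * (Q + suc k) ≤⟨ m≤m+n _ (Q ^ k * k) ⟩
  Q * Q ^ k * (Q + suc k) + Q ^ k * k ≡⟨ lem Q (Q ^ k) k ⟩
  suc Q * (Q ^ k * (Q + k)) ≤⟨ *-monoʳ-≤ (suc Q) (bernoulli-up Q k) ⟩
  suc Q * (suc Q ^ k * Q) ≡⟨ sym (*-assoc (suc Q) (suc Q ^ k) Q) ⟩
  suc Q ^ suc k * Q ∎
  where
  open ≤-Reasoning
  lem : ∀ Q x k → Q * x * (Q + suc k) + x * k ≡ suc Q * (x * (Q + k))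
  lem = solve-∀

^-distribʳ-* : ∀ k a b → (a * b) ^ k ≡ a ^ k * b ^ k
^-distribʳ-* zero    a b = refl
^-distribʳ-* (suc k) a b = trans (cong (a * b *_) (^-distribʳ-* k a b)) (lem a b (a ^ k) (b ^ k))
  where
  lem : ∀ a b x y → a * b * (x * y) ≡ a * x * (b * y)
  lem = solve-∀

2Q^Q≤ : ∀ Q .{{_ : NonZero Q}} → 2 * Q ^ Q ≤ suc Q ^ Q
2Q^Q≤ Q = *-cancelʳ-≤ _ _ Q (≤-trans (≤-reflexive (lem Q (Q ^ Q))) (bernoulli-up Q Q))
  where
  lem : ∀ Q x → 2 * x * Q ≡ x * (Q + Q)
  lem = solve-∀

-- (1 + 1/Q)^Q ≥ 2, so a moment with base 1 + 1/Q gains a factor 2 for every `Q` successes. This is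
-- why thresholds have the form `Q * B`.
2^B*Q^QB≤ : ∀ Q B .{{_ : NonZero Q}} → 2 ^ B * Q ^ (Q * B) ≤ suc Q ^ (Q * B)
2^B*Q^QB≤ Q B = begin
  2 ^ B * Q ^ (Q * B)   ≡⟨ cong (2 ^ B *_) (sym (^-*-assoc Q Q B)) ⟩
  2 ^ B * (Q ^ Q) ^ B   ≡⟨ sym (^-distribʳ-* B 2 (Q ^ Q)) ⟩
  (2 * Q ^ Q) ^ B ≤⟨ ^-monoˡ-≤ B (2Q^Q≤ Q) ⟩
  (suc Q ^ Q) ^ B ≡⟨ ^-*-assoc (suc Q) Q B ⟩
  suc Q ^ (Q * B) ∎
  where open ≤-Reasoning

-- The weight `P + count sel` is the one that the potential attaches to survival; the decay of the
-- survival probability with the number of coins cancels it.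
none-weighted-≤ : ∀ Ω (c : Out Ω → Bool) P .{{_ : NonZero P}} → P * ∑ (outs Ω) (λ x → 𝟙 (c x)) ≡ size Ω →
  ∀ m (sel : Fin m → Bool) →
  (P + count sel) * ∑ (outs (power Ω m)) (λ v → 𝟙 (hits sel c v ≤ᵇ 0)) ≤ P * size (power Ω m)
none-weighted-≤ Ω c (suc p) prob m sel = *-cancelˡ-≤ (suc p ^ N) {{m^n≢0 (suc p) N}} (begin
  suc p ^ N * ((suc p + N) * H) ≡⟨ x∙yz≈y∙xz (suc p ^ N) (suc p + N) H ⟩
  (suc p + N) * (suc p ^ N * H) ≤⟨ *-monoʳ-≤ (suc p + N) (none-≤ Ω c p prob m sel) ⟩
  (suc p + N) * (p ^ N * size (power Ω m)) ≡⟨ lem2 (suc p + N) (p ^ N) _ ⟩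
  p ^ N * (suc p + N) * size (power Ω m) ≤⟨ *-monoˡ-≤ (size (power Ω m)) (bernoulli-down p N) ⟩
  suc p * suc p ^ N * size (power Ω m) ≡⟨ lem3 (suc p) (suc p ^ N) _ ⟩
  suc p ^ N * (suc p * size (power Ω m)) ∎)
  where
  open ≤-Reasoning
  N H : ℕ
  N = count sel
  H = ∑ (outs (power Ω m)) (λ v → 𝟙 (hits sel c v ≤ᵇ 0))
  lem2 : ∀ a b c → a * (b * c) ≡ b * a * c
  lem2 = solve-∀
  lem3 : ∀ a b c → a * b * c ≡ b * (a * c)
  lem3 = solve-∀

-- Exponential moment with base 1 + 1/Q: a coin of probability Q/P contributes the factor 1 + 1/P.
many-≤ : ∀ Ω (d : Out Ω → Bool) P Q → P * ∑ (outs Ω) (λ x → 𝟙 (d x)) ≡ Q * size Ω →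
  ∀ m (sel : Fin m → Bool) b →
  suc Q ^ b * P ^ count sel * ∑ (outs (power Ω m)) (λ v → 𝟙 (b ≤ᵇ hits sel d v))
    ≤ Q ^ b * suc P ^ count sel * size (power Ω m)
many-≤ Ω d P Q prob m sel zero = *-mono-≤ (*-monoʳ-≤ 1 (^-monoˡ-≤ (count sel) (n≤1+n P)))
  (∑-𝟙≤ (outs (power Ω m)) (λ v → 0 ≤ᵇ hits sel d v))
many-≤ Ω d P Q prob zero    sel (suc b) = ≤-trans (≤-reflexive (*-zeroʳ (suc Q ^ suc b * 1))) z≤n
many-≤ Ω d P Q prob (suc m) sel (suc b) with sel Fin.zero
... | false = begin
  x * ∑ (outs (power Ω (suc m))) (λ v → 𝟙 (suc b ≤ᵇ count (λ i → tail i ∧ d (lookup v (Fin.suc i)))))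
    ≡⟨ cong (x *_) (trans (∑-power-suc Ω m _) (∑-const (outs Ω) H)) ⟩
  x * (size Ω * H) ≡⟨ lem x (size Ω) H ⟩
  size Ω * (x * H) ≤⟨ *-monoʳ-≤ (size Ω) (many-≤ Ω d P Q prob m tail (suc b)) ⟩
  size Ω * (y * size (power Ω m))  ≡⟨ lem (size Ω) y _ ⟩
  y * (size Ω * size (power Ω m))  ≡⟨ cong (y *_) (sym (size-power-suc Ω m)) ⟩
  y * size (power Ω (suc m)) ∎
  where
  open ≤-Reasoning
  tail : Fin m → Bool
  tail i = sel (Fin.suc i)
  H x y : ℕ
  H = ∑ (outs (power Ω m)) (λ v → 𝟙 (suc b ≤ᵇ hits tail d v))
  x = suc Q ^ suc b * P ^ count tail
  y = Q ^ suc b * suc P ^ count tail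
  lem : ∀ a b c → a * (b * c) ≡ b * (a * c)
  lem = solve-∀
... | true = begin
  suc Q ^ suc b * (P * PN) * ∑ (outs (power Ω (suc m))) (λ v → 𝟙 (suc b ≤ᵇ 𝟙 (d (lookup v Fin.zero)) + count (λ i → tail i ∧ d (lookup v (Fin.suc i)))))
    ≡⟨ cong (suc Q ^ suc b * (P * PN) *_) (trans (∑-power-suc Ω m _) (trans
         (∑-cong (outs Ω) (λ x → trans (∑-cong (outs (power Ω m)) (λ v → factor (d x) (hits tail d v)))
            (trans (∑-+ (outs (power Ω m)) _ _) (cong₂ _+_ (∑-*ˡ (outs (power Ω m)) (𝟙 (d x)) _) (∑-*ˡ (outs (power Ω m)) (𝟙 (not (d x))) _)))))
         (trans (∑-+ (outs Ω) _ _) (cong₂ _+_ (∑-*ʳ (outs Ω) H₀ _) (∑-*ʳ (outs Ω) H₁ _))))) ⟩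
  suc Q ^ suc b * (P * PN) * (on * H₀ + off * H₁)
    ≡⟨ lem (suc Q) (suc Q ^ b) P PN on H₀ off H₁ ⟩
  P * (on * suc Q * (suc Q ^ b * PN * H₀) + off * (suc Q ^ suc b * PN * H₁))
    ≤⟨ *-monoʳ-≤ P (+-mono-≤ (*-monoʳ-≤ (on * suc Q) (many-≤ Ω d P Q prob m tail b))
                             (*-monoʳ-≤ off (many-≤ Ω d P Q prob m tail (suc b)))) ⟩
  P * (on * suc Q * (Q ^ b * PN′ * z) + off * (Q ^ suc b * PN′ * z))
    ≡⟨ lem2 P on Q (Q ^ b) PN′ z off ⟩
  Q ^ b * PN′ * z * (P * on + Q * (P * (on + off)))
    ≡⟨ cong (Q ^ b * PN′ * z *_) (cong₂ _+_ prob (cong (λ k → Q * (P * k)) (∑-not (outs Ω) d))) ⟩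
  Q ^ b * PN′ * z * (Q * size Ω + Q * (P * size Ω))
    ≡⟨ lem3 (Q ^ b) PN′ z Q (size Ω) P ⟩
  Q ^ suc b * suc P ^ suc (count tail) * (size Ω * z)
    ≡⟨ cong (Q ^ suc b * suc P ^ suc (count tail) *_) (sym (size-power-suc Ω m)) ⟩
  Q ^ suc b * suc P ^ suc (count tail) * size (power Ω (suc m)) ∎
  where
  open ≤-Reasoning
  tail : Fin m → Bool
  tail i = sel (Fin.suc i)
  PN PN′ z H₀ H₁ on off : ℕ
  PN = P ^ count tail
  PN′ = suc P ^ count tail
  z = size (power Ω m)
  H₀ = ∑ (outs (power Ω m)) (λ v → 𝟙 (b ≤ᵇ hits tail d v))
  H₁ = ∑ (outs (power Ω m)) (λ v → 𝟙 (suc b ≤ᵇ hits tail d v))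
  on = ∑ (outs Ω) (λ x → 𝟙 (d x))
  off = ∑ (outs Ω) (λ x → 𝟙 (not (d x)))
  suc≤ᵇsuc : ∀ b h → (suc b ≤ᵇ suc h) ≡ (b ≤ᵇ h)
  suc≤ᵇsuc zero    h = refl
  suc≤ᵇsuc (suc b) h = refl
  factor : ∀ e h → 𝟙 (suc b ≤ᵇ 𝟙 e + h) ≡ 𝟙 e * 𝟙 (b ≤ᵇ h) + 𝟙 (not e) * 𝟙 (suc b ≤ᵇ h)
  factor true  h = trans (cong 𝟙 (suc≤ᵇsuc b h)) (sym (trans (+-identityʳ _) (+-identityʳ _)))
  factor false h = sym (+-identityʳ _)
  lem : ∀ q qb P PN on H₀ off H₁ → q * qb * (P * PN) * (on * H₀ + off * H₁)
        ≡ P * (on * q * (qb * PN * H₀) + off * (q * qb * PN * H₁))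
  lem = solve-∀
  lem2 : ∀ P on Q qb PN z off → P * (on * suc Q * (qb * PN * z) + off * (Q * qb * PN * z))
        ≡ qb * PN * z * (P * on + Q * (P * (on + off)))
  lem2 = solve-∀
  lem3 : ∀ qb PN z Q s P → qb * PN * z * (Q * s + Q * (P * s)) ≡ Q * qb * (suc P * PN) * (s * z)
  lem3 = solve-∀

-- Few selected coins make many successes of `d` unlikely, many make it unlikely that no `c`
-- succeeds. The bounds (1 - 1/P)^N and (1 + 1/P)^N multiply to at most 1, so the product of the two
-- probabilities is at most 2^(-B) for every number N of selected coins.
none-many-≤ : ∀ Ω (c d : Out Ω → Bool) P Q B .{{_ : NonZero P}} .{{_ : NonZero Q}} →
  P * ∑ (outs Ω) (λ x → 𝟙 (c x)) ≡ size Ω → P * ∑ (outs Ω) (λ x → 𝟙 (d x)) ≡ Q * size Ω →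
  ∀ m (sel : Fin m → Bool) →
  2 ^ B * (∑ (outs (power Ω m)) (λ v → 𝟙 (hits sel c v ≤ᵇ 0)) * ∑ (outs (power Ω m)) (λ v → 𝟙 (Q * B ≤ᵇ hits sel d v)))
    ≤ size (power Ω m) * size (power Ω m)
none-many-≤ Ω c d (suc p) Q B prob-c prob-d m sel =
  *-cancelˡ-≤ (Q ^ b * (P ^ N * P ^ N)) {{m*n≢0 _ _ {{m^n≢0 Q b}} {{m*n≢0 _ _ {{m^n≢0 P N}} {{m^n≢0 P N}}}}}} (begin
  Q ^ b * (P ^ N * P ^ N) * (2 ^ B * (H * J)) ≡⟨ lem (Q ^ b) (P ^ N) (2 ^ B) H J ⟩
  (2 ^ B * Q ^ b) * (P ^ N * H * (P ^ N * J)) ≤⟨ *-monoˡ-≤ (P ^ N * H * (P ^ N * J)) (2^B*Q^QB≤ Q B) ⟩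
  suc Q ^ b * (P ^ N * H * (P ^ N * J)) ≡⟨ lem2 (suc Q ^ b) (P ^ N) H J ⟩
  P ^ N * H * (suc Q ^ b * P ^ N * J) ≤⟨ *-mono-≤ (none-≤ Ω c p prob-c m sel) (many-≤ Ω d P Q prob-d m sel b) ⟩
  p ^ N * z * (Q ^ b * suc P ^ N * z) ≡⟨ lem3 (p ^ N) z (Q ^ b) (suc P ^ N) ⟩
  Q ^ b * (p ^ N * suc P ^ N) * (z * z) ≤⟨ *-monoˡ-≤ (z * z) (*-monoʳ-≤ (Q ^ b) pP≤) ⟩
  Q ^ b * (P ^ N * P ^ N) * (z * z) ∎)
  where
  open ≤-Reasoning
  P b N H J z : ℕ
  P = suc p
  b = Q * B
  N = count sel
  H = ∑ (outs (power Ω m)) (λ v → 𝟙 (hits sel c v ≤ᵇ 0))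
  J = ∑ (outs (power Ω m)) (λ v → 𝟙 (b ≤ᵇ hits sel d v))
  z = size (power Ω m)
  -- This is (P - 1)(P + 1) ≤ P², raised to the power N; it removes the dependence on N.
  pP≤ : p ^ N * suc P ^ N ≤ P ^ N * P ^ N
  pP≤ = begin
    p ^ N * suc P ^ N ≡⟨ sym (^-distribʳ-* N p (suc P)) ⟩
    (p * suc P) ^ N   ≤⟨ ^-monoˡ-≤ N (≤-trans (n≤1+n _) (≤-reflexive (sq p))) ⟩
    (P * P) ^ N ≡⟨ ^-distribʳ-* N P P ⟩
    P ^ N * P ^ N ∎
    where
    sq : ∀ p → suc (p * suc (suc p)) ≡ suc p * suc p
    sq = solve-∀
  lem : ∀ q P t H J → q * (P * P) * (t * (H * J)) ≡ (t * q) * (P * H * (P * J))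
  lem = solve-∀
  lem2 : ∀ q P H J → q * (P * H * (P * J)) ≡ P * H * (q * P * J)
  lem2 = solve-∀
  lem3 : ∀ a z q b → a * z * (q * b * z) ≡ q * (a * b) * (z * z)
  lem3 = solve-∀

allTrue : ∀ {R} → ℕ → Vec Bool R → Bool
allTrue zero    v       = true
allTrue (suc k) []      = true
allTrue (suc k) (b ∷ v) = b ∧ allTrue k v

∑-allTrue : ∀ R k → k ≤ R → 2 ^ k * ∑ (outs (bitSpace R)) (λ v → 𝟙 (allTrue k v)) ≡ size (bitSpace R)
∑-allTrue R zero h = trans (+-identityʳ _) (trans (∑-const (outs (bitSpace R)) 1) (*-identityʳ _))
∑-allTrue (suc R) (suc k) (s≤s h) = begin
  2 * 2 ^ k * ∑ (outs (bitSpace (suc R))) (λ v → 𝟙 (allTrue (suc k) v))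
    ≡⟨ cong (2 * 2 ^ k *_) (trans (∑-bitSpace-suc R _) (trans (cong (∑ (outs (bitSpace R)) (λ v → 𝟙 (allTrue k v)) +_) (∑-0 (outs (bitSpace R)))) (+-identityʳ _))) ⟩
  2 * 2 ^ k * ∑ (outs (bitSpace R)) (λ v → 𝟙 (allTrue k v)) ≡⟨ *-assoc 2 (2 ^ k) _ ⟩
  2 * (2 ^ k * ∑ (outs (bitSpace R)) (λ v → 𝟙 (allTrue k v))) ≡⟨ cong (2 *_) (∑-allTrue R k h) ⟩
  2 * size (bitSpace R)    ≡⟨ cong (2 *_) (size≡2^ (bitSpace R)) ⟩
  2 * 2 ^ R ≡⟨ sym (size≡2^ (bitSpace (suc R))) ⟩
  size (bitSpace (suc R))  ∎
  where open ≡-Reasoning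

-- Amplification by trees of disjunctions and conjunctions

gateSpace : Space → ℕ → Space
gateSpace Ω zero    = Ω ⊗ Ω
gateSpace Ω (suc k) = (gateSpace Ω k ⊗ gateSpace Ω k) ⊗ (gateSpace Ω k ⊗ gateSpace Ω k)

-- Amplifies a constant gap in the acceptance probability of h to an error doubly exponentially small in k.
gate : ∀ {Ω} k → (Out Ω → Bool) → Out (gateSpace Ω k) → Bool
gate zero    h (a , b)             = h a ∨ h b
gate (suc k) h ((a , b) , (c , d)) = (gate k h a ∨ gate k h b) ∧ (gate k h c ∨ gate k h d)

∑-pair : ∀ Ω (p : Out Ω → Bool) → ∑ (outs (Ω ⊗ Ω)) (λ x → 𝟙 (p (proj₁ x)) * 𝟙 (p (proj₂ x)))
         ≡ ∑ (outs Ω) (λ x → 𝟙 (p x)) * ∑ (outs Ω) (λ x → 𝟙 (p x))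
∑-pair Ω p = trans (∑-⊗ Ω Ω _) (∑-∑-* (outs Ω) (outs Ω) _ _)

∑-or : ∀ Ω (p : Out Ω → Bool) → ∑ (outs (Ω ⊗ Ω)) (λ x → 𝟙 (p (proj₁ x) ∨ p (proj₂ x)))
         ≤ 2 * (size Ω * ∑ (outs Ω) (λ x → 𝟙 (p x)))
∑-or Ω p = begin
  ∑ (outs (Ω ⊗ Ω)) (λ x → 𝟙 (p (proj₁ x) ∨ p (proj₂ x)))
    ≤⟨ ∑-mono (outs (Ω ⊗ Ω)) (λ x → 𝟙-∨ (p (proj₁ x)) (p (proj₂ x))) ⟩
  ∑ (outs (Ω ⊗ Ω)) (λ x → 𝟙 (p (proj₁ x)) + 𝟙 (p (proj₂ x)))
    ≡⟨ ∑-⊗ Ω Ω _ ⟩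
  ∑ (outs Ω) (λ x → ∑ (outs Ω) (λ y → 𝟙 (p x) + 𝟙 (p y)))
    ≡⟨ ∑-cong (outs Ω) (λ x → trans (∑-+ (outs Ω) _ _) (cong (_+ N) (∑-const (outs Ω) (𝟙 (p x))))) ⟩
  ∑ (outs Ω) (λ x → size Ω * 𝟙 (p x) + N)
    ≡⟨ trans (∑-+ (outs Ω) _ _) (cong₂ _+_ (∑-*ˡ (outs Ω) (size Ω) _) (∑-const (outs Ω) N)) ⟩
  size Ω * N + size Ω * N
    ≡⟨ cong (size Ω * N +_) (sym (+-identityʳ _)) ⟩
  2 * (size Ω * N) ∎
  where
  open ≤-Reasoning
  N : ℕ
  N = ∑ (outs Ω) (λ x → 𝟙 (p x))

-- One level of the tree acts on an error probability as q ↦ c q², which turns the bound 1/(cT) into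
-- 1/(cT²).
square-step : ∀ c T g z → c * T * g ≤ z → c * (T * T) * (c * (g * g)) ≤ z * z
square-step c T g z h = ≤-trans (≤-reflexive (lem c T g)) (*-mono-≤ h h)
  where
  lem : ∀ c T g → c * (T * T) * (c * (g * g)) ≡ c * T * g * (c * T * g)
  lem = solve-∀

2^2^suc : ∀ k → 2 ^ (2 ^ suc k) ≡ 2 ^ (2 ^ k) * 2 ^ (2 ^ k)
2^2^suc k = trans (cong (2 ^_) (cong (2 ^ k +_) (+-identityʳ (2 ^ k)))) (^-distribˡ-+-* 2 (2 ^ k) (2 ^ k))

-- A disjunction squares the probability of rejection and the conjunction at most doubles it: q ↦
-- 2q². The initial disjunction takes 1/2 to 1/4, the invariant 1/(2T) for T = 2.
gate-rejects-≤ : ∀ Ω k (h : Out Ω → Bool) → 2 * ∑ (outs Ω) (λ x → 𝟙 (not (h x))) ≤ size Ω →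
  2 * 2 ^ (2 ^ k) * ∑ (outs (gateSpace Ω k)) (λ x → 𝟙 (not (gate {Ω} k h x))) ≤ size (gateSpace Ω k)
gate-rejects-≤ Ω zero h H = begin
  4 * ∑ (outs (Ω ⊗ Ω)) (λ x → 𝟙 (not (h (proj₁ x) ∨ h (proj₂ x))))
    ≡⟨ cong (4 *_) (trans (∑-cong (outs (Ω ⊗ Ω)) (λ x → deMorgan (h (proj₁ x)) (h (proj₂ x)))) (∑-pair Ω (λ x → not (h x)))) ⟩
  4 * (N * N) ≡⟨ lem N ⟩
  2 * N * (2 * N) ≤⟨ *-mono-≤ H H ⟩
  size Ω * size Ω ≡⟨ sym (size-⊗ Ω Ω) ⟩
  size (Ω ⊗ Ω) ∎
  where
  open ≤-Reasoning
  N : ℕ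
  N = ∑ (outs Ω) (λ x → 𝟙 (not (h x)))
  deMorgan : ∀ a b → 𝟙 (not (a ∨ b)) ≡ 𝟙 (not a) * 𝟙 (not b)
  deMorgan true  b = refl
  deMorgan false b = sym (+-identityʳ _)
  lem : ∀ N → 4 * (N * N) ≡ 2 * N * (2 * N)
  lem = solve-∀
gate-rejects-≤ Ω (suc k) h H = begin
  2 * 2 ^ (2 ^ suc k) * ∑ (outs ((Γ ⊗ Γ) ⊗ (Γ ⊗ Γ))) (λ x → 𝟙 (not (or (proj₁ x) ∧ or (proj₂ x))))
    ≤⟨ *-monoʳ-≤ (2 * 2 ^ (2 ^ suc k)) (begin
         ∑ (outs ((Γ ⊗ Γ) ⊗ (Γ ⊗ Γ))) (λ x → 𝟙 (not (or (proj₁ x) ∧ or (proj₂ x))))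
           ≤⟨ ∑-mono (outs ((Γ ⊗ Γ) ⊗ (Γ ⊗ Γ))) (λ x → 𝟙-mono (deMorgan (or (proj₁ x)))) ⟩
         ∑ (outs ((Γ ⊗ Γ) ⊗ (Γ ⊗ Γ))) (λ x → 𝟙 (not (or (proj₁ x)) ∨ not (or (proj₂ x))))
           ≤⟨ ∑-or (Γ ⊗ Γ) (λ x → not (or x)) ⟩
         2 * (size (Γ ⊗ Γ) * ∑ (outs (Γ ⊗ Γ)) (λ x → 𝟙 (not (or x))))
           ≡⟨ cong (λ w → 2 * (size (Γ ⊗ Γ) * w)) (trans
                (∑-cong (outs (Γ ⊗ Γ)) (λ x → deMorgan₂ (gate {Ω} k h (proj₁ x)) (gate {Ω} k h (proj₂ x)))) (∑-pair Γ (λ x → not (gate {Ω} k h x)))) ⟩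
         2 * (size (Γ ⊗ Γ) * (N * N)) ∎) ⟩
  2 * 2 ^ (2 ^ suc k) * (2 * (size (Γ ⊗ Γ) * (N * N)))
    ≡⟨ cong₂ (λ a b → 2 * a * (2 * (b * (N * N)))) (2^2^suc k) (size-⊗ Γ Γ) ⟩
  2 * (2 ^ (2 ^ k) * 2 ^ (2 ^ k)) * (2 * (size Γ * size Γ * (N * N)))
    ≡⟨ lem (2 * (2 ^ (2 ^ k) * 2 ^ (2 ^ k))) (size Γ * size Γ) (N * N) ⟩
  size Γ * size Γ * (2 * (2 ^ (2 ^ k) * 2 ^ (2 ^ k)) * (2 * (N * N)))
    ≤⟨ *-monoʳ-≤ (size Γ * size Γ) (square-step 2 (2 ^ (2 ^ k)) N (size Γ) (gate-rejects-≤ Ω k h H)) ⟩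
  size Γ * size Γ * (size Γ * size Γ)
    ≡⟨ sym (trans (size-⊗ (Γ ⊗ Γ) (Γ ⊗ Γ)) (cong₂ _*_ (size-⊗ Γ Γ) (size-⊗ Γ Γ))) ⟩
  size ((Γ ⊗ Γ) ⊗ (Γ ⊗ Γ)) ∎
  where
  open ≤-Reasoning
  Γ : Space
  Γ = gateSpace Ω k
  N : ℕ
  N = ∑ (outs Γ) (λ x → 𝟙 (not (gate {Ω} k h x)))
  or : Out (Γ ⊗ Γ) → Bool
  or x = gate {Ω} k h (proj₁ x) ∨ gate {Ω} k h (proj₂ x)
  deMorgan : ∀ a {b} → not (a ∧ b) ≡ true → not a ∨ not b ≡ true
  deMorgan true  e = e
  deMorgan false e = refl
  deMorgan₂ : ∀ a b → 𝟙 (not (a ∨ b)) ≡ 𝟙 (not a) * 𝟙 (not b)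
  deMorgan₂ true  b = refl
  deMorgan₂ false b = sym (+-identityʳ _)
  lem : ∀ a b c → a * (2 * (b * c)) ≡ b * (a * (2 * c))
  lem = solve-∀

-- Here a disjunction at most doubles and the conjunction squares: p ↦ 4p². The initial disjunction
-- takes 1/16 to 1/8, the invariant 1/(4T) for T = 2, which is where 16 comes from.
gate-accepts-≤ : ∀ Ω k (h : Out Ω → Bool) → 16 * ∑ (outs Ω) (λ x → 𝟙 (h x)) ≤ size Ω →
  4 * 2 ^ (2 ^ k) * ∑ (outs (gateSpace Ω k)) (λ x → 𝟙 (gate {Ω} k h x)) ≤ size (gateSpace Ω k)
gate-accepts-≤ Ω zero h H = begin
  8 * ∑ (outs (Ω ⊗ Ω)) (λ x → 𝟙 (h (proj₁ x) ∨ h (proj₂ x))) ≤⟨ *-monoʳ-≤ 8 (∑-or Ω h) ⟩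
  8 * (2 * (size Ω * N))  ≡⟨ lem (size Ω) N ⟩
  size Ω * (16 * N) ≤⟨ *-monoʳ-≤ (size Ω) H ⟩
  size Ω * size Ω ≡⟨ sym (size-⊗ Ω Ω) ⟩
  size (Ω ⊗ Ω) ∎
  where
  open ≤-Reasoning
  N : ℕ
  N = ∑ (outs Ω) (λ x → 𝟙 (h x))
  lem : ∀ z N → 8 * (2 * (z * N)) ≡ z * (16 * N)
  lem = solve-∀
gate-accepts-≤ Ω (suc k) h H = begin
  4 * 2 ^ (2 ^ suc k) * ∑ (outs ((Γ ⊗ Γ) ⊗ (Γ ⊗ Γ))) (λ x → 𝟙 (or (proj₁ x) ∧ or (proj₂ x)))
    ≤⟨ *-monoʳ-≤ (4 * 2 ^ (2 ^ suc k)) (begin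
         ∑ (outs ((Γ ⊗ Γ) ⊗ (Γ ⊗ Γ))) (λ x → 𝟙 (or (proj₁ x) ∧ or (proj₂ x)))
           ≡⟨ trans (∑-cong (outs ((Γ ⊗ Γ) ⊗ (Γ ⊗ Γ))) (λ x → 𝟙-∧ (or (proj₁ x)) (or (proj₂ x)))) (∑-pair (Γ ⊗ Γ) or) ⟩
         O * O ≤⟨ *-mono-≤ (∑-or Γ (gate {Ω} k h)) (∑-or Γ (gate {Ω} k h)) ⟩
         2 * (size Γ * N) * (2 * (size Γ * N)) ∎) ⟩
  4 * 2 ^ (2 ^ suc k) * (2 * (size Γ * N) * (2 * (size Γ * N)))
    ≡⟨ cong (λ a → 4 * a * (2 * (size Γ * N) * (2 * (size Γ * N)))) (2^2^suc k) ⟩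
  4 * (2 ^ (2 ^ k) * 2 ^ (2 ^ k)) * (2 * (size Γ * N) * (2 * (size Γ * N)))
    ≡⟨ lem (4 * (2 ^ (2 ^ k) * 2 ^ (2 ^ k))) (size Γ) N ⟩
  size Γ * size Γ * (4 * (2 ^ (2 ^ k) * 2 ^ (2 ^ k)) * (4 * (N * N)))
    ≤⟨ *-monoʳ-≤ (size Γ * size Γ) (square-step 4 (2 ^ (2 ^ k)) N (size Γ) (gate-accepts-≤ Ω k h H)) ⟩
  size Γ * size Γ * (size Γ * size Γ)
    ≡⟨ sym (trans (size-⊗ (Γ ⊗ Γ) (Γ ⊗ Γ)) (cong₂ _*_ (size-⊗ Γ Γ) (size-⊗ Γ Γ))) ⟩
  size ((Γ ⊗ Γ) ⊗ (Γ ⊗ Γ)) ∎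
  where
  open ≤-Reasoning
  Γ : Space
  Γ = gateSpace Ω k
  N O : ℕ
  N = ∑ (outs Γ) (λ x → 𝟙 (gate {Ω} k h x))
  or : Out (Γ ⊗ Γ) → Bool
  or x = gate {Ω} k h (proj₁ x) ∨ gate {Ω} k h (proj₂ x)
  O = ∑ (outs (Γ ⊗ Γ)) (λ x → 𝟙 (or x))
  lem : ∀ a z N → a * (2 * (z * N) * (2 * (z * N))) ≡ z * z * (a * (4 * (N * N)))
  lem = solve-∀

-- The stages of the algorithm

∑< : ℕ → (ℕ → ℕ) → ℕ
∑< zero    f = 0
∑< (suc j) f = ∑< j f + f j

∑<-mono : ∀ j {f g : ℕ → ℕ} → (∀ l → l < j → f l ≤ g l) → ∑< j f ≤ ∑< j g
∑<-mono zero    h = z≤n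
∑<-mono (suc j) h = +-mono-≤ (∑<-mono j (λ l p → h l (m<n⇒m<1+n p))) (h j ≤-refl)

∑<-∈ : ∀ j (f : ℕ → ℕ) {l} → l < j → f l ≤ ∑< j f
∑<-∈ (suc j) f {l} (s≤s p) with l ≟ j
... | yes refl = m≤n+m (f j) _
... | no  l≢j  = ≤-trans (∑<-∈ j f (≤∧≢⇒< p l≢j)) (m≤m+n _ (f j))

∑<-const : ∀ j c → ∑< j (λ _ → c) ≡ j * c
∑<-const zero    c = refl
∑<-const (suc j) c = trans (cong (_+ c) (∑<-const j c)) (+-comm (j * c) c)

∑<-*ˡ : ∀ j c (f : ℕ → ℕ) → ∑< j (λ l → c * f l) ≡ c * ∑< j f
∑<-*ˡ zero    c f = sym (*-zeroʳ c)
∑<-*ˡ (suc j) c f = trans (cong (_+ c * f j) (∑<-*ˡ j c f)) (sym (*-distribˡ-+ c _ (f j)))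

∑-∑< : ∀ {A : Set} (xs : List A) j (f : A → ℕ → ℕ) → ∑ xs (λ x → ∑< j (f x)) ≡ ∑< j (λ l → ∑ xs (λ x → f x l))
∑-∑< xs zero    f = ∑-0 xs
∑-∑< xs (suc j) f = trans (∑-+ xs _ _) (cong (_+ ∑ xs (λ x → f x j)) (∑-∑< xs j f))

-- The bits address one of 2^k slots, and slots beyond the end of the list are empty. A hit then has
-- the fixed denominator 2^k whatever the length of the list, provided that it is at most 2^k.
pick : ∀ {A : Set} k → Vec Bool k → List A → Maybe A
pick zero    v       []       = nothing
pick zero    v       (x ∷ xs) = just x
pick (suc k) (b ∷ v) xs       = pick k v (if b then take (2 ^ k) xs else drop (2 ^ k) xs)

holds : ∀ {A : Set} → (A → Bool) → Maybe A → Bool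
holds p nothing  = false
holds p (just x) = p x

∑-pick : ∀ {A : Set} (p : A → Bool) k (xs : List A) → length xs ≤ 2 ^ k →
  ∑ (outs (bitSpace k)) (λ v → 𝟙 (holds p (pick k v xs))) ≡ ∑ xs (λ x → 𝟙 (p x))
∑-pick p zero    []           h = refl
∑-pick p zero    (x ∷ [])     h = refl
∑-pick p zero    (x ∷ y ∷ xs) (s≤s ())
∑-pick p (suc k) xs           h = begin
  ∑ (outs (bitSpace (suc k))) (λ v → 𝟙 (holds p (pick (suc k) v xs)))
    ≡⟨ ∑-bitSpace-suc k _ ⟩
  ∑ (outs (bitSpace k)) (λ v → 𝟙 (holds p (pick k v (take (2 ^ k) xs)))) + ∑ (outs (bitSpace k)) (λ v → 𝟙 (holds p (pick k v (drop (2 ^ k) xs))))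
    ≡⟨ cong₂ _+_ (∑-pick p k (take (2 ^ k) xs) (≤-trans (≤-reflexive (length-take (2 ^ k) xs)) (m⊓n≤m (2 ^ k) _)))
                 (∑-pick p k (drop (2 ^ k) xs) (≤-trans (≤-reflexive (length-drop (2 ^ k) xs))
                    (≤-trans (∸-monoˡ-≤ (2 ^ k) h) (≤-reflexive (trans (m+n∸m≡n (2 ^ k) _) (+-identityʳ (2 ^ k))))))) ⟩
  ∑ (take (2 ^ k) xs) (λ x → 𝟙 (p x)) + ∑ (drop (2 ^ k) xs) (λ x → 𝟙 (p x))
    ≡⟨ sym (∑-++ (take (2 ^ k) xs) (drop (2 ^ k) xs) _) ⟩
  ∑ (take (2 ^ k) xs ++ drop (2 ^ k) xs) (λ x → 𝟙 (p x))
    ≡⟨ cong (λ ys → ∑ ys (λ x → 𝟙 (p x))) (take++drop≡id (2 ^ k) xs) ⟩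
  ∑ xs (λ x → 𝟙 (p x)) ∎
  where
  open ≡-Reasoning

gate-cong : ∀ {Ω} k {h h′ : Out Ω → Bool} → (∀ x → h x ≡ h′ x) → ∀ x → gate {Ω} k h x ≡ gate {Ω} k h′ x
gate-cong zero    H (a , b) = cong₂ _∨_ (H a) (H b)
gate-cong (suc k) H ((a , b) , (c , d)) =
  cong₂ _∧_ (cong₂ _∨_ (gate-cong k H a) (gate-cong k H b)) (cong₂ _∨_ (gate-cong k H c) (gate-cong k H d))

holds-cong : ∀ {A : Set} {p q : A → Bool} → (∀ x → p x ≡ q x) → ∀ x → holds p x ≡ holds q x
holds-cong h nothing  = refl
holds-cong h (just x) = h x

-- The cutoff applies to the incoming list, before any of its members is tested; this limits the
-- number of tests to `b`. The value `nothing` records giving up.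
extend : ∀ {A : Set} → ℕ → (A → Bool) → Maybe (List A) → Maybe (List A)
extend b p nothing   = nothing
extend b p (just xs) = if length xs ≤ᵇ b then just (filterᵇ p xs) else nothing

extend-cong : ∀ {A : Set} b {p q : A → Bool} → (∀ x → p x ≡ q x) → ∀ xs → extend b p xs ≡ extend b q xs
extend-cong b h nothing   = refl
extend-cong b h (just xs) with length xs ≤ᵇ b
... | true  = cong just (filterᵇ-cong h xs)
... | false = refl

-- Giving up counts as not deserted: the element leaves the process as if a set had joined around
-- it.
deserted : ∀ {A : Set} → Maybe (List A) → Bool
deserted nothing   = false
deserted (just xs) = null xs

∑<-cong : ∀ j {f g : ℕ → ℕ} → (∀ l → l < j → f l ≡ g l) → ∑< j f ≡ ∑< j g
∑<-cong zero    h = refl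
∑<-cong (suc j) h = cong₂ _+_ (∑<-cong j (λ l p → h l (m<n⇒m<1+n p))) (h j ≤-refl)

null-filterᵇ : ∀ {A : Set} (p : A → Bool) {x} xs → null (filterᵇ p xs) ≡ true → x ∈ xs → p x ≡ false
null-filterᵇ p {x} xs h i with p x in eq
... | false = refl
... | true  with filterᵇ p xs | ∈-filterᵇ p xs i eq
null-filterᵇ p {x} xs () i | true | _ ∷ _ | _

filterᵇ-null : ∀ {A : Set} (p : A → Bool) xs → null (filterᵇ p xs) ≡ false → Σ A λ x → x ∈ xs × p x ≡ true
filterᵇ-null p xs h with filterᵇ p xs in eq
... | y ∷ ys = y , filterᵇ-∈ p xs (subst (y ∈_) (sym eq) (here refl))

length-filterᵇ-mono : ∀ {A : Set} {p q : A → Bool} → (∀ x → p x ≡ true → q x ≡ true) →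
  ∀ xs → length (filterᵇ p xs) ≤ length (filterᵇ q xs)
length-filterᵇ-mono {p = p} {q} h xs rewrite length-filterᵇ p xs | length-filterᵇ q xs = ∑-mono xs (λ x → 𝟙-mono (h x))

-- One stage for the scale 2^i: every set has residual size at most 2^(i+1) when it starts and less than 2^i when it ends.
module Stage {n m s t : ℕ} (I : Instance n m s t) (R B k i : ℕ) (U : Fin n → Bool)
             (coin : ℕ → Fin m → Bool) (τ : ℕ → Fin m → Out (gateSpace (bitSpace (suc i)) k)) where

  residual : Fin m → List (Fin n)
  residual S = filterᵇ U (elemsOf I S)

  -- Samples come from the residual set at the start of the stage, which fits into 2^(i+1) slots.
  -- The predicate `al`, whose evaluation is the expensive recursion, is needed at the sampled
  -- elements only.
  accepts : Fin m → (Fin n → Bool) → Out (gateSpace (bitSpace (suc i)) k) → Bool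
  accepts S al = gate {bitSpace (suc i)} k (λ v → holds al (pick (suc i) v (residual S)))

  heavy : Fin m → Bool
  heavy S = 2 ^ i ≤ᵇ length (residual S)

  -- chain j e l lists the sets around e with a successful coin in round j that are still active after the test of
  -- round l; an element meeting unexpectedly many of them gives up, which is what bounds the number of queries.
  alive : ℕ → Fin n → Bool
  chain : ℕ → Fin n → ℕ → Maybe (List (Fin m))
  alive zero    e = U e
  alive (suc j) e = alive j e ∧ deserted (chain j e j)
  chain j e zero    = just (filterᵇ (λ S → heavy S ∧ accepts S (alive 0) (τ 0 S)) (filterᵇ (coin j) (setsOf I e)))
  chain j e (suc l) = extend (2 ^ (j ∸ l) * B) (λ S → accepts S (alive (suc l)) (τ (suc l) S)) (chain j e l)

  -- A single failed test deactivates a set for the rest of the stage, so that the number of active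
  -- sets around an element can only decrease.
  active : ℕ → Fin m → Bool
  active zero    S = heavy S
  active (suc l) S = active l S ∧ accepts S (alive l) (τ l S)

  joined : ℕ → Fin m → Bool
  joined j S = coin j S ∧ active (suc j) S

  joinedBefore : ℕ → Fin m → Bool
  joinedBefore zero    S = false
  joinedBefore (suc j) S = joinedBefore j S ∨ joined j S

  -- An exact count instead of a sample. It secures the size bound for the next scale on every tape,
  -- including those on which tests have erred.
  final : Fin m → Bool
  final S = 2 ^ i ≤ᵇ length (filterᵇ (alive R) (elemsOf I S))

  chosen : Fin m → Bool
  chosen S = joinedBefore R S ∨ final S

  next : Fin n → Bool
  next e = alive R e ∧ null (filterᵇ final (setsOf I e))

  lost : Fin n → Bool
  lost e = U e ∧ (not (next e) ∧ null (filterᵇ chosen (setsOf I e)))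

  -- Phrased with `active` rather than `chain`, so that its probability can be computed with the
  -- active sets around `e` frozen.
  overflow : ℕ → ℕ → Fin n → Bool
  overflow l j e = not (length (filterᵇ (λ S → coin j S ∧ active (suc l) S) (setsOf I e)) ≤ᵇ 2 ^ (j ∸ l) * B)

  -- Giving up is the only deviation of the truncated computation from the process it simulates.
  chain-just : ∀ j e l {xs} → chain j e l ≡ just xs → xs ≡ filterᵇ (λ S → coin j S ∧ active (suc l) S) (setsOf I e)
  chain-just j e zero refl = filterᵇ-∧ (coin j) (λ S → heavy S ∧ accepts S (alive 0) (τ 0 S)) (setsOf I e)
  chain-just j e (suc l) eq with chain j e l in eql
  ... | just ys with length ys ≤ᵇ 2 ^ (j ∸ l) * B
  chain-just j e (suc l) refl | just ys | true = trans
    (cong (filterᵇ (λ S → accepts S (alive (suc l)) (τ (suc l) S))) (chain-just j e l eql))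
    (trans (filterᵇ-∧ (λ S → coin j S ∧ active (suc l) S) _ (setsOf I e))
           (filterᵇ-cong (λ S → ∧-assoc (coin j S) (active (suc l) S) _) (setsOf I e)))

  chain-nothing : ∀ j e l → chain j e l ≡ nothing → Σ ℕ λ l′ → l′ < l × overflow l′ j e ≡ true
  chain-nothing j e (suc l) eq with chain j e l in eql
  ... | nothing = let (l′ , p , o) = chain-nothing j e l eql in l′ , m<n⇒m<1+n p , o
  ... | just ys with length ys ≤ᵇ 2 ^ (j ∸ l) * B in le
  ...   | false = l , ≤-refl , cong not (trans (cong (λ zs → length zs ≤ᵇ 2 ^ (j ∸ l) * B) (sym (chain-just j e l eql))) le)

  alive-pred : ∀ j e → alive (suc j) e ≡ true → alive j e ≡ true
  alive-pred j e h = proj₁ (∧-elim h)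

  alive-≤ : ∀ {l} j e → l ≤ j → alive j e ≡ true → alive l e ≡ true
  alive-≤ {l} zero    e z≤n h = h
  alive-≤ {l} (suc j) e le  h with l ≟ suc j
  ... | yes refl = h
  ... | no  l≢   = alive-≤ j e (≤-pred (≤∧≢⇒< le l≢)) (alive-pred j e h)

  alive-none : ∀ j e → alive (suc j) e ≡ true → null (filterᵇ (joined j) (setsOf I e)) ≡ true
  alive-none j e h with chain j e j in eq | proj₂ (∧-elim {alive j e} h)
  ... | just xs | d = subst (λ zs → null zs ≡ true) (chain-just j e j eq) d

  alive-fails : ∀ j e → alive j e ≡ true → alive (suc j) e ≡ false →
    (Σ (Fin m) λ S → S ∈ setsOf I e × joined j S ≡ true) ⊎ (Σ ℕ λ l → l < j × overflow l j e ≡ true)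
  alive-fails j e h h′ with alive j e | chain j e j in eq
  ... | true | nothing = inj₂ (chain-nothing j e j eq)
  ... | true | just xs = inj₁ (filterᵇ-null (joined j) (setsOf I e) (subst (λ zs → null zs ≡ false) (chain-just j e j eq) h′))

  joined⇒chosen : ∀ {j S} → j < R → joined j S ≡ true → chosen S ≡ true
  joined⇒chosen {j} {S} j<R h = ∨-intro (before R j<R)
    where
    ∨-intro : ∀ {a b} → a ≡ true → a ∨ b ≡ true
    ∨-intro refl = refl
    before : ∀ r → j < r → joinedBefore r S ≡ true
    before (suc r) (s≤s p) with j ≟ r
    ... | yes refl = trans (cong (joinedBefore r S ∨_) h) (∨-zeroʳ _)
    ... | no  j≢r  = ∨-intro (before r (≤∧≢⇒< p j≢r))

  -- An element that leaves because a set joined or passed the final test is covered by that set, so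
  -- giving up is the only cause left. That `e` is alive in round `j` belongs to the conclusion,
  -- since overflow is improbable only in conjunction with having survived round `l`.
  lost⇒overflow : ∀ e → lost e ≡ true → Σ ℕ λ j → Σ ℕ λ l → l < j × j < R × alive j e ≡ true × overflow l j e ≡ true
  lost⇒overflow e h with ∧-elim {U e} h
  ... | Ue , h₂ with ∧-elim {not (next e)} h₂
  ... | ne , unc = search R ≤-refl dead
    where
    dead : alive R e ≡ false
    dead with alive R e | not-true ne
    ... | false | _  = refl
    ... | true  | no-final with filterᵇ-null final (setsOf I e) no-final
    ...   | S , S∈ , fS = false≢true (null-filterᵇ chosen (setsOf I e) unc S∈) (trans (cong (joinedBefore R S ∨_) fS) (∨-zeroʳ _))
    search : ∀ r → r ≤ R → alive r e ≡ false → Σ ℕ λ j → Σ ℕ λ l → l < j × j < R × alive j e ≡ true × overflow l j e ≡ true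
    search zero    le d = false≢true d Ue
    search (suc r) le d with alive r e in eq
    ... | false = search r (<⇒≤ le) eq
    ... | true  with alive-fails r e eq (trans (cong (_∧ deserted (chain r e r)) eq) d)
    ...   | inj₂ (l , p , o)  = r , l , p , le , eq , o
    ...   | inj₁ (S , S∈ , j) = false≢true (null-filterᵇ chosen (setsOf I e) unc S∈) (joined⇒chosen le j)

  -- A set failing the final test has few alive elements, and one passing it removes all of its
  -- elements from `next`.
  next-light : ∀ S → length (filterᵇ next (elemsOf I S)) < 2 ^ i
  next-light S with final S in eq
  ... | false = ≤-<-trans (length-filterᵇ-mono (λ e h → proj₁ (∧-elim h)) (elemsOf I S)) (≤ᵇ-false (2 ^ i) _ eq)
  ... | true  = ≤-<-trans (≤-trans (≤-reflexive (length-filterᵇ next (elemsOf I S)))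
                   (≤-trans (∑-mono-∈ (elemsOf I S) {g = λ _ → 0} gone) (≤-reflexive (∑-0 (elemsOf I S))))) (m^n>0 2 i)
    where
    gone : ∀ e → e ∈ elemsOf I S → 𝟙 (next e) ≤ 0
    gone e e∈ with next e in ne
    ... | false = z≤n
    ... | true  = false≢true (null-filterᵇ final (setsOf I e) (proj₂ (∧-elim {alive R e} ne)) (Equivalence.to (incidence I S e) e∈)) eq

module _ {n m s t : ℕ} (I : Instance n m s t) (R B k i : ℕ) (U : Fin n → Bool)
         {coin coin′ : ℕ → Fin m → Bool} {τ τ′ : ℕ → Fin m → Out (gateSpace (bitSpace (suc i)) k)} where
  private
    module A = Stage I R B k i U coin τ
    module A′ = Stage I R B k i U coin′ τ′

  accepts-cong : ∀ {al al′ : Fin n → Bool} {x x′} S → (∀ e → al e ≡ al′ e) → x ≡ x′ → A.accepts S al x ≡ A′.accepts S al′ x′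
  accepts-cong {x = x} S h refl = gate-cong k (λ v → holds-cong h (pick (suc i) v (A.residual S))) x

  -- Causality: the state at the start of round `j` is a function of the earlier rounds, and hence
  -- unaffected when round `j` is resampled.
  alive-cong : ∀ j → (∀ l → l < j → ∀ S → coin l S ≡ coin′ l S) → (∀ l → l < j → ∀ S → τ l S ≡ τ′ l S) →
    ∀ e → A.alive j e ≡ A′.alive j e
  chain-cong : ∀ j l → l ≤ j → (∀ l → l < suc j → ∀ S → coin l S ≡ coin′ l S) → (∀ l → l < suc j → ∀ S → τ l S ≡ τ′ l S) →
    ∀ e → A.chain j e l ≡ A′.chain j e l
  alive-cong zero    hc hτ e = refl
  alive-cong (suc j) hc hτ e = cong₂ _∧_
    (alive-cong j (λ l p → hc l (m<n⇒m<1+n p)) (λ l p → hτ l (m<n⇒m<1+n p)) e)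
    (cong deserted (chain-cong j j ≤-refl hc hτ e))
  chain-cong j zero le hc hτ e = cong just (trans
    (cong (filterᵇ (λ S → A.heavy S ∧ A.accepts S (A.alive 0) (τ 0 S))) (filterᵇ-cong (hc j ≤-refl) (setsOf I e)))
    (filterᵇ-cong (λ S → cong (A.heavy S ∧_) (accepts-cong S (λ e → refl) (hτ 0 (s≤s z≤n) S))) (filterᵇ (coin′ j) (setsOf I e))))
  chain-cong j (suc l) le hc hτ e = trans
    (cong (extend (2 ^ (j ∸ l) * B) _) (chain-cong j l (<⇒≤ le) hc hτ e))
    (extend-cong (2 ^ (j ∸ l) * B) (λ S → accepts-cong S
       (alive-cong (suc l) (λ l′ p → hc l′ (m≤n⇒m≤1+n (≤-trans p le))) (λ l′ p → hτ l′ (m≤n⇒m≤1+n (≤-trans p le))))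
       (hτ (suc l) (s≤s le) S)) (A′.chain j e l))

  -- Within a round the test precedes the coin: `active (suc j)` sees the tests of round `j` but not
  -- its coins, so those coins are independent of the sets they are thrown for.
  active-cong : ∀ j → (∀ l → l < j → ∀ S → coin l S ≡ coin′ l S) → (∀ l → l < suc j → ∀ S → τ l S ≡ τ′ l S) →
    ∀ S → A.active (suc j) S ≡ A′.active (suc j) S
  active-cong zero    hc hτ S = cong (A.heavy S ∧_) (accepts-cong S (λ e → refl) (hτ 0 (s≤s z≤n) S))
  active-cong (suc j) hc hτ S = cong₂ _∧_
    (active-cong j (λ l p → hc l (m<n⇒m<1+n p)) (λ l p → hτ l (m<n⇒m<1+n p)) S)
    (accepts-cong S (alive-cong (suc j) hc (λ l p → hτ l (m<n⇒m<1+n p))) (hτ (suc j) ≤-refl S))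

-- Expected cost of a stage

count-cong : ∀ {m} {f g : Fin m → Bool} → (∀ i → f i ≡ g i) → count f ≡ count g
count-cong {zero}  h = refl
count-cong {suc m} h = cong₂ _+_ (cong 𝟙 (h Fin.zero)) (count-cong (λ i → h (Fin.suc i)))

length-filterᵇ-unique : ∀ {m} (f : Fin m → Bool) xs → Unique xs →
  length (filterᵇ f xs) ≡ count (λ S → (S ∈ᵇ xs) ∧ f S)
length-filterᵇ-unique {m} f xs u = trans (length-filterᵇ f xs) (trans (∑-unique xs u (λ S → 𝟙 (f S)))
  (trans (∑-cong (allFin m) (λ S → if-𝟙 (S ∈ᵇ xs) (f S))) (∑-count m _)))
  where
  if-𝟙 : ∀ a b → (if a then 𝟙 b else 0) ≡ 𝟙 (a ∧ b)
  if-𝟙 true  b = refl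
  if-𝟙 false b = refl

null-length : ∀ {A : Set} (xs : List A) → null xs ≡ true → length xs ≡ 0
null-length [] _ = refl

-- Requiring `R ∸ j` true bits gives success probability 2^(j-R), which doubles with every round and
-- ends at 1/2.
coinAt : ∀ m R → Vec (Out (power (bitSpace R) m)) R → ℕ → Fin m → Bool
coinAt m R κ j S = allTrue (R ∸ j) (lookup (at (default (power (bitSpace R) m)) κ j) S)

testAt : ∀ m R Ω → Vec (Out (power Ω m)) R → ℕ → Fin m → Out Ω
testAt m R Ω θ j S = lookup (at (default (power Ω m)) θ j) S

module Analysis {n m s t : ℕ} (I : Instance n m s t) (R B k i : ℕ) (U : Fin n → Bool) where

  TestSpace CoinSpace : Space
  TestSpace = power (gateSpace (bitSpace (suc i)) k) m
  CoinSpace = power (bitSpace R) m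

  coinOf : Vec (Out CoinSpace) R → ℕ → Fin m → Bool
  coinOf = coinAt m R

  testOf : Vec (Out TestSpace) R → ℕ → Fin m → Out (gateSpace (bitSpace (suc i)) k)
  testOf = testAt m R (gateSpace (bitSpace (suc i)) k)

  module St (θ : Vec (Out TestSpace) R) (κ : Vec (Out CoinSpace) R) = Stage I R B k i U (coinOf κ) (testOf θ)

  coins : List (Vec (Out CoinSpace) R)
  coins = outs (power CoinSpace R)

  flips : List (Out CoinSpace)
  flips = outs CoinSpace

  tests : List (Vec (Out TestSpace) R)
  tests = outs (power TestSpace R)

  coinOf-put : ∀ κ j x {l} → l < j → ∀ S → coinOf (put κ j x) l S ≡ coinOf κ l S
  coinOf-put κ j x {l} l<j S = cong (λ v → allTrue (R ∸ l) (lookup v S)) (at-put-≢ (default CoinSpace) κ x (<⇒≢ l<j))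

  testOf-put : ∀ θ j x {l} → l < j → ∀ S → testOf (put θ j x) l S ≡ testOf θ l S
  testOf-put θ j x l<j S = cong (λ v → lookup v S) (at-put-≢ (default TestSpace) θ x (<⇒≢ l<j))

  alive-coins : ∀ θ κ j x {l} → l ≤ j → ∀ e → St.alive θ (put κ j x) l e ≡ St.alive θ κ l e
  alive-coins θ κ j x {l} le = alive-cong I R B k i U l (λ l′ p → coinOf-put κ j x (≤-trans p le)) (λ l′ p S → refl)

  alive-tests : ∀ θ κ j x {l} → l ≤ j → ∀ e → St.alive (put θ j x) κ l e ≡ St.alive θ κ l e
  alive-tests θ κ j x {l} le = alive-cong I R B k i U l (λ l′ p S → refl) (λ l′ p → testOf-put θ j x (≤-trans p le))

  active-coins : ∀ θ κ j x {l} → l ≤ suc j → ∀ S → St.active θ (put κ j x) l S ≡ St.active θ κ l S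
  active-coins θ κ j x {zero}  le S = refl
  active-coins θ κ j x {suc l} (s≤s le) S =
    active-cong I R B k i U l (λ l′ p → coinOf-put κ j x (≤-trans p le)) (λ l′ p S → refl) S

  near : ∀ θ κ l e → Fin m → Bool
  near θ κ l e S = (S ∈ᵇ setsOf I e) ∧ St.active θ κ l S

  deg : ∀ θ κ l e → ℕ
  deg θ κ l e = count (near θ κ l e)

  near-coins : ∀ θ κ j x {l} → l ≤ suc j → ∀ e S → near θ (put κ j x) l e S ≡ near θ κ l e S
  near-coins θ κ j x le e S = cong ((S ∈ᵇ setsOf I e) ∧_) (active-coins θ κ j x le S)

  deg-∑ : ∀ θ κ l e → deg θ κ l e ≡ ∑ (setsOf I e) (λ S → 𝟙 (St.active θ κ l S))
  deg-∑ θ κ l e = trans (sym (length-filterᵇ-unique (St.active θ κ l) (setsOf I e) (setsOf-unique I e)))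
    (length-filterᵇ (St.active θ κ l) (setsOf I e))

  deg≤t : ∀ θ κ l e → deg θ κ l e ≤ t
  deg≤t θ κ l e = begin
    deg θ κ l e ≡⟨ deg-∑ θ κ l e ⟩
    ∑ (setsOf I e) (λ S → 𝟙 (St.active θ κ l S)) ≤⟨ ∑-𝟙≤ (setsOf I e) (St.active θ κ l) ⟩
    length (setsOf I e) ≤⟨ elemFreq I e ⟩
    t ∎
    where open ≤-Reasoning

  deg-suc : ∀ θ κ l e → deg θ κ (suc l) e ≤ deg θ κ l e
  deg-suc θ κ l e = begin
    deg θ κ (suc l) e ≡⟨ deg-∑ θ κ (suc l) e ⟩
    ∑ (setsOf I e) (λ S → 𝟙 (St.active θ κ (suc l) S)) ≤⟨ ∑-mono (setsOf I e) (λ S → 𝟙-mono (λ h → proj₁ (∧-elim h))) ⟩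
    ∑ (setsOf I e) (λ S → 𝟙 (St.active θ κ l S)) ≡⟨ sym (deg-∑ θ κ l e) ⟩
    deg θ κ l e ∎
    where open ≤-Reasoning

  success : ℕ → Vec Bool R → Bool
  success j = allTrue (R ∸ j)

  ∑-success : ∀ j → 2 ^ (R ∸ j) * ∑ (outs (bitSpace R)) (λ x → 𝟙 (success j x)) ≡ size (bitSpace R)
  ∑-success j = ∑-allTrue R (R ∸ j) (m∸n≤m R j)

  2^R∸ : ∀ {j r} → j ≤ r → 2 ^ j * 2 ^ (r ∸ j) ≡ 2 ^ r
  2^R∸ {j} {r} le = trans (sym (^-distribˡ-+-* 2 j (r ∸ j))) (cong (2 ^_) (m+[n∸m]≡n le))

  -- The coin of round `j` over the denominator P of round `l`: its probability is Q/P with Q =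
  -- 2^(j-l), the form that `none-many-≤` expects.
  ∑-success₂ : ∀ {l j} → l ≤ j → j ≤ R → 2 ^ (R ∸ l) * ∑ (outs (bitSpace R)) (λ x → 𝟙 (success j x)) ≡ 2 ^ (j ∸ l) * size (bitSpace R)
  ∑-success₂ {l} {j} l≤j j≤R = begin
    2 ^ (R ∸ l) * w ≡⟨ cong (λ e → 2 ^ e * w) (sym e≡) ⟩
    2 ^ (j ∸ l + (R ∸ j)) * w ≡⟨ cong (_* w) (^-distribˡ-+-* 2 (j ∸ l) (R ∸ j)) ⟩
    2 ^ (j ∸ l) * 2 ^ (R ∸ j) * w ≡⟨ *-assoc (2 ^ (j ∸ l)) (2 ^ (R ∸ j)) w ⟩
    2 ^ (j ∸ l) * (2 ^ (R ∸ j) * w) ≡⟨ cong (2 ^ (j ∸ l) *_) (∑-success j) ⟩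
    2 ^ (j ∸ l) * size (bitSpace R) ∎
    where
    open ≡-Reasoning
    w : ℕ
    w = ∑ (outs (bitSpace R)) (λ x → 𝟙 (success j x))
    e≡ : j ∸ l + (R ∸ j) ≡ R ∸ l
    e≡ = trans (sym (+-∸-comm (R ∸ j) l≤j)) (cong (_∸ l) (m+[n∸m]≡n j≤R))

  joined-hits : ∀ θ κ j l x e → j < R →
    length (filterᵇ (λ S → coinOf (put κ j x) j S ∧ St.active θ κ l S) (setsOf I e)) ≡ hits (near θ κ l e) (success j) x
  joined-hits θ κ j l x e j<R = trans (length-filterᵇ-unique _ (setsOf I e) (setsOf-unique I e)) (count-cong eq)
    where
    rot : ∀ a b c → a ∧ (b ∧ c) ≡ (a ∧ c) ∧ b
    rot true  true  c = sym (∧-identityʳ c)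
    rot true  false c = sym (∧-zeroʳ c)
    rot false b     c = refl
    eq : ∀ S → (S ∈ᵇ setsOf I e) ∧ (coinOf (put κ j x) j S ∧ St.active θ κ l S) ≡ near θ κ l e S ∧ success j (lookup x S)
    eq S = trans (rot (S ∈ᵇ setsOf I e) (coinOf (put κ j x) j S) (St.active θ κ l S))
      (cong (near θ κ l e S ∧_) (cong (λ v → success j (lookup v S)) (at-put (default CoinSpace) κ x j<R)))

  alive-none-hits : ∀ θ κ j x e → j < R → St.alive θ (put κ j x) (suc j) e ≡ true →
    (hits (near θ κ (suc j) e) (success j) x ≤ᵇ 0) ≡ true
  alive-none-hits θ κ j x e j<R h = true-≤ᵇ _ 0 (≤-reflexive (trans (sym (joined-hits θ κ j (suc j) x e j<R))
    (trans (cong length (filterᵇ-cong (λ S → cong (coinOf (put κ j x) j S ∧_) (sym (active-coins θ κ j x ≤-refl S))) (setsOf I e)))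
           (null-length _ (St.alive-none θ (put κ j x) j e h)))))

  spent : ∀ θ κ j e → ℕ
  spent θ κ j e = ∑< j (λ l → 2 ^ l * (𝟙 (St.alive θ κ l e) * deg θ κ (suc l) e))

  -- A supermartingale: what e pays in round l is 2^(l-R) times its number of active sets, which is at most doubled from
  -- one round to the next, while e stays alive with probability at most (1-p)^N ≤ 1/(1+pN).
  potential : ∀ θ κ j e → ℕ
  potential θ κ j e = spent θ κ j e + 𝟙 (St.alive θ κ j e) * (2 * 2 ^ R + 2 ^ j * deg θ κ j e)

  spent-coins : ∀ θ κ j x e → spent θ (put κ j x) j e ≡ spent θ κ j e
  spent-coins θ κ j x e = ∑<-cong j (λ l l<j → cong₂ (λ a b → 2 ^ l * (𝟙 a * b))
    (alive-coins θ κ j x (<⇒≤ l<j) e) (count-cong (near-coins θ κ j x (s≤s (<⇒≤ l<j)) e)))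

  potential-step : ∀ θ j e → j < R → ∑ coins (λ κ → potential θ κ (suc j) e) ≤ ∑ coins (λ κ → potential θ κ j e)
  potential-step θ j e j<R = resample-≤ CoinSpace R j<R (λ κ → potential θ κ (suc j) e) (λ κ → potential θ κ j e) step
    where
    step : ∀ κ → ∑ flips (λ x → potential θ (put κ j x) (suc j) e) ≤ ∑ flips (λ x → potential θ (put κ j x) j e)
    step κ = begin
      ∑ flips (λ x → potential θ (put κ j x) (suc j) e)
        ≤⟨ ∑-mono flips upper ⟩
      -- Since 2^R = 2^j P, the bracket of the next potential is 2 · 2^j (P + N), a multiple of the
      -- weight that survival with probability at most P/(P + N) cancels. What is left, 2 · 2^R,
      -- together with the payment 2^j N of this round is at most the old bracket.
      ∑ flips (λ x → (W + 2 ^ j * (a * N)) + 2 * 2 ^ j * a * ((P + N) * 𝟙 (none x)))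
        ≡⟨ trans (∑-+ flips _ _) (cong₂ _+_ (∑-const flips _)
             (trans (∑-*ˡ flips (2 * 2 ^ j * a) _) (cong (2 * 2 ^ j * a *_) (∑-*ˡ flips (P + N) _)))) ⟩
      z * (W + 2 ^ j * (a * N)) + 2 * 2 ^ j * a * ((P + N) * ∑ flips (λ x → 𝟙 (none x)))
        ≤⟨ +-monoʳ-≤ _ (*-monoʳ-≤ (2 * 2 ^ j * a)
             (none-weighted-≤ (bitSpace R) (success j) P {{m^n≢0 2 (R ∸ j)}} (∑-success j) m (near θ κ (suc j) e))) ⟩
      z * (W + 2 ^ j * (a * N)) + 2 * 2 ^ j * a * (P * z)
        ≡⟨ lem z W (2 ^ j) a N P ⟩
      z * (W + a * (2 * (2 ^ j * P) + 2 ^ j * N))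
        ≡⟨ cong (λ p → z * (W + a * (2 * p + 2 ^ j * N))) (2^R∸ (<⇒≤ j<R)) ⟩
      z * (W + a * (2 * 2 ^ R + 2 ^ j * N))
        ≤⟨ *-monoʳ-≤ z (+-monoʳ-≤ W (*-monoʳ-≤ a (+-monoʳ-≤ (2 * 2 ^ R) (*-monoʳ-≤ (2 ^ j) (deg-suc θ κ j e))))) ⟩
      z * potential θ κ j e
        ≡⟨ sym (∑-const flips _) ⟩
      ∑ flips (λ x → potential θ κ j e)
        ≡⟨ ∑-cong flips (λ x → sym (cong₂ _+_ (spent-coins θ κ j x e)
             (cong₂ (λ b d → 𝟙 b * (2 * 2 ^ R + 2 ^ j * d)) (alive-coins θ κ j x ≤-refl e)
                (count-cong (near-coins θ κ j x (n≤1+n j) e))))) ⟩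
      ∑ flips (λ x → potential θ (put κ j x) j e) ∎
      where
      open ≤-Reasoning
      W a N P z : ℕ
      W = spent θ κ j e
      a = 𝟙 (St.alive θ κ j e)
      N = deg θ κ (suc j) e
      P = 2 ^ (R ∸ j)
      z = size CoinSpace
      none : Vec (Vec Bool R) m → Bool
      none x = hits (near θ κ (suc j) e) (success j) x ≤ᵇ 0
      lem : ∀ z W J a N P → z * (W + J * (a * N)) + 2 * J * a * (P * z) ≡ z * (W + a * (2 * (J * P) + J * N))
      lem = solve-∀
      lem2 : ∀ a c J P N → a * c * (2 * (J * P) + 2 * J * N) ≡ 2 * J * a * ((P + N) * c)
      lem2 = solve-∀
      stays : ∀ x → 𝟙 (St.alive θ (put κ j x) (suc j) e) ≤ a * 𝟙 (none x)
      stays x = ≤-trans (𝟙-mono (λ h → ∧-intro (trans (sym (alive-coins θ κ j x ≤-refl e)) (St.alive-pred θ (put κ j x) j e h))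
        (alive-none-hits θ κ j x e j<R h))) (≤-reflexive (𝟙-∧ (St.alive θ κ j e) (none x)))
      upper : ∀ x → potential θ (put κ j x) (suc j) e ≤ (W + 2 ^ j * (a * N)) + 2 * 2 ^ j * a * ((P + N) * 𝟙 (none x))
      upper x = begin
        spent θ (put κ j x) j e + 2 ^ j * (𝟙 (St.alive θ (put κ j x) j e) * deg θ (put κ j x) (suc j) e)
          + 𝟙 (St.alive θ (put κ j x) (suc j) e) * (2 * 2 ^ R + 2 * 2 ^ j * deg θ (put κ j x) (suc j) e)
          ≡⟨ cong₂ (λ d c → spent θ (put κ j x) j e + 2 ^ j * (c * d)
               + 𝟙 (St.alive θ (put κ j x) (suc j) e) * (2 * 2 ^ R + 2 * 2 ^ j * d))
               (count-cong (near-coins θ κ j x ≤-refl e)) (cong 𝟙 (alive-coins θ κ j x ≤-refl e)) ⟩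
        spent θ (put κ j x) j e + 2 ^ j * (a * N) + 𝟙 (St.alive θ (put κ j x) (suc j) e) * (2 * 2 ^ R + 2 * 2 ^ j * N)
          ≡⟨ cong (λ w → w + 2 ^ j * (a * N) + 𝟙 (St.alive θ (put κ j x) (suc j) e) * (2 * 2 ^ R + 2 * 2 ^ j * N)) (spent-coins θ κ j x e) ⟩
        W + 2 ^ j * (a * N) + 𝟙 (St.alive θ (put κ j x) (suc j) e) * (2 * 2 ^ R + 2 * 2 ^ j * N)
          ≤⟨ +-monoʳ-≤ (W + 2 ^ j * (a * N)) (*-monoˡ-≤ (2 * 2 ^ R + 2 * 2 ^ j * N) (stays x)) ⟩
        W + 2 ^ j * (a * N) + a * 𝟙 (none x) * (2 * 2 ^ R + 2 * 2 ^ j * N)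
          ≡⟨ cong (λ p → W + 2 ^ j * (a * N) + a * 𝟙 (none x) * (2 * p + 2 * 2 ^ j * N)) (sym (2^R∸ (<⇒≤ j<R))) ⟩
        W + 2 ^ j * (a * N) + a * 𝟙 (none x) * (2 * (2 ^ j * P) + 2 * 2 ^ j * N)
          ≡⟨ cong (W + 2 ^ j * (a * N) +_) (lem2 a (𝟙 (none x)) (2 ^ j) P N) ⟩
        (W + 2 ^ j * (a * N)) + 2 * 2 ^ j * a * ((P + N) * 𝟙 (none x)) ∎

  potential-≤ : ∀ θ j e → j ≤ R → ∑ coins (λ κ → potential θ κ j e) ≤ ∑ coins (λ κ → potential θ κ 0 e)
  potential-≤ θ zero    e le = ≤-refl
  potential-≤ θ (suc j) e le = ≤-trans (potential-step θ j e le) (potential-≤ θ j e (<⇒≤ le))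

  -- The starting potential of an element of `U` is 2 · 2^R plus its degree, which is at most t ≤
  -- 2^R. The extra term on the left covers sets still active after the last round, which the final
  -- test may choose.
  total-spent-≤ : t ≤ 2 ^ R → ∀ θ e →
    ∑ coins (λ κ → spent θ κ R e + 2 ^ R * (𝟙 (St.alive θ κ R e) * deg θ κ R e)) ≤ length coins * (3 * 2 ^ R * 𝟙 (U e))
  total-spent-≤ t≤ θ e = begin
    ∑ coins (λ κ → spent θ κ R e + 2 ^ R * (𝟙 (St.alive θ κ R e) * deg θ κ R e))
      ≤⟨ ∑-mono coins (λ κ → +-monoʳ-≤ (spent θ κ R e) (begin
           2 ^ R * (𝟙 (St.alive θ κ R e) * deg θ κ R e) ≡⟨ x∙yz≈y∙xz (2 ^ R) (𝟙 (St.alive θ κ R e)) (deg θ κ R e) ⟩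
           𝟙 (St.alive θ κ R e) * (2 ^ R * deg θ κ R e) ≤⟨ *-monoʳ-≤ (𝟙 (St.alive θ κ R e)) (m≤n+m _ (2 * 2 ^ R)) ⟩
           𝟙 (St.alive θ κ R e) * (2 * 2 ^ R + 2 ^ R * deg θ κ R e) ∎)) ⟩
    ∑ coins (λ κ → potential θ κ R e) ≤⟨ potential-≤ θ R e ≤-refl ⟩
    ∑ coins (λ κ → potential θ κ 0 e)
      ≤⟨ ∑-mono coins (λ κ → *-monoʳ-≤ (𝟙 (U e)) (+-monoʳ-≤ (2 * 2 ^ R) (*-monoʳ-≤ 1 (≤-trans (deg≤t θ κ 0 e) t≤)))) ⟩
    ∑ coins (λ κ → 𝟙 (U e) * (2 * 2 ^ R + 1 * 2 ^ R))
      ≡⟨ trans (∑-const coins _) (cong (length coins *_) (lem2 (𝟙 (U e)) (2 ^ R))) ⟩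
    length coins * (3 * 2 ^ R * 𝟙 (U e)) ∎
    where
    open ≤-Reasoning
    lem2 : ∀ u r → u * (2 * r + 1 * r) ≡ 3 * r * u
    lem2 = solve-∀

-- Charging chosen sets to alive elements and to test errors

module StageCost {n m s t : ℕ} (I : Instance n m s t) (R B k i : ℕ) (U : Fin n → Bool) where
  open Analysis I R B k i U

  Tape₁ : Set
  Tape₁ = Vec (Out TestSpace) R
  Tape₂ : Set
  Tape₂ = Vec (Out CoinSpace) R

  alive#  : ℕ
  alive# = ∑ (allFin n) (λ e → 𝟙 (U e))

  resid : Tape₁ → Tape₂ → ℕ → Fin m → ℕ
  resid θ κ j S = length (filterᵇ (St.alive θ κ j) (elemsOf I S))

  resid-∑ : ∀ θ κ j S → resid θ κ j S ≡ ∑ (elemsOf I S) (λ e → 𝟙 (St.alive θ κ j e))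
  resid-∑ θ κ j S = length-filterᵇ (St.alive θ κ j) (elemsOf I S)

  resid-coins : ∀ θ κ j x S → resid θ (put κ j x) j S ≡ resid θ κ j S
  resid-coins θ κ j x S = cong length (filterᵇ-cong (alive-coins θ κ j x ≤-refl) (elemsOf I S))

  resid-tests : ∀ θ κ j x S → resid (put θ j x) κ j S ≡ resid θ κ j S
  resid-tests θ κ j x S = cong length (filterᵇ-cong (alive-tests θ κ j x ≤-refl) (elemsOf I S))

  resid-mono : ∀ θ κ {l j} S → l ≤ j → resid θ κ j S ≤ resid θ κ l S
  resid-mono θ κ {l} {j} S le = length-filterᵇ-mono (λ e → St.alive-≤ θ κ j e le) (elemsOf I S)

  resid-swap : ∀ θ κ l j → ∑ (allFin m) (λ S → 𝟙 (St.active θ κ l S) * resid θ κ j S)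
               ≡ ∑ (allFin n) (λ e → 𝟙 (St.alive θ κ j e) * deg θ κ l e)
  resid-swap θ κ l j = begin
    ∑ (allFin m) (λ S → 𝟙 (St.active θ κ l S) * resid θ κ j S)
      ≡⟨ ∑-cong (allFin m) (λ S → trans (cong (𝟙 (St.active θ κ l S) *_) (resid-∑ θ κ j S))
           (sym (∑-*ˡ (elemsOf I S) (𝟙 (St.active θ κ l S)) _))) ⟩
    ∑ (allFin m) (λ S → ∑ (elemsOf I S) (λ e → 𝟙 (St.active θ κ l S) * 𝟙 (St.alive θ κ j e)))
      ≡⟨ ∑-incidence I (λ S e → 𝟙 (St.active θ κ l S) * 𝟙 (St.alive θ κ j e)) ⟩
    ∑ (allFin n) (λ e → ∑ (setsOf I e) (λ S → 𝟙 (St.active θ κ l S) * 𝟙 (St.alive θ κ j e)))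
      ≡⟨ ∑-cong (allFin n) (λ e → trans (∑-*ʳ (setsOf I e) (𝟙 (St.alive θ κ j e)) _)
           (trans (*-comm _ (𝟙 (St.alive θ κ j e))) (cong (𝟙 (St.alive θ κ j e) *_) (sym (deg-∑ θ κ l e))))) ⟩
    ∑ (allFin n) (λ e → 𝟙 (St.alive θ κ j e) * deg θ κ l e) ∎
    where open ≡-Reasoning

  -- The coin of round `j` is independent both of the activity of `S` and of its residual size at
  -- that time, so joining costs a factor 2^(j-R).
  join-gain-≤ : ∀ θ j S → j < R → ∑ coins (λ κ → 2 ^ R * (𝟙 (St.joined θ κ j S) * resid θ κ j S))
                ≤ ∑ coins (λ κ → 2 ^ j * (𝟙 (St.active θ κ (suc j) S) * resid θ κ j S))
  join-gain-≤ θ j S j<R = resample-≤ CoinSpace R j<R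
    (λ κ → 2 ^ R * (𝟙 (St.joined θ κ j S) * resid θ κ j S))
    (λ κ → 2 ^ j * (𝟙 (St.active θ κ (suc j) S) * resid θ κ j S)) step
    where
    open ≤-Reasoning
    success-≤ : 2 ^ R * ∑ (outs (bitSpace R)) (λ x → 𝟙 (success j x)) ≤ 2 ^ j * size (bitSpace R)
    success-≤ = ≤-reflexive (trans (cong (_* ∑ (outs (bitSpace R)) (λ x → 𝟙 (success j x))) (sym (2^R∸ (<⇒≤ j<R))))
      (trans (*-assoc (2 ^ j) (2 ^ (R ∸ j)) _) (cong (2 ^ j *_) (∑-success j))))
    lem : ∀ r b a c → r * (b * a * c) ≡ a * c * r * b
    lem = solve-∀
    lem2 : ∀ a r w → a * r * w ≡ a * (r * w)
    lem2 = solve-∀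
    lem3 : ∀ c j z → c * (j * z) ≡ z * (j * c)
    lem3 = solve-∀
    step : ∀ κ → ∑ flips (λ x → 2 ^ R * (𝟙 (St.joined θ (put κ j x) j S) * resid θ (put κ j x) j S))
               ≤ ∑ flips (λ x → 2 ^ j * (𝟙 (St.active θ (put κ j x) (suc j) S) * resid θ (put κ j x) j S))
    step κ = begin
      ∑ flips (λ x → 2 ^ R * (𝟙 (St.joined θ (put κ j x) j S) * resid θ (put κ j x) j S))
        ≡⟨ ∑-cong flips (λ x → trans
             (cong₂ (λ b r → 2 ^ R * (b * r))
               (trans (cong 𝟙 (cong₂ _∧_ (cong (λ v → success j (lookup v S)) (at-put (default CoinSpace) κ x j<R)) (active-coins θ κ j x ≤-refl S)))
                      (𝟙-∧ (success j (lookup x S)) (St.active θ κ (suc j) S)))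
               (resid-coins θ κ j x S))
             (lem (2 ^ R) (𝟙 (success j (lookup x S))) a r)) ⟩
      ∑ flips (λ x → a * r * 2 ^ R * 𝟙 (success j (lookup x S)))
        ≡⟨ ∑-*ˡ flips (a * r * 2 ^ R) _ ⟩
      a * r * 2 ^ R * ∑ flips (λ x → 𝟙 (success j (lookup x S)))
        ≡⟨ lem2 (a * r) (2 ^ R) _ ⟩
      a * r * (2 ^ R * ∑ flips (λ x → 𝟙 (success j (lookup x S))))
        ≤⟨ *-monoʳ-≤ (a * r) (∑-lookup-≤ (bitSpace R) S (λ v → 𝟙 (success j v)) {2 ^ R} {2 ^ j} success-≤) ⟩
      a * r * (2 ^ j * size CoinSpace)
        ≡⟨ trans (lem3 (a * r) (2 ^ j) (size CoinSpace)) (sym (∑-const flips _)) ⟩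
      ∑ flips (λ x → 2 ^ j * (a * r))
        ≡⟨ ∑-cong flips (λ x → sym (cong₂ (λ b r → 2 ^ j * (𝟙 b * r)) (active-coins θ κ j x ≤-refl S) (resid-coins θ κ j x S))) ⟩
      ∑ flips (λ x → 2 ^ j * (𝟙 (St.active θ (put κ j x) (suc j) S) * resid θ (put κ j x) j S)) ∎
      where
      a r : ℕ
      a = 𝟙 (St.active θ κ (suc j) S)
      r = resid θ κ j S

  -- The alive elements that `S` sees whenever it joins, and at the end if it is still active. They
  -- are its credit: barring test errors, every such event comes with more than 2^i / 8 of them.
  gain : Tape₁ → Tape₂ → Fin m → ℕ
  gain θ κ S = ∑< R (λ j → 𝟙 (St.joined θ κ j S) * resid θ κ j S) + 𝟙 (St.active θ κ R S) * resid θ κ R S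

  -- Double counting turns the credit of the sets into payments of the elements, where the
  -- supermartingale bounds it by 3 per element of `U`.
  total-gain-≤ : t ≤ 2 ^ R → ∀ θ → ∑ coins (λ κ → ∑ (allFin m) (gain θ κ)) ≤ length coins * (3 * alive#)
  total-gain-≤ t≤ θ = *-cancelˡ-≤ (2 ^ R) {{m^n≢0 2 R}} (begin
    2 ^ R * ∑ coins (λ κ → ∑ (allFin m) (gain θ κ))
      ≡⟨ trans (sym (∑-*ˡ coins (2 ^ R) _)) (∑-cong coins (λ κ → sym (∑-*ˡ (allFin m) (2 ^ R) (gain θ κ)))) ⟩
    ∑ coins (λ κ → ∑ (allFin m) (λ S → 2 ^ R * gain θ κ S))
      ≡⟨ ∑-swap coins (allFin m) _ ⟩
    ∑ (allFin m) (λ S → ∑ coins (λ κ → 2 ^ R * gain θ κ S))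
      ≤⟨ ∑-mono (allFin m) per-set ⟩
    ∑ (allFin m) (λ S → ∑ coins (λ κ → expected κ S))
      ≡⟨ ∑-swap (allFin m) coins _ ⟩
    ∑ coins (λ κ → ∑ (allFin m) (λ S → expected κ S))
      ≡⟨ ∑-cong coins exchange ⟩
    ∑ coins (λ κ → ∑ (allFin n) (λ e → spent θ κ R e + 2 ^ R * (𝟙 (St.alive θ κ R e) * deg θ κ R e)))
      ≡⟨ ∑-swap coins (allFin n) _ ⟩
    ∑ (allFin n) (λ e → ∑ coins (λ κ → spent θ κ R e + 2 ^ R * (𝟙 (St.alive θ κ R e) * deg θ κ R e)))
      ≤⟨ ∑-mono (allFin n) (total-spent-≤ t≤ θ) ⟩
    ∑ (allFin n) (λ e → length coins * (3 * 2 ^ R * 𝟙 (U e)))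
      ≡⟨ trans (∑-*ˡ (allFin n) (length coins) _) (cong (length coins *_) (∑-*ˡ (allFin n) (3 * 2 ^ R) _)) ⟩
    length coins * (3 * 2 ^ R * alive#)
      ≡⟨ lem (length coins) (2 ^ R) alive# ⟩
    2 ^ R * (length coins * (3 * alive#)) ∎)
    where
    open ≤-Reasoning
    lem : ∀ l r a → l * (3 * r * a) ≡ r * (l * (3 * a))
    lem = solve-∀
    expected : Tape₂ → Fin m → ℕ
    expected κ S = ∑< R (λ j → 2 ^ j * (𝟙 (St.active θ κ (suc j) S) * resid θ κ j S)) + 2 ^ R * (𝟙 (St.active θ κ R S) * resid θ κ R S)
    per-set : ∀ S → ∑ coins (λ κ → 2 ^ R * gain θ κ S) ≤ ∑ coins (λ κ → expected κ S)
    per-set S = begin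
      ∑ coins (λ κ → 2 ^ R * gain θ κ S)
        ≡⟨ ∑-cong coins (λ κ → trans (*-distribˡ-+ (2 ^ R) (∑< R (λ j → 𝟙 (St.joined θ κ j S) * resid θ κ j S)) _)
             (cong (_+ 2 ^ R * (𝟙 (St.active θ κ R S) * resid θ κ R S)) (sym (∑<-*ˡ R (2 ^ R) _)))) ⟩
      ∑ coins (λ κ → ∑< R (λ j → 2 ^ R * (𝟙 (St.joined θ κ j S) * resid θ κ j S)) + 2 ^ R * (𝟙 (St.active θ κ R S) * resid θ κ R S))
        ≡⟨ trans (∑-+ coins _ _) (cong (_+ ∑ coins (λ κ → 2 ^ R * (𝟙 (St.active θ κ R S) * resid θ κ R S))) (∑-∑< coins R _)) ⟩
      ∑< R (λ j → ∑ coins (λ κ → 2 ^ R * (𝟙 (St.joined θ κ j S) * resid θ κ j S))) + ∑ coins (λ κ → 2 ^ R * (𝟙 (St.active θ κ R S) * resid θ κ R S))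
        ≤⟨ +-monoˡ-≤ _ (∑<-mono R (λ j j<R → join-gain-≤ θ j S j<R)) ⟩
      ∑< R (λ j → ∑ coins (λ κ → 2 ^ j * (𝟙 (St.active θ κ (suc j) S) * resid θ κ j S))) + ∑ coins (λ κ → 2 ^ R * (𝟙 (St.active θ κ R S) * resid θ κ R S))
        ≡⟨ sym (trans (∑-+ coins _ _) (cong (_+ ∑ coins (λ κ → 2 ^ R * (𝟙 (St.active θ κ R S) * resid θ κ R S))) (∑-∑< coins R _))) ⟩
      ∑ coins (λ κ → expected κ S) ∎
    exchange : ∀ κ → ∑ (allFin m) (λ S → expected κ S)
                     ≡ ∑ (allFin n) (λ e → spent θ κ R e + 2 ^ R * (𝟙 (St.alive θ κ R e) * deg θ κ R e))
    exchange κ = trans (∑-+ (allFin m) _ _) (trans (cong₂ _+_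
        (trans (∑-∑< (allFin m) R _) (trans (∑<-cong R (λ j _ → scaled j (suc j) j)) (sym (∑-∑< (allFin n) R _))))
        (scaled R R R))
      (sym (∑-+ (allFin n) _ _)))
      where
      scaled : ∀ c l j → ∑ (allFin m) (λ S → 2 ^ c * (𝟙 (St.active θ κ l S) * resid θ κ j S))
                       ≡ ∑ (allFin n) (λ e → 2 ^ c * (𝟙 (St.alive θ κ j e) * deg θ κ l e))
      scaled c l j = trans (∑-*ˡ (allFin m) (2 ^ c) _) (trans (cong (2 ^ c *_) (resid-swap θ κ l j)) (sym (∑-*ˡ (allFin n) (2 ^ c) _)))

  passes : Tape₁ → Tape₂ → ℕ → Fin m → Bool
  passes θ κ j S = St.accepts θ κ S (St.alive θ κ j) (testOf θ j S)

  heavy : Fin m → Bool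
  heavy S = 2 ^ i ≤ᵇ length (filterᵇ U (elemsOf I S))

  -- Strictly between 2^i / 8 and 2^i alive elements either verdict is acceptable. Relative to the
  -- 2^(i+1) sampling slots the two thresholds are 1/16 and 1/2, the gap that the gate amplifies.
  falsePass falseFail : Tape₁ → Tape₂ → ℕ → Fin m → Bool
  falsePass θ κ j S = passes θ κ j S ∧ (8 * resid θ κ j S ≤ᵇ 2 ^ i)
  falseFail θ κ j S = not (passes θ κ j S) ∧ (2 ^ i ≤ᵇ resid θ κ j S)

  mistakes : Tape₁ → Tape₂ → Fin m → ℕ
  mistakes θ κ S = ∑< R (λ j → 𝟙 (falsePass θ κ j S) + 𝟙 (falseFail θ κ j S))

  -- A set that joins sees more than 2^i / 8 alive elements or has passed falsely. A final set is
  -- still active, with at least 2^i alive elements, or was rejected falsely. The factor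
  -- `𝟙 (heavy S)` keeps the expected number of errors proportional to the heavy sets rather than to
  -- `m`.
  charge : ∀ θ κ S → 2 ^ i * 𝟙 (St.chosen θ κ S) ≤ 8 * gain θ κ S + 2 ^ i * (𝟙 (heavy S) * mistakes θ κ S)
  charge θ κ S = begin
    K * 𝟙 (St.chosen θ κ S)
      ≤⟨ *-monoʳ-≤ K (≤-trans (𝟙-∨ (St.joinedBefore θ κ R S) _) (+-monoˡ-≤ _ (before R))) ⟩
    K * (∑< R (λ j → 𝟙 (St.joined θ κ j S)) + 𝟙 (St.final θ κ S))
      ≡⟨ trans (*-distribˡ-+ K _ (𝟙 (St.final θ κ S))) (cong (_+ K * 𝟙 (St.final θ κ S)) (sym (∑<-*ˡ R K _))) ⟩
    ∑< R (λ j → K * 𝟙 (St.joined θ κ j S)) + K * 𝟙 (St.final θ κ S)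
      ≤⟨ +-mono-≤ (∑<-mono R (λ j _ → joined-charge j)) final-charge ⟩
    ∑< R (λ j → 8 * (𝟙 (St.joined θ κ j S) * resid θ κ j S) + K * (h * 𝟙 (falsePass θ κ j S)))
      + (8 * (𝟙 (St.active θ κ R S) * resid θ κ R S) + K * (h * fails))
      ≡⟨ cong (_+ (8 * L + K * (h * fails))) (trans (∑<-+ R _ _) (cong₂ _+_ (∑<-*ˡ R 8 _) (trans (∑<-*ˡ R K _) (cong (K *_) (∑<-*ˡ R h _))))) ⟩
    (8 * G + K * (h * passed)) + (8 * L + K * (h * fails))
      ≡⟨ lem G L K h _ _ ⟩
    8 * (G + L) + K * (h * (passed + fails))
      ≡⟨ cong (λ w → 8 * (G + L) + K * (h * w)) (sym (∑<-+ R _ _)) ⟩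
    8 * gain θ κ S + K * (h * mistakes θ κ S) ∎
    where
    open ≤-Reasoning
    K h G L passed fails : ℕ
    passed = ∑< R (λ j → 𝟙 (falsePass θ κ j S))
    fails = ∑< R (λ j → 𝟙 (falseFail θ κ j S))
    K = 2 ^ i
    h = 𝟙 (heavy S)
    G = ∑< R (λ j → 𝟙 (St.joined θ κ j S) * resid θ κ j S)
    L = 𝟙 (St.active θ κ R S) * resid θ κ R S
    lem : ∀ G L K h x y → (8 * G + K * (h * x)) + (8 * L + K * (h * y)) ≡ 8 * (G + L) + K * (h * (x + y))
    lem = solve-∀
    ∑<-+ : ∀ j (f g : ℕ → ℕ) → ∑< j (λ l → f l + g l) ≡ ∑< j f + ∑< j g
    ∑<-+ zero    f g = refl
    ∑<-+ (suc j) f g = trans (cong (_+ (f j + g j)) (∑<-+ j f g)) (ℕSum.interchange (∑< j f) (∑< j g) (f j) (g j))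
    before : ∀ r → 𝟙 (St.joinedBefore θ κ r S) ≤ ∑< r (λ j → 𝟙 (St.joined θ κ j S))
    before zero    = z≤n
    before (suc r) = ≤-trans (𝟙-∨ (St.joinedBefore θ κ r S) _) (+-monoˡ-≤ _ (before r))
    active⇒heavy : ∀ l → St.active θ κ l S ≡ true → heavy S ≡ true
    active⇒heavy zero    e = e
    active⇒heavy (suc l) e = active⇒heavy l (proj₁ (∧-elim e))
    joined-charge : ∀ j → K * 𝟙 (St.joined θ κ j S) ≤ 8 * (𝟙 (St.joined θ κ j S) * resid θ κ j S) + K * (h * 𝟙 (falsePass θ κ j S))
    joined-charge j with St.joined θ κ j S in eq
    ... | false = ≤-trans (≤-reflexive (*-zeroʳ K)) z≤n
    ... | true with 8 * resid θ κ j S ≤ᵇ K in le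
    ...   | false = ≤-trans (≤-reflexive (*-identityʳ K)) (≤-trans (<⇒≤ (≤ᵇ-false _ K le))
                      (≤-trans (≤-reflexive (cong (8 *_) (sym (*-identityˡ (resid θ κ j S))))) (m≤m+n _ _)))
    ...   | true with ∧-elim {St.active θ κ j S} (proj₂ (∧-elim {coinOf κ j S} eq))
    ...     | act , pass rewrite active⇒heavy j act | pass = m≤n+m (K * 1) _
    -- Residual sizes only decrease, so a set that is large at the end was large when it was
    -- rejected, and the rejection was an error.
    rejected : ∀ r → r ≤ R → heavy S ≡ true → St.active θ κ r S ≡ false → K ≤ resid θ κ R S →
      1 ≤ fails
    rejected zero    le hv na big = false≢true na hv
    rejected (suc r) le hv na big with St.active θ κ r S in ar
    ... | false = rejected r (<⇒≤ le) hv ar big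
    ... | true  = ≤-trans (≤-reflexive (cong 𝟙 (sym (∧-intro (cong not na)
                    (true-≤ᵇ K _ (≤-trans big (resid-mono θ κ S (<⇒≤ le)))))))) (∑<-∈ R (λ j → 𝟙 (falseFail θ κ j S)) le)
    final-charge : K * 𝟙 (St.final θ κ S) ≤ 8 * (𝟙 (St.active θ κ R S) * resid θ κ R S) + K * (h * fails)
    final-charge with St.final θ κ S in eq
    ... | false = ≤-trans (≤-reflexive (*-zeroʳ K)) z≤n
    ... | true with St.active θ κ R S in aR
    ...   | true  = ≤-trans (≤-reflexive (*-identityʳ K)) (≤-trans (≤ᵇ-true K _ eq)
                      (≤-trans (m≤n*m (resid θ κ R S) 8) (≤-trans (≤-reflexive (cong (8 *_) (sym (*-identityˡ (resid θ κ R S))))) (m≤m+n _ _))))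
    ...   | false = *-monoʳ-≤ K (≤-trans (rejected R ≤-refl hv aR (≤ᵇ-true K _ eq))
                      (≤-trans (≤-reflexive (sym (*-identityˡ _))) (≤-reflexive (cong (λ b → 𝟙 b * fails) (sym hv)))))
      where
      hv : heavy S ≡ true
      hv = true-≤ᵇ K _ (≤-trans (≤ᵇ-true K _ eq) (resid-mono θ κ {0} {R} S z≤n))

-- Probability of test errors and of giving up; the total cost of a stage

module StageBound {n m s t : ℕ} (I : Instance n m s t) (R B k i : ℕ) (U : Fin n → Bool)
  (residual≤ : ∀ S → length (filterᵇ U (elemsOf I S)) ≤ 2 ^ suc i) where
  open Analysis I R B k i U
  open StageCost I R B k i U

  Γ : Space
  Γ = gateSpace (bitSpace (suc i)) k

  sampler : Tape₁ → Tape₂ → ℕ → Fin m → Vec Bool (suc i) → Bool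
  sampler θ κ j S v = holds (St.alive θ κ j) (pick (suc i) v (filterᵇ U (elemsOf I S)))

  passes-put : ∀ θ κ j x S → j < R → passes (put θ j x) κ j S ≡ gate {bitSpace (suc i)} k (sampler θ κ j S) (lookup x S)
  passes-put θ κ j x S j<R = trans
    (cong (gate {bitSpace (suc i)} k (sampler (put θ j x) κ j S)) (cong (λ v → lookup v S) (at-put (default TestSpace) θ x j<R)))
    (gate-cong k (λ v → holds-cong (alive-tests θ κ j x ≤-refl) (pick (suc i) v (filterᵇ U (elemsOf I S)))) (lookup x S))

  ∑-sampler : ∀ θ κ j S → ∑ (outs (bitSpace (suc i))) (λ v → 𝟙 (sampler θ κ j S v)) ≡ resid θ κ j S
  ∑-sampler θ κ j S = begin
    ∑ (outs (bitSpace (suc i))) (λ v → 𝟙 (sampler θ κ j S v)) ≡⟨ ∑-pick (St.alive θ κ j) (suc i) (filterᵇ U (elemsOf I S)) (residual≤ S) ⟩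
    ∑ (filterᵇ U (elemsOf I S)) (λ e → 𝟙 (St.alive θ κ j e))   ≡⟨ sym (length-filterᵇ (St.alive θ κ j) (filterᵇ U (elemsOf I S))) ⟩
    length (filterᵇ (St.alive θ κ j) (filterᵇ U (elemsOf I S))) ≡⟨ cong length (filterᵇ-∧ U (St.alive θ κ j) (elemsOf I S)) ⟩
    length (filterᵇ (λ e → U e ∧ St.alive θ κ j e) (elemsOf I S)) ≡⟨ cong length (filterᵇ-cong (λ e → bool-ext
                                                                       (λ h → proj₂ (∧-elim {U e} h))
                                                                       (λ h → ∧-intro (St.alive-≤ θ κ {0} j e z≤n h) h)) (elemsOf I S)) ⟩
    resid θ κ j S ∎
    where open ≡-Reasoning

  -- With all other rounds frozen, the event may depend on round `j` only through the samples of
  -- `S`; a bound for one gate then carries over to the whole tape.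
  ∑-test : ∀ (W : ℕ) (j : ℕ) S (κ : Tape₂) (f : Tape₁ → Bool) → j < R →
    (∀ θ → Σ (Out Γ → Bool) λ g → (∀ x → f (put θ j x) ≡ g (lookup x S)) × W * ∑ (outs Γ) (λ x → 𝟙 (g x)) ≤ size Γ) →
    W * ∑ tests (λ θ → 𝟙 (f θ)) ≤ length tests
  ∑-test W j S κ f j<R H = begin
    W * ∑ tests (λ θ → 𝟙 (f θ)) ≡⟨ sym (∑-*ˡ tests W _) ⟩
    ∑ tests (λ θ → W * 𝟙 (f θ)) ≤⟨ resample-≤ TestSpace R j<R (λ θ → W * 𝟙 (f θ)) (λ _ → 1) step ⟩
    ∑ tests (λ _ → 1) ≡⟨ trans (∑-const tests 1) (*-identityʳ _) ⟩
    length tests ∎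
    where
    open ≤-Reasoning
    step : ∀ θ → ∑ (outs TestSpace) (λ x → W * 𝟙 (f (put θ j x))) ≤ ∑ (outs TestSpace) (λ _ → 1)
    step θ = let (g , f≡g , g≤) = H θ in begin
      ∑ (outs TestSpace) (λ x → W * 𝟙 (f (put θ j x)))    ≡⟨ ∑-*ˡ (outs TestSpace) W _ ⟩
      W * ∑ (outs TestSpace) (λ x → 𝟙 (f (put θ j x)))    ≡⟨ cong (W *_) (∑-cong (outs TestSpace) (λ x → cong 𝟙 (f≡g x))) ⟩
      W * ∑ (outs TestSpace) (λ x → 𝟙 (g (lookup x S)))   ≤⟨ ∑-lookup-≤ Γ S (λ x → 𝟙 (g x)) {W} {1} (≤-trans g≤ (≤-reflexive (sym (*-identityˡ _)))) ⟩
      1 * size TestSpace ≡⟨ trans (*-identityˡ _) (sym (trans (∑-const (outs TestSpace) 1) (*-identityʳ _))) ⟩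
      ∑ (outs TestSpace) (λ _ → 1) ∎

  falsePass-≤ : ∀ κ j S → j < R → 2 ^ (2 ^ k) * ∑ tests (λ θ → 𝟙 (falsePass θ κ j S)) ≤ length tests
  falsePass-≤ κ j S j<R = ∑-test (2 ^ (2 ^ k)) j S κ (λ θ → falsePass θ κ j S) j<R split′
    where
    open ≤-Reasoning
    split′ : ∀ θ → Σ (Out Γ → Bool) λ g → (∀ x → falsePass (put θ j x) κ j S ≡ g (lookup x S)) × 2 ^ (2 ^ k) * ∑ (outs Γ) (λ x → 𝟙 (g x)) ≤ size Γ
    split′ θ = (λ x → gate {bitSpace (suc i)} k (sampler θ κ j S) x ∧ (8 * resid θ κ j S ≤ᵇ 2 ^ i))
      , (λ x → cong₂ _∧_ (passes-put θ κ j x S j<R) (cong (λ r → 8 * r ≤ᵇ 2 ^ i) (resid-tests θ κ j x S)))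
      , bound
      where
      bound : 2 ^ (2 ^ k) * ∑ (outs Γ) (λ x → 𝟙 (gate {bitSpace (suc i)} k (sampler θ κ j S) x ∧ (8 * resid θ κ j S ≤ᵇ 2 ^ i))) ≤ size Γ
      bound with 8 * resid θ κ j S ≤ᵇ 2 ^ i in le
      ... | false = ≤-trans (≤-reflexive (trans (cong (2 ^ (2 ^ k) *_) (trans (∑-cong (outs Γ) (λ x → cong 𝟙 (∧-zeroʳ _))) (∑-0 (outs Γ)))) (*-zeroʳ (2 ^ (2 ^ k))))) z≤n
      ... | true = begin
        2 ^ (2 ^ k) * ∑ (outs Γ) (λ x → 𝟙 (gate {bitSpace (suc i)} k (sampler θ κ j S) x ∧ true))
          ≤⟨ *-mono-≤ (m≤n*m (2 ^ (2 ^ k)) 4) (∑-mono (outs Γ) (λ x → 𝟙-mono (λ h → proj₁ (∧-elim h)))) ⟩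
        4 * 2 ^ (2 ^ k) * ∑ (outs Γ) (λ x → 𝟙 (gate {bitSpace (suc i)} k (sampler θ κ j S) x))
          ≤⟨ gate-accepts-≤ (bitSpace (suc i)) k (sampler θ κ j S) (begin
               16 * ∑ (outs (bitSpace (suc i))) (λ v → 𝟙 (sampler θ κ j S v)) ≡⟨ cong (16 *_) (∑-sampler θ κ j S) ⟩
               16 * resid θ κ j S ≡⟨ *-assoc 2 8 (resid θ κ j S) ⟩
               2 * (8 * resid θ κ j S)    ≤⟨ *-monoʳ-≤ 2 (≤ᵇ-true (8 * resid θ κ j S) (2 ^ i) le) ⟩
               2 ^ suc i ≡⟨ sym (size≡2^ (bitSpace (suc i))) ⟩
               size (bitSpace (suc i))    ∎) ⟩
        size Γ ∎

  falseFail-≤ : ∀ κ j S → j < R → 2 ^ (2 ^ k) * ∑ tests (λ θ → 𝟙 (falseFail θ κ j S)) ≤ length tests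
  falseFail-≤ κ j S j<R = ∑-test (2 ^ (2 ^ k)) j S κ (λ θ → falseFail θ κ j S) j<R split′
    where
    open ≤-Reasoning
    split′ : ∀ θ → Σ (Out Γ → Bool) λ g → (∀ x → falseFail (put θ j x) κ j S ≡ g (lookup x S)) × 2 ^ (2 ^ k) * ∑ (outs Γ) (λ x → 𝟙 (g x)) ≤ size Γ
    split′ θ = (λ x → not (gate {bitSpace (suc i)} k (sampler θ κ j S) x) ∧ (2 ^ i ≤ᵇ resid θ κ j S))
      , (λ x → cong₂ _∧_ (cong not (passes-put θ κ j x S j<R)) (cong (2 ^ i ≤ᵇ_) (resid-tests θ κ j x S)))
      , bound
      where
      misses : ℕ
      misses = ∑ (outs (bitSpace (suc i))) (λ v → 𝟙 (not (sampler θ κ j S v)))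
      bound : 2 ^ (2 ^ k) * ∑ (outs Γ) (λ x → 𝟙 (not (gate {bitSpace (suc i)} k (sampler θ κ j S) x) ∧ (2 ^ i ≤ᵇ resid θ κ j S))) ≤ size Γ
      bound with 2 ^ i ≤ᵇ resid θ κ j S in le
      ... | false = ≤-trans (≤-reflexive (trans (cong (2 ^ (2 ^ k) *_) (trans (∑-cong (outs Γ) (λ x → cong 𝟙 (∧-zeroʳ _))) (∑-0 (outs Γ)))) (*-zeroʳ (2 ^ (2 ^ k))))) z≤n
      ... | true = begin
        2 ^ (2 ^ k) * ∑ (outs Γ) (λ x → 𝟙 (not (gate {bitSpace (suc i)} k (sampler θ κ j S) x) ∧ true))
          ≤⟨ *-mono-≤ (m≤n*m (2 ^ (2 ^ k)) 2) (∑-mono (outs Γ) (λ x → 𝟙-mono (λ h → proj₁ (∧-elim h)))) ⟩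
        2 * 2 ^ (2 ^ k) * ∑ (outs Γ) (λ x → 𝟙 (not (gate {bitSpace (suc i)} k (sampler θ κ j S) x)))
          ≤⟨ gate-rejects-≤ (bitSpace (suc i)) k (sampler θ κ j S) (+-cancelˡ-≤ (2 ^ suc i) _ _ (begin
               2 * 2 ^ i + 2 * misses ≡⟨ sym (*-distribˡ-+ 2 (2 ^ i) misses) ⟩
               2 * (2 ^ i + misses) ≤⟨ *-monoʳ-≤ 2 (+-monoˡ-≤ misses (≤ᵇ-true (2 ^ i) _ le)) ⟩
               2 * (resid θ κ j S + misses) ≡⟨ cong (2 *_) (trans (cong (_+ misses) (sym (∑-sampler θ κ j S))) (∑-not (outs (bitSpace (suc i))) (sampler θ κ j S))) ⟩
               2 * size (bitSpace (suc i)) ≡⟨ cong (size (bitSpace (suc i)) +_) (+-identityʳ _) ⟩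
               size (bitSpace (suc i)) + size (bitSpace (suc i)) ≡⟨ cong (_+ size (bitSpace (suc i))) (size≡2^ (bitSpace (suc i))) ⟩
               2 ^ suc i + size (bitSpace (suc i)) ∎)) ⟩
        size Γ ∎

  mistakes-≤ : ∀ κ S → 2 ^ (2 ^ k) * ∑ tests (λ θ → mistakes θ κ S) ≤ R * (2 * length tests)
  mistakes-≤ κ S = begin
    W * ∑ tests (λ θ → mistakes θ κ S)
      ≡⟨ trans (cong (W *_) (∑-∑< tests R _)) (sym (∑<-*ˡ R W _)) ⟩
    ∑< R (λ j → W * ∑ tests (λ θ → 𝟙 (falsePass θ κ j S) + 𝟙 (falseFail θ κ j S)))
      ≤⟨ ∑<-mono R (λ j j<R → begin
           W * ∑ tests (λ θ → 𝟙 (falsePass θ κ j S) + 𝟙 (falseFail θ κ j S))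
             ≡⟨ trans (cong (W *_) (∑-+ tests _ _)) (*-distribˡ-+ W _ _) ⟩
           W * ∑ tests (λ θ → 𝟙 (falsePass θ κ j S)) + W * ∑ tests (λ θ → 𝟙 (falseFail θ κ j S))
             ≤⟨ +-mono-≤ (falsePass-≤ κ j S j<R) (falseFail-≤ κ j S j<R) ⟩
           length tests + length tests
             ≡⟨ cong (length tests +_) (sym (+-identityʳ _)) ⟩
           2 * length tests ∎) ⟩
    ∑< R (λ _ → 2 * length tests)
      ≡⟨ ∑<-const R _ ⟩
    R * (2 * length tests) ∎
    where
    open ≤-Reasoning
    W : ℕ
    W = 2 ^ (2 ^ k)

  -- Counting incidences: a heavy set contains at least 2^i elements of `U`, and an element lies in
  -- at most t sets.
  heavy-≤ : 2 ^ i * ∑ (allFin m) (λ S → 𝟙 (heavy S)) ≤ t * alive#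
  heavy-≤ = begin
    2 ^ i * ∑ (allFin m) (λ S → 𝟙 (heavy S)) ≡⟨ sym (∑-*ˡ (allFin m) (2 ^ i) _) ⟩
    ∑ (allFin m) (λ S → 2 ^ i * 𝟙 (heavy S)) ≤⟨ ∑-mono (allFin m) small ⟩
    ∑ (allFin m) (λ S → ∑ (elemsOf I S) (λ e → 𝟙 (U e))) ≡⟨ ∑-incidence I (λ S e → 𝟙 (U e)) ⟩
    ∑ (allFin n) (λ e → ∑ (setsOf I e) (λ S → 𝟙 (U e))) ≤⟨ ∑-mono (allFin n) (λ e → ≤-trans (≤-reflexive (∑-const (setsOf I e) (𝟙 (U e)))) (*-monoˡ-≤ (𝟙 (U e)) (elemFreq I e))) ⟩
    ∑ (allFin n) (λ e → t * 𝟙 (U e)) ≡⟨ ∑-*ˡ (allFin n) t _ ⟩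
    t * alive# ∎
    where
    open ≤-Reasoning
    small : ∀ S → 2 ^ i * 𝟙 (heavy S) ≤ ∑ (elemsOf I S) (λ e → 𝟙 (U e))
    small S with heavy S in eq
    ... | false = ≤-trans (≤-reflexive (*-zeroʳ (2 ^ i))) z≤n
    ... | true  = ≤-trans (≤-reflexive (*-identityʳ (2 ^ i))) (≤-trans (≤ᵇ-true (2 ^ i) _ eq) (≤-reflexive (length-filterᵇ U (elemsOf I S))))

  -- Each of the at most t|U| / 2^i heavy sets makes at most 2R / 2^(2^k) errors in expectation. The
  -- hypothesis on `k` is what reduces this to |U| / 2^i.
  total-mistakes-≤ : 2 * (R * t) ≤ 2 ^ (2 ^ k) → ∀ κ →
    2 ^ i * ∑ tests (λ θ → ∑ (allFin m) (λ S → 𝟙 (heavy S) * mistakes θ κ S)) ≤ alive# * length tests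
  total-mistakes-≤ err κ = *-cancelˡ-≤ W {{m^n≢0 2 (2 ^ k)}} (begin
    W * (K * ∑ tests (λ θ → ∑ (allFin m) (λ S → 𝟙 (heavy S) * mistakes θ κ S)))
      ≡⟨ cong (λ w → W * (K * w)) (trans (∑-swap tests (allFin m) _) (∑-cong (allFin m) (λ S → ∑-*ˡ tests (𝟙 (heavy S)) _))) ⟩
    W * (K * ∑ (allFin m) (λ S → 𝟙 (heavy S) * ∑ tests (λ θ → mistakes θ κ S)))
      ≡⟨ trans (x∙yz≈y∙xz W K _) (cong (K *_) (sym (∑-*ˡ (allFin m) W _))) ⟩
    K * ∑ (allFin m) (λ S → W * (𝟙 (heavy S) * ∑ tests (λ θ → mistakes θ κ S)))
      ≤⟨ *-monoʳ-≤ K (∑-mono (allFin m) (λ S → ≤-trans (≤-reflexive (x∙yz≈y∙xz W (𝟙 (heavy S)) _)) (*-monoʳ-≤ (𝟙 (heavy S)) (mistakes-≤ κ S)))) ⟩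
    K * ∑ (allFin m) (λ S → 𝟙 (heavy S) * (R * (2 * length tests)))
      ≡⟨ trans (cong (K *_) (∑-*ʳ (allFin m) (R * (2 * length tests)) _)) (sym (*-assoc K _ _)) ⟩
    K * ∑ (allFin m) (λ S → 𝟙 (heavy S)) * (R * (2 * length tests))
      ≤⟨ *-monoˡ-≤ (R * (2 * length tests)) heavy-≤ ⟩
    t * alive# * (R * (2 * length tests))
      ≡⟨ lem2 t alive# R (length tests) ⟩
    2 * (R * t) * (alive# * length tests)
      ≤⟨ *-monoˡ-≤ (alive# * length tests) err ⟩
    W * (alive# * length tests) ∎)
    where
    open ≤-Reasoning
    W K : ℕ
    W = 2 ^ (2 ^ k)
    K = 2 ^ i
    lem2 : ∀ t a R l → t * a * (R * (2 * l)) ≡ 2 * (R * t) * (a * l)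
    lem2 = solve-∀

  -- Being alive in round `j > l` means that no active set around `e` succeeded in round `l`, while
  -- overflow means that many of them succeed in round `j`. With the other rounds frozen these sets
  -- are fixed and the two events are independent, so `none-many-≤` applies.
  overflow-≤ : ∀ θ j l e → l < j → j < R →
    2 ^ B * ∑ coins (λ κ → 𝟙 (St.alive θ κ j e ∧ St.overflow θ κ l j e)) ≤ 𝟙 (U e) * length coins
  overflow-≤ θ j l e l<j j<R = begin
    2 ^ B * ∑ coins (λ κ → 𝟙 (bad κ)) ≡⟨ sym (∑-*ˡ coins (2 ^ B) _) ⟩
    ∑ coins (λ κ → 2 ^ B * 𝟙 (bad κ)) ≤⟨ resample₂-≤ CoinSpace R l<R j<R (λ κ → 2 ^ B * 𝟙 (bad κ)) (λ _ → 𝟙 (U e)) step ⟩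
    ∑ coins (λ _ → 𝟙 (U e)) ≡⟨ trans (∑-const coins _) (*-comm (length coins) _) ⟩
    𝟙 (U e) * length coins ∎
    where
    open ≤-Reasoning
    l<R : l < R
    l<R = <-trans l<j j<R
    bad : Tape₂ → Bool
    bad κ = St.alive θ κ j e ∧ St.overflow θ κ l j e
    z : ℕ
    z = size CoinSpace
    lem : ∀ b u x y → b * (u * (x * y)) ≡ b * u * (x * y)
    lem = solve-∀
    step : ∀ κ → ∑ flips (λ x → ∑ flips (λ y → 2 ^ B * 𝟙 (bad (put (put κ l x) j y))))
               ≤ ∑ flips (λ x → ∑ flips (λ y → 𝟙 (U e)))
    step κ = begin
      ∑ flips (λ x → ∑ flips (λ y → 2 ^ B * 𝟙 (bad (put (put κ l x) j y))))
        ≤⟨ ∑-mono flips (λ x → ∑-mono flips (λ y → *-monoʳ-≤ (2 ^ B) (pointwise x y))) ⟩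
      ∑ flips (λ x → ∑ flips (λ y → 2 ^ B * (𝟙 (U e) * (𝟙 (none x) * 𝟙 (many y)))))
        ≡⟨ ∑-cong flips (λ x → ∑-cong flips (λ y → lem2 (2 ^ B) (𝟙 (U e)) (𝟙 (none x)) (𝟙 (many y)))) ⟩
      ∑ flips (λ x → ∑ flips (λ y → 𝟙 (none x) * (2 ^ B * 𝟙 (U e) * 𝟙 (many y))))
        ≡⟨ trans (∑-∑-* flips flips _ _) (cong (∑ flips (λ x → 𝟙 (none x)) *_) (∑-*ˡ flips (2 ^ B * 𝟙 (U e)) _)) ⟩
      ∑ flips (λ x → 𝟙 (none x)) * (2 ^ B * 𝟙 (U e) * ∑ flips (λ y → 𝟙 (many y)))
        ≡⟨ lem3 (∑ flips (λ x → 𝟙 (none x))) (2 ^ B) (𝟙 (U e)) (∑ flips (λ y → 𝟙 (many y))) ⟩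
      𝟙 (U e) * (2 ^ B * (∑ flips (λ x → 𝟙 (none x)) * ∑ flips (λ y → 𝟙 (many y))))
        ≤⟨ *-monoʳ-≤ (𝟙 (U e)) (none-many-≤ (bitSpace R) (success l) (success j) (2 ^ (R ∸ l)) (2 ^ (j ∸ l)) B
             {{m^n≢0 2 (R ∸ l)}} {{m^n≢0 2 (j ∸ l)}} (∑-success l) (∑-success₂ (<⇒≤ l<j) (<⇒≤ j<R)) m (near θ κ (suc l) e)) ⟩
      𝟙 (U e) * (z * z)
        ≡⟨ trans (*-comm (𝟙 (U e)) (z * z)) (trans (*-assoc z z (𝟙 (U e))) (sym (trans (∑-cong flips (λ x → ∑-const flips _)) (∑-const flips _)))) ⟩
      ∑ flips (λ x → ∑ flips (λ y → 𝟙 (U e))) ∎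
      where
      lem2 : ∀ b u x y → b * (u * (x * y)) ≡ x * (b * u * y)
      lem2 = solve-∀
      lem3 : ∀ x b u y → x * (b * u * y) ≡ u * (b * (x * y))
      lem3 = solve-∀
      none many : Vec (Vec Bool R) m → Bool
      none x = hits (near θ κ (suc l) e) (success l) x ≤ᵇ 0
      many y = 2 ^ (j ∸ l) * B ≤ᵇ hits (near θ κ (suc l) e) (success j) y
      pointwise : ∀ x y → 𝟙 (bad (put (put κ l x) j y)) ≤ 𝟙 (U e) * (𝟙 (none x) * 𝟙 (many y))
      pointwise x y = ≤-trans (𝟙-mono {b = U e ∧ (none x ∧ many y)} implies)
        (≤-reflexive (trans (𝟙-∧ (U e) _) (cong (𝟙 (U e) *_) (𝟙-∧ (none x) (many y)))))
        where
        implies : bad (put (put κ l x) j y) ≡ true → U e ∧ (none x ∧ many y) ≡ true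
        implies h = ∧-intro (St.alive-≤ θ (put (put κ l x) j y) {0} j e z≤n al) (∧-intro
          (alive-none-hits θ κ l x e l<R (trans (sym (alive-coins θ (put κ l x) j y l<j e)) (St.alive-≤ θ (put (put κ l x) j y) j e l<j al)))
          (true-≤ᵇ _ _ (≤-trans (<⇒≤ (≤ᵇ-false _ (2 ^ (j ∸ l) * B) (not-true ov))) (≤-reflexive (begin-equality
             length (filterᵇ (λ S → coinOf (put (put κ l x) j y) j S ∧ St.active θ (put (put κ l x) j y) (suc l) S) (setsOf I e))
               ≡⟨ cong length (filterᵇ-cong (λ S → cong (coinOf (put (put κ l x) j y) j S ∧_) (active-coins θ (put κ l x) j y (m≤n⇒m≤1+n l<j) S)) (setsOf I e)) ⟩
             length (filterᵇ (λ S → coinOf (put (put κ l x) j y) j S ∧ St.active θ (put κ l x) (suc l) S) (setsOf I e))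
               ≡⟨ joined-hits θ (put κ l x) j (suc l) y e j<R ⟩
             hits (near θ (put κ l x) (suc l) e) (success j) y
               ≡⟨ count-cong (λ S → cong (_∧ success j (lookup y S)) (near-coins θ κ l x ≤-refl e S)) ⟩
             hits (near θ κ (suc l) e) (success j) y ∎)))))
          where
          al : St.alive θ (put (put κ l x) j y) j e ≡ true
          al = proj₁ (∧-elim h)
          ov : St.overflow θ (put (put κ l x) j y) l j e ≡ true
          ov = proj₂ (∧-elim {St.alive θ (put (put κ l x) j y) j e} h)

  -- A union bound over the at most R² pairs of rounds; the choice of `B` also absorbs the factor
  -- 2^i, because a lost element costs a whole set.
  total-lost-≤ : 2 ^ i * (R * R) ≤ 2 ^ B → ∀ θ →
    2 ^ i * ∑ coins (λ κ → ∑ (allFin n) (λ e → 𝟙 (St.lost θ κ e))) ≤ alive# * length coins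
  total-lost-≤ loss θ = *-cancelˡ-≤ (2 ^ B) {{m^n≢0 2 B}} (begin
    2 ^ B * (2 ^ i * ∑ coins (λ κ → ∑ (allFin n) (λ e → 𝟙 (St.lost θ κ e))))
      ≡⟨ trans (x∙yz≈y∙xz (2 ^ B) (2 ^ i) _) (cong (2 ^ i *_) (trans (cong (2 ^ B *_) (∑-swap coins (allFin n) _)) (sym (∑-*ˡ (allFin n) (2 ^ B) _)))) ⟩
    2 ^ i * ∑ (allFin n) (λ e → 2 ^ B * ∑ coins (λ κ → 𝟙 (St.lost θ κ e)))
      ≤⟨ *-monoʳ-≤ (2 ^ i) (∑-mono (allFin n) per-element) ⟩
    2 ^ i * ∑ (allFin n) (λ e → R * R * length coins * 𝟙 (U e))
      ≡⟨ cong (2 ^ i *_) (∑-*ˡ (allFin n) (R * R * length coins) _) ⟩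
    2 ^ i * (R * R * length coins * alive#)
      ≡⟨ lem2 (2 ^ i) R (length coins) alive# ⟩
    2 ^ i * (R * R) * (alive# * length coins)
      ≤⟨ *-monoˡ-≤ (alive# * length coins) loss ⟩
    2 ^ B * (alive# * length coins) ∎)
    where
    open ≤-Reasoning
    lem2 : ∀ K R c a → K * (R * R * c * a) ≡ K * (R * R) * (a * c)
    lem2 = solve-∀
    per-element : ∀ e → 2 ^ B * ∑ coins (λ κ → 𝟙 (St.lost θ κ e)) ≤ R * R * length coins * 𝟙 (U e)
    per-element e = begin
      2 ^ B * ∑ coins (λ κ → 𝟙 (St.lost θ κ e))
        ≤⟨ *-monoʳ-≤ (2 ^ B) (∑-mono coins witness) ⟩
      2 ^ B * ∑ coins (λ κ → ∑< R (λ j → ∑< j (λ l → 𝟙 (St.alive θ κ j e ∧ St.overflow θ κ l j e))))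
        ≡⟨ cong (2 ^ B *_) (trans (∑-∑< coins R _) (∑<-cong R (λ j _ → ∑-∑< coins j _))) ⟩
      2 ^ B * ∑< R (λ j → ∑< j (λ l → ∑ coins (λ κ → 𝟙 (St.alive θ κ j e ∧ St.overflow θ κ l j e))))
        ≡⟨ trans (sym (∑<-*ˡ R (2 ^ B) _)) (∑<-cong R (λ j _ → sym (∑<-*ˡ j (2 ^ B) _))) ⟩
      ∑< R (λ j → ∑< j (λ l → 2 ^ B * ∑ coins (λ κ → 𝟙 (St.alive θ κ j e ∧ St.overflow θ κ l j e))))
        ≤⟨ ∑<-mono R (λ j j<R → ≤-trans (∑<-mono j (λ l l<j → overflow-≤ θ j l e l<j j<R))
             (≤-trans (≤-reflexive (∑<-const j _)) (*-monoˡ-≤ (𝟙 (U e) * length coins) (<⇒≤ j<R)))) ⟩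
      ∑< R (λ j → R * (𝟙 (U e) * length coins))
        ≡⟨ trans (∑<-const R _) (lem3 R (𝟙 (U e)) (length coins)) ⟩
      R * R * length coins * 𝟙 (U e) ∎
      where
      lem3 : ∀ R u c → R * (R * (u * c)) ≡ R * R * c * u
      lem3 = solve-∀
      witness : ∀ κ → 𝟙 (St.lost θ κ e) ≤ ∑< R (λ j → ∑< j (λ l → 𝟙 (St.alive θ κ j e ∧ St.overflow θ κ l j e)))
      witness κ with St.lost θ κ e in eq
      ... | false = z≤n
      ... | true with St.lost⇒overflow θ κ e eq
      ...   | j , l , l<j , j<R , al , ov = ≤-trans (≤-reflexive (sym (cong 𝟙 (∧-intro al ov))))
        (≤-trans (∑<-∈ j (λ l → 𝟙 (St.alive θ κ j e ∧ St.overflow θ κ l j e)) l<j)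
                 (∑<-∈ R (λ j → ∑< j (λ l → 𝟙 (St.alive θ κ j e ∧ St.overflow θ κ l j e))) j<R))

  -- 26 = 8 · 3 + 1 + 1: three units of credit per element at the rate 8, one for test errors and
  -- one for lost elements.
  stage-≤ : t ≤ 2 ^ R → 2 * (R * t) ≤ 2 ^ (2 ^ k) → 2 ^ i * (R * R) ≤ 2 ^ B →
    2 ^ i * ∑ tests (λ θ → ∑ coins (λ κ → ∑ (allFin m) (λ S → 𝟙 (St.chosen θ κ S)) + ∑ (allFin n) (λ e → 𝟙 (St.lost θ κ e))))
      ≤ 26 * alive# * (length tests * length coins)
  stage-≤ t≤ err loss = begin
    K * ∑ tests (λ θ → ∑ coins (λ κ → X θ κ + Y θ κ))
      ≡⟨ trans (cong (K *_) (trans (∑-cong tests (λ θ → ∑-+ coins _ _)) (∑-+ tests _ _))) (*-distribˡ-+ K _ _) ⟩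
    K * ∑ tests (λ θ → ∑ coins (X θ)) + K * ∑ tests (λ θ → ∑ coins (Y θ))
      ≡⟨ cong₂ _+_ (pull X) (sym (∑-*ˡ tests K _)) ⟩
    ∑ tests (λ θ → ∑ coins (λ κ → K * X θ κ)) + ∑ tests (λ θ → K * ∑ coins (Y θ))
      ≤⟨ +-mono-≤ (∑-mono tests (λ θ → ∑-mono coins (λ κ → charged θ κ))) (∑-mono tests (total-lost-≤ loss)) ⟩
    ∑ tests (λ θ → ∑ coins (λ κ → 8 * G θ κ + K * E θ κ)) + ∑ tests (λ _ → alive# * c)
      ≡⟨ cong₂ _+_ (trans (∑-cong tests (λ θ → ∑-+ coins _ _)) (∑-+ tests _ _)) (∑-const tests _) ⟩
    ∑ tests (λ θ → ∑ coins (λ κ → 8 * G θ κ)) + ∑ tests (λ θ → ∑ coins (λ κ → K * E θ κ)) + length tests * (alive# * c)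
      ≤⟨ +-monoˡ-≤ _ (+-mono-≤ gains errors) ⟩
    length tests * (8 * (c * (3 * alive#))) + c * (alive# * length tests) + length tests * (alive# * c)
      ≡⟨ lem (length tests) c alive# ⟩
    26 * alive# * (length tests * c) ∎
    where
    open ≤-Reasoning
    K c : ℕ
    K = 2 ^ i
    c = length coins
    X Y G E : Tape₁ → Tape₂ → ℕ
    X θ κ = ∑ (allFin m) (λ S → 𝟙 (St.chosen θ κ S))
    Y θ κ = ∑ (allFin n) (λ e → 𝟙 (St.lost θ κ e))
    G θ κ = ∑ (allFin m) (gain θ κ)
    E θ κ = ∑ (allFin m) (λ S → 𝟙 (heavy S) * mistakes θ κ S)
    pull : ∀ (F : Tape₁ → Tape₂ → ℕ) → K * ∑ tests (λ θ → ∑ coins (F θ)) ≡ ∑ tests (λ θ → ∑ coins (λ κ → K * F θ κ))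
    pull F = trans (sym (∑-*ˡ tests K _)) (∑-cong tests (λ θ → sym (∑-*ˡ coins K _)))
    lem : ∀ l c a → l * (8 * (c * (3 * a))) + c * (a * l) + l * (a * c) ≡ 26 * a * (l * c)
    lem = solve-∀
    charged : ∀ θ κ → K * X θ κ ≤ 8 * G θ κ + K * E θ κ
    charged θ κ = begin
      K * X θ κ ≡⟨ sym (∑-*ˡ (allFin m) K _) ⟩
      ∑ (allFin m) (λ S → K * 𝟙 (St.chosen θ κ S)) ≤⟨ ∑-mono (allFin m) (charge θ κ) ⟩
      ∑ (allFin m) (λ S → 8 * gain θ κ S + K * (𝟙 (heavy S) * mistakes θ κ S))
        ≡⟨ trans (∑-+ (allFin m) _ _) (cong₂ _+_ (∑-*ˡ (allFin m) 8 _) (∑-*ˡ (allFin m) K _)) ⟩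
      8 * G θ κ + K * E θ κ ∎
    gains : ∑ tests (λ θ → ∑ coins (λ κ → 8 * G θ κ)) ≤ length tests * (8 * (c * (3 * alive#)))
    gains = ≤-trans (∑-mono tests (λ θ → ≤-trans (≤-reflexive (∑-*ˡ coins 8 _)) (*-monoʳ-≤ 8 (total-gain-≤ t≤ θ))))
      (≤-reflexive (∑-const tests _))
    errors : ∑ tests (λ θ → ∑ coins (λ κ → K * E θ κ)) ≤ c * (alive# * length tests)
    errors = ≤-trans (≤-reflexive (∑-swap tests coins _)) (≤-trans
      (∑-mono coins (λ κ → ≤-trans (≤-reflexive (∑-*ˡ tests K _)) (total-mistakes-≤ err κ))) (≤-reflexive (∑-const coins _)))

-- Runs over all scales

stageSpace : ℕ → ℕ → ℕ → ℕ → Space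
stageSpace m R k i = power (power (gateSpace (bitSpace (suc i)) k) m) R ⊗ power (power (bitSpace R) m) R

runSpace : ℕ → ℕ → ℕ → ℕ → Space
runSpace m R k zero    = unitSpace
runSpace m R k (suc i) = stageSpace m R k i ⊗ runSpace m R k i

isFirst : ∀ {m} → Fin m → List (Fin m) → Bool
isFirst S []       = false
isFirst S (x ∷ xs) = does (S Fin.≟ x)

∑-isFirst : ∀ {m} (xs : List (Fin m)) → Unique xs → ∑ xs (λ S → 𝟙 (isFirst S xs)) ≤ 1
∑-isFirst []       u        = z≤n
∑-isFirst (x ∷ xs) (d ∷ u) = ≤-trans (+-mono-≤ (𝟙≤1 (does (x Fin.≟ x)))
  (≤-trans (∑-mono-∈ xs {g = λ _ → 0} others) (≤-reflexive (∑-0 xs)))) ≤-refl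
  where
  others : ∀ S → S ∈ xs → 𝟙 (does (S Fin.≟ x)) ≤ 0
  others S S∈ with S Fin.≟ x
  ... | no _     = z≤n
  ... | yes refl = ⊥-elim (All.lookup d S∈ refl)

first-of : ∀ {m} (xs : List (Fin m)) {x} → x ∈ xs → Σ (Fin m) λ S → S ∈ xs × isFirst S xs ≡ true
first-of (y ∷ ys) _ = y , here refl , y-first
  where
  y-first : does (y Fin.≟ y) ≡ true
  y-first with y Fin.≟ y
  ... | yes _ = refl
  ... | no ¬p = ⊥-elim (¬p refl)

module Run {n m s t : ℕ} (I : Instance n m s t) (R B k : ℕ) where

  module An (i : ℕ) (U : Fin n → Bool) = Analysis I R B k i U

  picked : ∀ L → (Fin n → Bool) → Out (runSpace m R k L) → Fin m → Bool
  picked zero    U ω             S = false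
  picked (suc i) U ((θ , κ) , ω) S = An.St.chosen i U θ κ S ∨ picked i (An.St.next i U θ κ) ω S

  uncovered : ∀ L → (Fin n → Bool) → Out (runSpace m R k L) → Fin n → Bool
  uncovered L U ω e = null (filterᵇ (picked L U ω) (setsOf I e))

  fallback : ∀ L → (Fin n → Bool) → Out (runSpace m R k L) → Fin m → Bool
  fallback L U ω S = not (null (filterᵇ (λ e → uncovered L U ω e ∧ isFirst S (setsOf I e)) (elemsOf I S)))

  cover : ∀ L → Out (runSpace m R k L) → Fin m → Bool
  cover L ω S = picked L (λ _ → true) ω S ∨ fallback L (λ _ → true) ω S

  stageCost : ∀ i → (Fin n → Bool) → Out (stageSpace m R k i) → ℕ
  stageCost i U (θ , κ) = ∑ (allFin m) (λ S → 𝟙 (An.St.chosen i U θ κ S)) + ∑ (allFin n) (λ e → 𝟙 (An.St.lost i U θ κ e))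

  runCost : ∀ L → (Fin n → Bool) → Out (runSpace m R k L) → ℕ
  runCost zero    U ω             = 0
  runCost (suc i) U ((θ , κ) , ω) = stageCost i U (θ , κ) + runCost i (An.St.next i U θ κ) ω

  Light : ℕ → (Fin n → Bool) → Set
  Light L U = ∀ S → length (filterᵇ U (elemsOf I S)) < 2 ^ L

  null-∨ : ∀ {A : Set} (p q : A → Bool) xs → null (filterᵇ (λ x → p x ∨ q x) xs) ≡ true →
    null (filterᵇ p xs) ≡ true × null (filterᵇ q xs) ≡ true
  null-∨ p q []       h = refl , refl
  null-∨ p q (x ∷ xs) h with p x | q x
  null-∨ p q (x ∷ xs) () | true  | _
  null-∨ p q (x ∷ xs) () | false | true
  null-∨ p q (x ∷ xs) h  | false | false = null-∨ p q xs h

  -- An element of `U` left uncovered by all stages either is lost in the current one or is passed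
  -- on, so each is paid for once. At `L = 0` a residual size below 1 leaves no element at all,
  -- because every element lies in some set.
  picked-cost : ∀ L U ω → Light L U →
    ∑ (allFin m) (λ S → 𝟙 (picked L U ω S)) + ∑ (allFin n) (λ e → 𝟙 (U e ∧ uncovered L U ω e)) ≤ runCost L U ω
  picked-cost zero U ω light = ≤-trans (+-mono-≤ (≤-reflexive (∑-0 (allFin m))) (≤-trans (∑-mono (allFin n) none-alive) (≤-reflexive (∑-0 (allFin n))))) z≤n
    where
    none-alive : ∀ e → 𝟙 (U e ∧ uncovered 0 U ω e) ≤ 0
    none-alive e with U e in Ue
    ... | false = z≤n
    ... | true  with covers I e
    ...   | S , e∈S with filterᵇ U (elemsOf I S) | ∈-filterᵇ U (elemsOf I S) e∈S Ue | light S
    ...     | _ ∷ _ | _ | s≤s ()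
  picked-cost (suc i) U ((θ , κ) , ω) light = begin
    ∑ (allFin m) (λ S → 𝟙 (ch S ∨ picked i U′ ω S)) + ∑ (allFin n) (λ e → 𝟙 (U e ∧ uncovered (suc i) U ((θ , κ) , ω) e))
      ≤⟨ +-mono-≤ (∑-mono (allFin m) (λ S → 𝟙-∨ (ch S) (picked i U′ ω S))) (∑-mono (allFin n) element) ⟩
    ∑ (allFin m) (λ S → 𝟙 (ch S) + 𝟙 (picked i U′ ω S)) + ∑ (allFin n) (λ e → 𝟙 (An.St.lost i U θ κ e) + 𝟙 (U′ e ∧ uncovered i U′ ω e))
      ≡⟨ cong₂ _+_ (∑-+ (allFin m) _ _) (∑-+ (allFin n) _ _) ⟩
    (∑ (allFin m) (λ S → 𝟙 (ch S)) + ∑ (allFin m) (λ S → 𝟙 (picked i U′ ω S)))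
      + (∑ (allFin n) (λ e → 𝟙 (An.St.lost i U θ κ e)) + ∑ (allFin n) (λ e → 𝟙 (U′ e ∧ uncovered i U′ ω e)))
      ≡⟨ ℕSum.interchange (∑ (allFin m) (λ S → 𝟙 (ch S))) _ _ _ ⟩
    stageCost i U (θ , κ) + (∑ (allFin m) (λ S → 𝟙 (picked i U′ ω S)) + ∑ (allFin n) (λ e → 𝟙 (U′ e ∧ uncovered i U′ ω e)))
      ≤⟨ +-monoʳ-≤ (stageCost i U (θ , κ)) (picked-cost i U′ ω (An.St.next-light i U θ κ)) ⟩
    runCost (suc i) U ((θ , κ) , ω) ∎
    where
    open ≤-Reasoning
    ch : Fin m → Bool
    ch = An.St.chosen i U θ κ
    U′ : Fin n → Bool
    U′ = An.St.next i U θ κ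
    element : ∀ e → 𝟙 (U e ∧ uncovered (suc i) U ((θ , κ) , ω) e) ≤ 𝟙 (An.St.lost i U θ κ e) + 𝟙 (U′ e ∧ uncovered i U′ ω e)
    element e = ≤-trans
      (𝟙-mono (λ h → let (Ue , un) = ∧-elim {U e} h ; (un₁ , un₂) = null-∨ ch (picked i U′ ω) (setsOf I e) un in ∧-intro Ue (∧-intro un₁ un₂)))
      (cases (U e) (U′ e) (null (filterᵇ ch (setsOf I e))) (uncovered i U′ ω e))
      where
      cases : ∀ u v c p → 𝟙 (u ∧ (c ∧ p)) ≤ 𝟙 (u ∧ (not v ∧ c)) + 𝟙 (v ∧ p)
      cases false v     c     p = z≤n
      cases true  v     false p = z≤n
      cases true  true  true  p = ≤-refl
      cases true  false true  p = ≤-trans (𝟙≤1 p) ≤-refl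

  -- Every fallback set is the first set of some uncovered element, and an element has at most one
  -- first set.
  cover-cost : ∀ L ω → Light L (λ _ → true) → coverSize (cover L ω) ≤ runCost L (λ _ → true) ω
  cover-cost L ω light = begin
    ∑ (allFin m) (λ S → 𝟙 (pk S ∨ fallback L 𝕌 ω S))
      ≤⟨ ∑-mono (allFin m) (λ S → ≤-trans (𝟙-∨ (pk S) _) (+-monoʳ-≤ (𝟙 (pk S)) (first S))) ⟩
    ∑ (allFin m) (λ S → 𝟙 (pk S) + ∑ (elemsOf I S) (λ e → 𝟙 (un e) * 𝟙 (isFirst S (setsOf I e))))
      ≡⟨ trans (∑-+ (allFin m) _ _) (cong (∑ (allFin m) (λ S → 𝟙 (pk S)) +_) (∑-incidence I (λ S e → 𝟙 (un e) * 𝟙 (isFirst S (setsOf I e))))) ⟩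
    ∑ (allFin m) (λ S → 𝟙 (pk S)) + ∑ (allFin n) (λ e → ∑ (setsOf I e) (λ S → 𝟙 (un e) * 𝟙 (isFirst S (setsOf I e))))
      ≤⟨ +-monoʳ-≤ (∑ (allFin m) (λ S → 𝟙 (pk S))) (∑-mono (allFin n) (λ e → begin
           ∑ (setsOf I e) (λ S → 𝟙 (un e) * 𝟙 (isFirst S (setsOf I e))) ≡⟨ ∑-*ˡ (setsOf I e) (𝟙 (un e)) _ ⟩
           𝟙 (un e) * ∑ (setsOf I e) (λ S → 𝟙 (isFirst S (setsOf I e))) ≤⟨ *-monoʳ-≤ (𝟙 (un e)) (∑-isFirst (setsOf I e) (setsOf-unique I e)) ⟩
           𝟙 (un e) * 1 ≡⟨ *-identityʳ (𝟙 (un e)) ⟩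
           𝟙 (un e) ∎)) ⟩
    ∑ (allFin m) (λ S → 𝟙 (pk S)) + ∑ (allFin n) (λ e → 𝟙 (un e))
      ≤⟨ picked-cost L 𝕌 ω light ⟩
    runCost L 𝕌 ω ∎
    where
    open ≤-Reasoning
    𝕌 : Fin n → Bool
    𝕌 _ = true
    pk : Fin m → Bool
    pk = picked L 𝕌 ω
    un : Fin n → Bool
    un = uncovered L 𝕌 ω
    first : ∀ S → 𝟙 (fallback L 𝕌 ω S) ≤ ∑ (elemsOf I S) (λ e → 𝟙 (un e) * 𝟙 (isFirst S (setsOf I e)))
    first S with null (filterᵇ (λ e → un e ∧ isFirst S (setsOf I e)) (elemsOf I S)) in eq
    ... | true  = z≤n
    ... | false with filterᵇ-null (λ e → un e ∧ isFirst S (setsOf I e)) (elemsOf I S) eq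
    ...   | e , e∈ , h = ≤-trans (≤-reflexive (trans (cong 𝟙 (sym h)) (𝟙-∧ (un e) _)))
                           (∑-∈ (elemsOf I S) (λ e → 𝟙 (un e) * 𝟙 (isFirst S (setsOf I e))) e∈)

  cover-covers : ∀ L ω → IsSetCover I (cover L ω)
  cover-covers L ω e with uncovered L (λ _ → true) ω e in un
  ... | false with filterᵇ-null (picked L (λ _ → true) ω) (setsOf I e) un
  ...   | S , S∈ , p = S , Equivalence.from (incidence I S e) S∈ , cong (_∨ fallback L (λ _ → true) ω S) p
  cover-covers L ω e | true with first-of (setsOf I e) (Equivalence.to (incidence I (proj₁ (covers I e)) e) (proj₂ (covers I e)))
  ...   | S , S∈ , S-first = S , e∈S , trans (cong (picked L (λ _ → true) ω S ∨_) falls) (∨-zeroʳ _)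
    where
    e∈S : e ∈ elemsOf I S
    e∈S = Equivalence.from (incidence I S e) S∈
    falls : fallback L (λ _ → true) ω S ≡ true
    falls with null (filterᵇ (λ e → uncovered L (λ _ → true) ω e ∧ isFirst S (setsOf I e)) (elemsOf I S)) in nl
    ... | false = refl
    ... | true  = false≢true (null-filterᵇ _ (elemsOf I S) nl e∈S) (∧-intro un S-first)

  module _ (D V : ℕ) (fractional : ∀ (U : Fin n → Bool) c → (∀ S → length (filterᵇ U (elemsOf I S)) ≤ c) → D * ∑ (allFin n) (λ e → 𝟙 (U e)) ≤ c * V)
           (t≤ : t ≤ 2 ^ R) (err : 2 * (R * t) ≤ 2 ^ (2 ^ k)) where

    -- 52 = 26 · 2: a stage costs at most 26 |U| / 2^i, and |U| is at most 2^(i+1) times the optimum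
    -- V/D.
    stageCost-≤ : ∀ i U → Light (suc i) U → 2 ^ i * (R * R) ≤ 2 ^ B →
      D * ∑ (outs (stageSpace m R k i)) (stageCost i U) ≤ 52 * V * size (stageSpace m R k i)
    stageCost-≤ i U light loss = *-cancelˡ-≤ K {{m^n≢0 2 i}} (begin
      K * (D * ∑ (outs Σ′) (stageCost i U))   ≡⟨ x∙yz≈y∙xz K D _ ⟩
      D * (K * ∑ (outs Σ′) (stageCost i U))   ≡⟨ cong (λ w → D * (K * w)) (∑-⊗ Θ Κ (stageCost i U)) ⟩
      D * (K * ∑ (outs Θ) (λ θ → ∑ (outs Κ) (λ κ → stageCost i U (θ , κ))))
        ≤⟨ *-monoʳ-≤ D (StageBound.stage-≤ I R B k i U (λ S → <⇒≤ (light S)) t≤ err loss) ⟩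
      D * (26 * a * (size Θ * size Κ)) ≡⟨ cong (λ w → D * (26 * a * w)) (sym (size-⊗ Θ Κ)) ⟩
      D * (26 * a * size Σ′) ≡⟨ lem2 D a (size Σ′) ⟩
      26 * (D * a) * size Σ′ ≤⟨ *-monoˡ-≤ (size Σ′) (*-monoʳ-≤ 26 (fractional U (2 ^ suc i) (λ S → <⇒≤ (light S)))) ⟩
      26 * (2 ^ suc i * V) * size Σ′ ≡⟨ lem3 K V (size Σ′) ⟩
      K * (52 * V * size Σ′) ∎)
      where
      open ≤-Reasoning
      K a : ℕ
      K = 2 ^ i
      a = ∑ (allFin n) (λ e → 𝟙 (U e))
      Θ Κ Σ′ : Space
      Θ = power (power (gateSpace (bitSpace (suc i)) k) m) R
      Κ = power (power (bitSpace R) m) R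
      Σ′ = stageSpace m R k i
      lem2 : ∀ D a z → D * (26 * a * z) ≡ 26 * (D * a) * z
      lem2 = solve-∀
      lem3 : ∀ K V z → 26 * (2 * K * V) * z ≡ K * (52 * V * z)
      lem3 = solve-∀

    -- The bound for the remaining stages holds uniformly in the outcome of the present one, so the
    -- contributions of the stages simply add up.
    runCost-≤ : ∀ L U → Light L U → (∀ i → i < L → 2 ^ i * (R * R) ≤ 2 ^ B) →
      D * ∑ (outs (runSpace m R k L)) (runCost L U) ≤ 52 * L * V * size (runSpace m R k L)
    runCost-≤ zero    U light loss = ≤-reflexive (*-zeroʳ D)
    runCost-≤ (suc i) U light loss = begin
      D * ∑ (outs (Σ′ ⊗ Ρ)) (runCost (suc i) U)
        ≡⟨ cong (D *_) (trans (∑-⊗ Σ′ Ρ _) (trans (∑-cong (outs Σ′) (λ σ → trans (∑-+ (outs Ρ) _ _) (cong (_+ ∑ (outs Ρ) (rest σ)) (∑-const (outs Ρ) _)))) (∑-+ (outs Σ′) _ _))) ⟩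
      D * (∑ (outs Σ′) (λ σ → size Ρ * stageCost i U σ) + ∑ (outs Σ′) (λ σ → ∑ (outs Ρ) (rest σ)))
        ≡⟨ trans (*-distribˡ-+ D _ _) (cong₂ _+_ (trans (cong (D *_) (∑-*ˡ (outs Σ′) (size Ρ) _)) (x∙yz≈y∙xz D (size Ρ) _)) (sym (∑-*ˡ (outs Σ′) D _))) ⟩
      size Ρ * (D * ∑ (outs Σ′) (stageCost i U)) + ∑ (outs Σ′) (λ σ → D * ∑ (outs Ρ) (rest σ))
        ≤⟨ +-mono-≤ (*-monoʳ-≤ (size Ρ) (stageCost-≤ i U light (loss i ≤-refl)))
             (∑-mono (outs Σ′) (λ { (θ , κ) → runCost-≤ i (An.St.next i U θ κ) (An.St.next-light i U θ κ) (λ l p → loss l (m<n⇒m<1+n p)) })) ⟩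
      size Ρ * (52 * V * size Σ′) + ∑ (outs Σ′) (λ σ → 52 * i * V * size Ρ)
        ≡⟨ cong (size Ρ * (52 * V * size Σ′) +_) (∑-const (outs Σ′) _) ⟩
      size Ρ * (52 * V * size Σ′) + size Σ′ * (52 * i * V * size Ρ)
        ≡⟨ lem2 (size Ρ) V (size Σ′) i ⟩
      52 * suc i * V * (size Σ′ * size Ρ)
        ≡⟨ cong (52 * suc i * V *_) (sym (size-⊗ Σ′ Ρ)) ⟩
      52 * suc i * V * size (Σ′ ⊗ Ρ) ∎
      where
      open ≤-Reasoning
      Σ′ Ρ : Space
      Σ′ = stageSpace m R k i
      Ρ = runSpace m R k i
      rest : Out Σ′ → Out Ρ → ℕ
      rest (θ , κ) ω = runCost i (An.St.next i U θ κ) ω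
      lem2 : ∀ r V z i → r * (52 * V * z) + z * (52 * i * V * r) ≡ 52 * suc i * V * (z * r)
      lem2 = solve-∀

-- Fractional covers

toℚᵘ-toℚ : ∀ k → toℚᵘ (toℚ k) ℚᵘ.≃ mkℚᵘ (ℤ.+ k) 0
toℚᵘ-toℚ k = ℚP.toℚᵘ-fromℚᵘ (mkℚᵘ (ℤ.+ k) 0)

toℚ-* : ∀ a b → toℚ (a * b) ≡ toℚ a ℚ.* toℚ b
toℚ-* a b = ℚP.toℚᵘ-injective (begin-equality
  toℚᵘ (toℚ (a * b)) ≃⟨ toℚᵘ-toℚ (a * b) ⟩
  mkℚᵘ (ℤ.+ (a * b)) 0 ≡⟨ cong (λ z → mkℚᵘ z 0) (ℤP.pos-* a b) ⟩
  mkℚᵘ (ℤ.+ a) 0 ℚᵘ.* mkℚᵘ (ℤ.+ b) 0 ≃⟨ ℚᵘP.*-cong (ℚᵘP.≃-sym (toℚᵘ-toℚ a)) (ℚᵘP.≃-sym (toℚᵘ-toℚ b)) ⟩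
  toℚᵘ (toℚ a) ℚᵘ.* toℚᵘ (toℚ b) ≃⟨ ℚᵘP.≃-sym (ℚP.toℚᵘ-homo-* (toℚ a) (toℚ b)) ⟩
  toℚᵘ (toℚ a ℚ.* toℚ b) ∎)
  where open ℚᵘP.≤-Reasoning

toℚ-+ : ∀ a b → toℚ (a + b) ≡ toℚ a ℚ.+ toℚ b
toℚ-+ a b = ℚP.toℚᵘ-injective (begin-equality
  toℚᵘ (toℚ (a + b)) ≃⟨ toℚᵘ-toℚ (a + b) ⟩
  mkℚᵘ (ℤ.+ (a + b)) 0 ≡⟨ cong (λ z → mkℚᵘ z 0) (sym (cong₂ ℤ._+_ (ℤP.*-identityʳ (ℤ.+ a)) (ℤP.*-identityʳ (ℤ.+ b)))) ⟩
  mkℚᵘ (ℤ.+ a) 0 ℚᵘ.+ mkℚᵘ (ℤ.+ b) 0 ≃⟨ ℚᵘP.+-cong (ℚᵘP.≃-sym (toℚᵘ-toℚ a)) (ℚᵘP.≃-sym (toℚᵘ-toℚ b)) ⟩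
  toℚᵘ (toℚ a) ℚᵘ.+ toℚᵘ (toℚ b) ≃⟨ ℚᵘP.≃-sym (ℚP.toℚᵘ-homo-+ (toℚ a) (toℚ b)) ⟩
  toℚᵘ (toℚ a ℚ.+ toℚ b) ∎)
  where open ℚᵘP.≤-Reasoning

toℚ-mono-≤ : ∀ {a b} → a ≤ b → toℚ a ℚ.≤ toℚ b
toℚ-mono-≤ {a} {b} le = ℚP.toℚᵘ-cancel-≤ (begin
  toℚᵘ (toℚ a) ≃⟨ toℚᵘ-toℚ a ⟩
  mkℚᵘ (ℤ.+ a) 0    ≤⟨ *≤* (ℤP.*-monoʳ-≤-nonNeg (ℤ.+ 1) (ℤ.+≤+ le)) ⟩
  mkℚᵘ (ℤ.+ b) 0    ≃⟨ ℚᵘP.≃-sym (toℚᵘ-toℚ b) ⟩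
  toℚᵘ (toℚ b) ∎)
  where open ℚᵘP.≤-Reasoning

toℚ-cancel-≤ : ∀ {a b} → toℚ a ℚ.≤ toℚ b → a ≤ b
toℚ-cancel-≤ {a} {b} le with a ≤? b
... | yes p = p
... | no ¬p with begin-strict
      toℚᵘ (toℚ b) ≃⟨ toℚᵘ-toℚ b ⟩
      mkℚᵘ (ℤ.+ b) 0    <⟨ ℚᵘ.*<* (ℤP.*-monoʳ-<-pos (ℤ.+ 1) (ℤ.+<+ (≰⇒> ¬p))) ⟩
      mkℚᵘ (ℤ.+ a) 0    ≃⟨ ℚᵘP.≃-sym (toℚᵘ-toℚ a) ⟩
      toℚᵘ (toℚ a) ≤⟨ ℚP.toℚᵘ-mono-≤ le ⟩
      toℚᵘ (toℚ b) ∎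
  where open ℚᵘP.≤-Reasoning
... | b<b = ⊥-elim (ℚᵘP.<-irrefl ℚᵘP.≃-refl b<b)

toℚ-nonNeg : ∀ k → ℚ.NonNegative (toℚ k)
toℚ-nonNeg k = ℚP.normalize-nonNeg k 1

as-fraction : ∀ p → 0ℚ ℚ.≤ p → Σ ℕ λ D → Σ ℕ λ V → NonZero D × toℚ D ℚ.* p ≡ toℚ V
as-fraction (mkℚ ℤ.-[1+ v ] d c) h with ℚP.drop-*≤* h
... | ()
as-fraction p@(mkℚ (ℤ.+ v) d c) h = suc d , v , _ , ℚP.toℚᵘ-injective (begin-equality
  toℚᵘ (toℚ (suc d) ℚ.* p) ≃⟨ ℚP.toℚᵘ-homo-* (toℚ (suc d)) p ⟩
  toℚᵘ (toℚ (suc d)) ℚᵘ.* toℚᵘ p ≃⟨ ℚᵘP.*-congʳ {toℚᵘ p} (toℚᵘ-toℚ (suc d)) ⟩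
  mkℚᵘ (ℤ.+ suc d) 0 ℚᵘ.* mkℚᵘ (ℤ.+ v) d ≃⟨ *≡* eq ⟩
  mkℚᵘ (ℤ.+ v) 0 ≃⟨ ℚᵘP.≃-sym (toℚᵘ-toℚ v) ⟩
  toℚᵘ (toℚ v) ∎)
  where
  open ℚᵘP.≤-Reasoning
  eq : (ℤ.+ suc d ℤ.* ℤ.+ v) ℤ.* ℤ.+ 1 ≡ ℤ.+ v ℤ.* ℤ.+ (1 * suc d)
  eq = trans (ℤP.*-identityʳ (ℤ.+ suc d ℤ.* ℤ.+ v)) (trans (ℤP.*-comm (ℤ.+ suc d) (ℤ.+ v))
         (cong (λ k → ℤ.+ v ℤ.* ℤ.+ k) (sym (*-identityˡ (suc d)))))

module ℚSum = ListSum ℚP.+-0-commutativeMonoid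

ℚSum-mono : ∀ {A : Set} (xs : List A) {f g : A → ℚ} → (∀ x → f x ℚ.≤ g x) → ℚSum.Sum xs f ℚ.≤ ℚSum.Sum xs g
ℚSum-mono []       h = ℚP.≤-refl
ℚSum-mono (x ∷ xs) h = ℚP.+-mono-≤ (h x) (ℚSum-mono xs h)

ℚSum-*ˡ : ∀ {A : Set} (xs : List A) c (f : A → ℚ) → ℚSum.Sum xs (λ x → c ℚ.* f x) ≡ c ℚ.* ℚSum.Sum xs f
ℚSum-*ˡ []       c f = sym (ℚP.*-zeroʳ c)
ℚSum-*ˡ (x ∷ xs) c f = trans (cong (c ℚ.* f x ℚ.+_) (ℚSum-*ˡ xs c f)) (sym (ℚP.*-distribˡ-+ c (f x) _))

ℚSum-*ʳ : ∀ {A : Set} (xs : List A) c (f : A → ℚ) → ℚSum.Sum xs (λ x → f x ℚ.* c) ≡ ℚSum.Sum xs f ℚ.* c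
ℚSum-*ʳ []       c f = sym (ℚP.*-zeroˡ c)
ℚSum-*ʳ (x ∷ xs) c f = trans (cong (f x ℚ.* c ℚ.+_) (ℚSum-*ʳ xs c f)) (sym (ℚP.*-distribʳ-+ c (f x) _))

toℚ-∑ : ∀ {A : Set} (xs : List A) (f : A → ℕ) → toℚ (∑ xs f) ≡ ℚSum.Sum xs (λ x → toℚ (f x))
toℚ-∑ []       f = refl
toℚ-∑ (x ∷ xs) f = trans (toℚ-+ (f x) _) (cong (toℚ (f x) ℚ.+_) (toℚ-∑ xs f))

module _ {n m s t : ℕ} {I : Instance n m s t} (x : FractionalCover I) where

  fracValue-nonneg : 0ℚ ℚ.≤ fracValue x
  fracValue-nonneg = ℚP.≤-trans (ℚP.≤-reflexive (sym (ℚSum.Sum-ε (allFin m)))) (ℚSum-mono (allFin m) (nonneg x))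

  -- Weak duality: for positive `c`, weight 1/c on every element of `U` is a feasible dual solution.
  fracValue-≥ : ∀ (U : Fin n → Bool) c → (∀ S → length (filterᵇ U (elemsOf I S)) ≤ c) →
    toℚ (∑ (allFin n) (λ e → 𝟙 (U e))) ℚ.≤ toℚ c ℚ.* fracValue x
  fracValue-≥ U c h = begin
    toℚ (∑ (allFin n) (λ e → 𝟙 (U e))) ≡⟨ toℚ-∑ (allFin n) _ ⟩
    ℚSum.Sum (allFin n) (λ e → toℚ (𝟙 (U e))) ≤⟨ ℚSum-mono (allFin n) pay ⟩
    ℚSum.Sum (allFin n) (λ e → ℚSum.Sum (setsOf I e) (λ S → toℚ (𝟙 (U e)) ℚ.* weight x S))
      ≡⟨ sym (ℚSum.Sum-incidence I (λ S e → toℚ (𝟙 (U e)) ℚ.* weight x S)) ⟩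
    ℚSum.Sum (allFin m) (λ S → ℚSum.Sum (elemsOf I S) (λ e → toℚ (𝟙 (U e)) ℚ.* weight x S))
      ≤⟨ ℚSum-mono (allFin m) receive ⟩
    ℚSum.Sum (allFin m) (λ S → toℚ c ℚ.* weight x S) ≡⟨ ℚSum-*ˡ (allFin m) (toℚ c) _ ⟩
    toℚ c ℚ.* fracValue x ∎
    where
    open ℚP.≤-Reasoning
    pay : ∀ e → toℚ (𝟙 (U e)) ℚ.≤ ℚSum.Sum (setsOf I e) (λ S → toℚ (𝟙 (U e)) ℚ.* weight x S)
    pay e = begin
      toℚ (𝟙 (U e)) ≡⟨ sym (ℚP.*-identityʳ (toℚ (𝟙 (U e)))) ⟩
      toℚ (𝟙 (U e)) ℚ.* 1ℚ    ≤⟨ ℚP.*-monoˡ-≤-nonNeg (toℚ (𝟙 (U e))) {{toℚ-nonNeg (𝟙 (U e))}} (feasible x e) ⟩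
      toℚ (𝟙 (U e)) ℚ.* sumℚ (map (weight x) (setsOf I e)) ≡⟨ sym (ℚSum-*ˡ (setsOf I e) (toℚ (𝟙 (U e))) (weight x)) ⟩
      ℚSum.Sum (setsOf I e) (λ S → toℚ (𝟙 (U e)) ℚ.* weight x S) ∎
    receive : ∀ S → ℚSum.Sum (elemsOf I S) (λ e → toℚ (𝟙 (U e)) ℚ.* weight x S) ℚ.≤ toℚ c ℚ.* weight x S
    receive S = begin
      ℚSum.Sum (elemsOf I S) (λ e → toℚ (𝟙 (U e)) ℚ.* weight x S) ≡⟨ ℚSum-*ʳ (elemsOf I S) (weight x S) _ ⟩
      ℚSum.Sum (elemsOf I S) (λ e → toℚ (𝟙 (U e))) ℚ.* weight x S ≡⟨ cong (ℚ._* weight x S) (sym (toℚ-∑ (elemsOf I S) _)) ⟩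
      toℚ (∑ (elemsOf I S) (λ e → 𝟙 (U e))) ℚ.* weight x S
        ≤⟨ ℚP.*-monoʳ-≤-nonNeg (weight x S) {{ℚ.nonNegative (nonneg x S)}} (toℚ-mono-≤ (≤-trans (≤-reflexive (sym (length-filterᵇ U (elemsOf I S)))) (h S))) ⟩
      toℚ c ℚ.* weight x S ∎

  -- The optimum as a quotient V / D of naturals, so that costs can be compared without leaving ℕ.
  fracValue-ℕ : Σ ℕ λ D → Σ ℕ λ V →
    (∀ (U : Fin n → Bool) c → (∀ S → length (filterᵇ U (elemsOf I S)) ≤ c) → D * ∑ (allFin n) (λ e → 𝟙 (U e)) ≤ c * V) ×
    (∀ a c → D * a ≤ c * V → toℚ a ℚ.≤ toℚ c ℚ.* fracValue x)
  fracValue-ℕ with as-fraction (fracValue x) fracValue-nonneg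
  ... | D , V , D≢0 , D*p≡V = D , V , lower , upper
    where
    open ℚP.≤-Reasoning
    p : ℚ
    p = fracValue x
    swap : ∀ c → toℚ D ℚ.* (toℚ c ℚ.* p) ≡ toℚ (c * V)
    swap c = begin-equality
      toℚ D ℚ.* (toℚ c ℚ.* p)   ≡⟨ sym (ℚP.*-assoc (toℚ D) (toℚ c) p) ⟩
      toℚ D ℚ.* toℚ c ℚ.* p ≡⟨ cong (ℚ._* p) (ℚP.*-comm (toℚ D) (toℚ c)) ⟩
      toℚ c ℚ.* toℚ D ℚ.* p ≡⟨ ℚP.*-assoc (toℚ c) (toℚ D) p ⟩
      toℚ c ℚ.* (toℚ D ℚ.* p)   ≡⟨ cong (toℚ c ℚ.*_) D*p≡V ⟩
      toℚ c ℚ.* toℚ V ≡⟨ sym (toℚ-* c V) ⟩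
      toℚ (c * V) ∎
    lower : ∀ (U : Fin n → Bool) c → (∀ S → length (filterᵇ U (elemsOf I S)) ≤ c) → D * ∑ (allFin n) (λ e → 𝟙 (U e)) ≤ c * V
    lower U c h = toℚ-cancel-≤ (begin
      toℚ (D * ∑ (allFin n) (λ e → 𝟙 (U e))) ≡⟨ toℚ-* D _ ⟩
      toℚ D ℚ.* toℚ (∑ (allFin n) (λ e → 𝟙 (U e))) ≤⟨ ℚP.*-monoˡ-≤-nonNeg (toℚ D) {{toℚ-nonNeg D}} (fracValue-≥ U c h) ⟩
      toℚ D ℚ.* (toℚ c ℚ.* p) ≡⟨ swap c ⟩
      toℚ (c * V) ∎)
    upper : ∀ a c → D * a ≤ c * V → toℚ a ℚ.≤ toℚ c ℚ.* p
    upper a c h = ℚP.*-cancelˡ-≤-pos (toℚ D) {{ℚP.normalize-pos D 1 {{_}} {{D≢0}}}} (begin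
      toℚ D ℚ.* toℚ a ≡⟨ sym (toℚ-* D a) ⟩
      toℚ (D * a) ≤⟨ toℚ-mono-≤ h ⟩
      toℚ (c * V) ≡⟨ sym (swap c) ⟩
      toℚ D ℚ.* (toℚ c ℚ.* p)   ∎)

-- Query computations

-- Leaves of a query tree carry only Booleans, so a computation with a result in `A` is written in
-- continuation-passing style.
Comp : ℕ → ℕ → Set → Set
Comp n m A = (A → QTree n m) → QTree n m

ret : ∀ {n m} {A : Set} → A → Comp n m A
ret a k = k a

infixl 1 _>>=_
_>>=_ : ∀ {n m} {A C : Set} → Comp n m A → (A → Comp n m C) → Comp n m C
(c >>= f) k = c (λ a → f a k)

-- An intermediate result is visible only through what follows it. Quantifying over all
-- continuations makes values compose and query counts add up.
Computes : ∀ {n m s t} → Instance n m s t → {A : Set} → Comp n m A → A → ℕ → Set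
Computes I c v q = ∀ k → run I (c k) ≡ run I (k v) × queries I (c k) ≤ q + queries I (k v)

-- The size bound of the instance serves as fuel: a list of maximal length is read without a further
-- query for its end.
collect : ∀ {n m} {A : Set} → (ℕ → Comp n m (Maybe A)) → ℕ → ℕ → Comp n m (List A)
collect ask zero       j = ret []
collect ask (suc fuel) j = ask j >>= λ { nothing  → ret []
                                       ; (just x) → collect ask fuel (suc j) >>= λ xs → ret (x ∷ xs) }

filterP : ∀ {n m} {A : Set} → (A → Comp n m Bool) → List A → Comp n m (List A)
filterP p []       = ret []
filterP p (x ∷ xs) = p x >>= λ b → filterP p xs >>= λ ys → ret (if b then x ∷ ys else ys)

holdsP : ∀ {n m} {A : Set} → (A → Comp n m Bool) → Maybe A → Comp n m Bool
holdsP p nothing  = ret false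
holdsP p (just x) = p x

gateP : ∀ {n m} {Ω} k → (Out Ω → Comp n m Bool) → Out (gateSpace Ω k) → Comp n m Bool
gateP zero    h (a , b) = h a >>= λ x → h b >>= λ y → ret (x ∨ y)
gateP (suc k) h ((a , b) , (c , d)) =
  gateP k h a >>= λ w → gateP k h b >>= λ x → gateP k h c >>= λ y → gateP k h d >>= λ z → ret ((w ∨ x) ∧ (y ∨ z))

extendP : ∀ {n m} {A : Set} → ℕ → (A → Comp n m Bool) → Maybe (List A) → Comp n m (Maybe (List A))
extendP b p nothing   = ret nothing
extendP b p (just xs) = if length xs ≤ᵇ b then (filterP p xs >>= λ ys → ret (just ys)) else ret nothing

leaves : ℕ → ℕ
leaves zero    = 2
leaves (suc k) = 4 * leaves k

module _ {n m s t : ℕ} (I : Instance n m s t) where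

  computes-ret : ∀ {A : Set} (a : A) → Computes I (ret a) a 0
  computes-ret a k = refl , ≤-refl

  computes-≤ : ∀ {A : Set} {c} {v : A} {q q′} → q ≤ q′ → Computes I c v q → Computes I c v q′
  computes-≤ le h k = proj₁ (h k) , ≤-trans (proj₂ (h k)) (+-monoˡ-≤ _ le)

  computes->>= : ∀ {A C : Set} {c} {f : A → Comp n m C} {v w q r} →
    Computes I c v q → Computes I (f v) w r → Computes I (c >>= f) w (q + r)
  computes->>= {f = f} {v} {w} {q} {r} hc hf k =
    let (e₁ , l₁) = hc (λ a → f a k) ; (e₂ , l₂) = hf k in
    trans e₁ e₂ , ≤-trans l₁ (≤-trans (+-monoʳ-≤ q l₂) (≤-reflexive (sym (+-assoc q r _))))

  computes-map : ∀ {A C : Set} {c} {v : A} {q} (f : A → C) → Computes I c v q → Computes I (c >>= λ a → ret (f a)) (f v) q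
  computes-map {q = q} f h = computes-≤ (≤-reflexive (+-identityʳ q)) (computes->>= h (computes-ret (f _)))

  computes-elem : ∀ S j → Computes I (askElem S j) (nth (elemsOf I S) j) 1
  computes-elem S j k = refl , ≤-refl

  computes-set : ∀ e j → Computes I (askSet e j) (nth (setsOf I e) j) 1
  computes-set e j k = refl , ≤-refl

  computes-collect : ∀ {A : Set} {ask : ℕ → Comp n m (Maybe A)} fuel j ys → (∀ l → Computes I (ask (j + l)) (nth ys l) 1) →
    length ys ≤ fuel → Computes I (collect ask fuel j) ys fuel
  computes-collect zero j [] h le = computes-ret []
  computes-collect {ask = ask} (suc fuel) j [] h le =
    computes-≤ (s≤s z≤n) (computes->>= (subst (λ l → Computes I (ask l) nothing 1) (+-identityʳ j) (h 0)) (computes-ret []))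
  computes-collect {ask = ask} (suc fuel) j (y ∷ ys) h (s≤s le) =
    computes->>= (subst (λ l → Computes I (ask l) (just y) 1) (+-identityʳ j) (h 0))
      (computes-map (y ∷_) (computes-collect fuel (suc j) ys
        (λ l → subst (λ i → Computes I (ask i) (nth ys l) 1) (+-suc j l) (h (suc l))) le))

  computes-filter : ∀ {A : Set} {p : A → Comp n m Bool} {f : A → Bool} {q} → (∀ x → Computes I (p x) (f x) q) →
    ∀ xs → Computes I (filterP p xs) (filterᵇ f xs) (length xs * q)
  computes-filter h [] = computes-ret []
  computes-filter {f = f} h (x ∷ xs) = subst (λ zs → Computes I _ zs _) (filter-∷ (f x) refl)
    (computes->>= (h x) (computes-map (λ ys → if f x then x ∷ ys else ys) (computes-filter h xs)))
    where
    filter-∷ : ∀ b → f x ≡ b → (if f x then x ∷ filterᵇ f xs else filterᵇ f xs) ≡ filterᵇ f (x ∷ xs)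
    filter-∷ b eq with f x
    ... | true  = refl
    ... | false = refl

  computes-holds : ∀ {A : Set} {p : A → Comp n m Bool} {f : A → Bool} {q} → (∀ x → Computes I (p x) (f x) q) →
    ∀ x → Computes I (holdsP p x) (holds f x) q
  computes-holds h nothing  = computes-≤ z≤n (computes-ret false)
  computes-holds h (just x) = h x

  computes-gate : ∀ {Ω} k {p : Out Ω → Comp n m Bool} {f : Out Ω → Bool} {q} → (∀ x → Computes I (p x) (f x) q) →
    ∀ x → Computes I (gateP {Ω = Ω} k p x) (gate {Ω} k f x) (leaves k * q)
  computes-gate zero {q = q} h (a , b) = computes->>= (h a) (computes-≤ (≤-reflexive (sym (+-identityʳ q))) (computes-map _ (h b)))
  computes-gate {Ω} (suc k) {q = q} h ((a , b) , (c , d)) = computes-≤ (≤-reflexive (lem (leaves k) q))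
    (computes->>= (rec a) (computes->>= (rec b) (computes->>= (rec c) (computes-map _ (rec d)))))
    where
    rec : ∀ x → Computes I _ _ (leaves k * q)
    rec = computes-gate {Ω} k h
    lem : ∀ l q → l * q + (l * q + (l * q + l * q)) ≡ 4 * l * q
    lem = solve-∀

  computes-extend : ∀ {A : Set} {p : A → Comp n m Bool} {f : A → Bool} {q} b → (∀ x → Computes I (p x) (f x) q) →
    ∀ xs → Computes I (extendP b p xs) (extend b f xs) (b * q)
  computes-extend b h nothing = computes-≤ z≤n (computes-ret nothing)
  computes-extend {q = q} b h (just xs) with length xs ≤ᵇ b in le
  ... | false = computes-≤ z≤n (computes-ret nothing)
  ... | true  = computes-≤ (*-monoˡ-≤ q (≤ᵇ-true (length xs) b le)) (computes-map just (computes-filter h xs))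

module Rates (s t R B k : ℕ) where

  -- Relative to the cost of one oracle call, `base` pays for residual sets and the start of a
  -- chain, `growth` for one more round, and `polynomial` for deducing `chosen` or `next` from the
  -- statuses of elements. A whole stage multiplies the oracle cost by `factor`.
  base growth polynomial factor : ℕ
  base = 1 + s + t * (1 + 2 * s + leaves k)
  growth = 4 * suc (B * suc (leaves k)) + 2
  polynomial = 1 + t + 2 * (t * s) + R * (1 + R * suc (leaves k)) + 2 * s
  factor = base * growth ^ R * polynomial

-- The uncovered elements are stored nowhere. Membership in `U` is itself a computation `UP`, and
-- `nextP` is the oracle handed to the following scale.
module StageP {n m : ℕ} (s t R B k i : ℕ) (UP : Fin n → Comp n m Bool)
              (coin : ℕ → Fin m → Bool) (τ : ℕ → Fin m → Out (gateSpace (bitSpace (suc i)) k)) where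

  elemsP : Fin m → Comp n m (List (Fin n))
  elemsP S = collect (askElem S) s 0

  setsP : Fin n → Comp n m (List (Fin m))
  setsP e = collect (askSet e) t 0

  residualP : Fin m → Comp n m (List (Fin n))
  residualP S = elemsP S >>= filterP UP

  acceptsP : Fin m → (Fin n → Comp n m Bool) → Out (gateSpace (bitSpace (suc i)) k) → Comp n m Bool
  acceptsP S al σ = residualP S >>= λ xs → gateP {Ω = bitSpace (suc i)} k (λ v → holdsP al (pick (suc i) v xs)) σ

  heavyP : Fin m → Comp n m Bool
  heavyP S = residualP S >>= λ xs → ret (2 ^ i ≤ᵇ length xs)

  aliveP : ℕ → Fin n → Comp n m Bool
  chainP : ℕ → Fin n → ℕ → Comp n m (Maybe (List (Fin m)))
  aliveP zero    e = UP e
  aliveP (suc j) e = aliveP j e >>= λ b → chainP j e j >>= λ c → ret (b ∧ deserted c)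
  chainP j e zero = setsP e >>= λ Ss →
    filterP (λ S → heavyP S >>= λ b → acceptsP S (aliveP 0) (τ 0 S) >>= λ c → ret (b ∧ c)) (filterᵇ (coin j) Ss) >>= λ xs → ret (just xs)
  chainP j e (suc l) = chainP j e l >>= extendP (2 ^ (j ∸ l) * B) (λ S → acceptsP S (aliveP (suc l)) (τ (suc l) S))

  activeP : ℕ → Fin m → Comp n m Bool
  activeP zero    S = heavyP S
  activeP (suc l) S = activeP l S >>= λ b → acceptsP S (aliveP l) (τ l S) >>= λ c → ret (b ∧ c)

  joinedBeforeP : ℕ → Fin m → Comp n m Bool
  joinedBeforeP zero    S = ret false
  joinedBeforeP (suc j) S = joinedBeforeP j S >>= λ b → activeP (suc j) S >>= λ c → ret (b ∨ (coin j S ∧ c))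

  finalP : Fin m → Comp n m Bool
  finalP S = elemsP S >>= λ es → filterP (aliveP R) es >>= λ xs → ret (2 ^ i ≤ᵇ length xs)

  chosenP : Fin m → Comp n m Bool
  chosenP S = joinedBeforeP R S >>= λ b → finalP S >>= λ c → ret (b ∨ c)

  nextP : Fin n → Comp n m Bool
  nextP e = aliveP R e >>= λ b → setsP e >>= λ Ss → filterP finalP Ss >>= λ xs → ret (b ∧ null xs)

  open Rates s t R B k

  module Cost (I : Instance n m s t) (U : Fin n → Bool) (T₀ : ℕ) (oracle : ∀ e → Computes I (UP e) (U e) T₀) where
    module Sem = Stage I R B k i U coin τ

    M E A′ G r : ℕ
    M = leaves k
    E = suc (B * suc M)
    A′ = 2 * E + 1
    G = base * suc T₀
    r = s * suc T₀

    growth≡ : growth ≡ 2 * A′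
    growth≡ = lem E
      where
      lem : ∀ E → 4 * E + 2 ≡ 2 * (2 * E + 1)
      lem = solve-∀

    time : ℕ → ℕ
    time l = G * growth ^ l

    growth^-≥1 : ∀ l → 1 ≤ growth ^ l
    growth^-≥1 l = m^n>0 growth {{subst NonZero (+-comm 2 (4 * E)) _}} l

    G≤time : ∀ l → G ≤ time l
    G≤time l = ≤-trans (≤-reflexive (sym (*-identityʳ G))) (*-monoʳ-≤ G (growth^-≥1 l))

    suc-T₀≤G : suc T₀ ≤ G
    suc-T₀≤G = m≤m+n (suc T₀) _

    r≤G : r ≤ G
    r≤G = *-monoˡ-≤ (suc T₀) (≤-trans (m≤n+m s 1) (m≤m+n (1 + s) _))

    computes-elems : ∀ S → Computes I (elemsP S) (elemsOf I S) s
    computes-elems S = computes-collect I s 0 (elemsOf I S) (computes-elem I S) (setSize I S)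

    computes-sets : ∀ e → Computes I (setsP e) (setsOf I e) t
    computes-sets e = computes-collect I t 0 (setsOf I e) (computes-set I e) (elemFreq I e)

    computes-residual : ∀ S → Computes I (residualP S) (Sem.residual S) r
    computes-residual S = computes-≤ I (≤-trans (+-monoʳ-≤ s (*-monoˡ-≤ T₀ (setSize I S))) (≤-reflexive (sym (*-suc s T₀))))
      (computes->>= I (computes-elems S) (computes-filter I oracle (elemsOf I S)))

    computes-heavy : ∀ S → Computes I (heavyP S) (Sem.heavy S) r
    computes-heavy S = computes-map I (λ xs → 2 ^ i ≤ᵇ length xs) (computes-residual S)

    computes-accepts : ∀ S σ {alP al q} → (∀ e → Computes I (alP e) (al e) q) → Computes I (acceptsP S alP σ) (Sem.accepts S al σ) (r + M * q)
    computes-accepts S σ h = computes->>= I (computes-residual S)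
      (computes-gate I {bitSpace (suc i)} k (λ v → computes-holds I h (pick (suc i) v (Sem.residual S))) σ)

    chain-start-≤ : t + t * (r + (r + M * T₀)) ≤ G
    chain-start-≤ = begin
      t + t * (r + (r + M * T₀)) ≤⟨ m≤m+n _ (t * T₀ + t * M) ⟩
      t + t * (r + (r + M * T₀)) + (t * T₀ + t * M) ≡⟨ lem t s T₀ M ⟩
      t * (1 + 2 * s + M) * suc T₀ ≤⟨ *-monoˡ-≤ (suc T₀) (m≤n+m _ (1 + s)) ⟩
      G ∎
      where
      open ≤-Reasoning
      lem : ∀ t s T M → t + t * (s * suc T + (s * suc T + M * T)) + (t * T + t * M) ≡ t * (1 + 2 * s + M) * suc T
      lem = solve-∀

    -- Extending a chain past level `l` tests at most 2^(j-l) B sets, each at cost proportional to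
    -- `time (suc l)`, that is to (2 A′)^(l+1). The powers of two combine to 2^(j+1) for every `l`,
    -- which leaves a geometric series in `A′`. Adding the chain to `time j` then costs at most the
    -- factor 4E + 2 = 2 A′, so the same rate closes both inductions.
    computes-alive : ∀ j e → Computes I (aliveP j e) (Sem.alive j e) (time j)
    computes-chain : ∀ j e l → l ≤ j → Computes I (chainP j e l) (Sem.chain j e l) (4 * E * G * (2 ^ j * A′ ^ l))
    computes-alive zero e = computes-≤ I (≤-trans (n≤1+n T₀) (≤-trans suc-T₀≤G (G≤time 0))) (oracle e)
    computes-alive (suc j) e = computes-≤ I bound (computes->>= I (computes-alive j e)
      (computes-map I (λ c → Sem.alive j e ∧ deserted c) (computes-chain j e j ≤-refl)))
      where
      open ≤-Reasoning
      lem : ∀ G E x → G * x + 4 * E * G * x + G * x ≡ G * ((4 * E + 2) * x)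
      lem = solve-∀
      bound : time j + 4 * E * G * (2 ^ j * A′ ^ j) ≤ time (suc j)
      bound = begin
        G * growth ^ j + 4 * E * G * (2 ^ j * A′ ^ j) ≡⟨ cong (λ x → G * growth ^ j + 4 * E * G * x) (trans (sym (^-distribʳ-* j 2 A′)) (cong (_^ j) (sym growth≡))) ⟩
        G * growth ^ j + 4 * E * G * growth ^ j ≤⟨ m≤m+n _ (G * growth ^ j) ⟩
        G * growth ^ j + 4 * E * G * growth ^ j + G * growth ^ j ≡⟨ lem G E (growth ^ j) ⟩
        time (suc j) ∎
    computes-chain j e zero le = computes-≤ I bound (computes->>= I (computes-sets e) (computes-map I just
      (computes-≤ I (*-monoˡ-≤ (r + (r + M * T₀)) (≤-trans (length-filter (λ S → T? (coin j S)) (setsOf I e)) (elemFreq I e)))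
        (computes-filter I (λ S → computes->>= I {f = λ b → acceptsP S (aliveP 0) (τ 0 S) >>= λ c → ret (b ∧ c)} (computes-heavy S)
          (computes-map I (Sem.heavy S ∧_) (computes-accepts S (τ 0 S) oracle))) (filterᵇ (coin j) (setsOf I e))))))
      where
      open ≤-Reasoning
      bound : t + t * (r + (r + M * T₀)) ≤ 4 * E * G * (2 ^ j * 1)
      bound = begin
        t + t * (r + (r + M * T₀))   ≤⟨ chain-start-≤ ⟩
        G ≤⟨ m≤n*m G (4 * E) ⟩
        4 * E * G ≤⟨ m≤m*n (4 * E * G) (2 ^ j * 1) {{m*n≢0 (2 ^ j) 1 {{m^n≢0 2 j}}}} ⟩
        4 * E * G * (2 ^ j * 1) ∎
    computes-chain j e (suc l) le = computes-≤ I bound (computes->>= I (computes-chain j e l (<⇒≤ le))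
      (computes-extend I (2 ^ (j ∸ l) * B) (λ S → computes-accepts S (τ (suc l) S) (computes-alive (suc l))) (Sem.chain j e l)))
      where
      open ≤-Reasoning
      lem : ∀ p B M G x → p * B * (G * x + M * (G * x)) ≡ B * suc M * (p * (G * x))
      lem = solve-∀
      lem2 : ∀ E p G q a → E * (p * (G * (q * a))) ≡ E * G * (p * q * a)
      lem2 = solve-∀
      step : 2 ^ (j ∸ l) * B * (r + M * time (suc l)) ≤ E * G * (2 * 2 ^ j * A′ ^ suc l)
      step = begin
        2 ^ (j ∸ l) * B * (r + M * time (suc l))
          ≤⟨ *-monoʳ-≤ (2 ^ (j ∸ l) * B) (+-monoˡ-≤ (M * time (suc l)) (≤-trans r≤G (G≤time (suc l)))) ⟩
        2 ^ (j ∸ l) * B * (time (suc l) + M * time (suc l))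
          ≡⟨ lem (2 ^ (j ∸ l)) B M G (growth ^ suc l) ⟩
        B * suc M * (2 ^ (j ∸ l) * (G * growth ^ suc l))
          ≤⟨ *-monoˡ-≤ (2 ^ (j ∸ l) * (G * growth ^ suc l)) (n≤1+n (B * suc M)) ⟩
        E * (2 ^ (j ∸ l) * (G * growth ^ suc l))
          ≡⟨ cong (λ x → E * (2 ^ (j ∸ l) * (G * x))) (trans (cong (_^ suc l) growth≡) (^-distribʳ-* (suc l) 2 A′)) ⟩
        E * (2 ^ (j ∸ l) * (G * (2 ^ suc l * A′ ^ suc l)))
          ≡⟨ lem2 E (2 ^ (j ∸ l)) G (2 ^ suc l) (A′ ^ suc l) ⟩
        E * G * (2 ^ (j ∸ l) * 2 ^ suc l * A′ ^ suc l)
          ≡⟨ cong (λ x → E * G * (x * A′ ^ suc l)) (trans (sym (^-distribˡ-+-* 2 (j ∸ l) (suc l))) (cong (2 ^_) (trans (+-suc (j ∸ l) l) (cong suc (m∸n+n≡m (<⇒≤ le)))))) ⟩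
        E * G * (2 * 2 ^ j * A′ ^ suc l) ∎
      bound : 4 * E * G * (2 ^ j * A′ ^ l) + 2 ^ (j ∸ l) * B * (r + M * time (suc l)) ≤ 4 * E * G * (2 ^ j * A′ ^ suc l)
      bound = begin
        4 * E * G * (2 ^ j * A′ ^ l) + 2 ^ (j ∸ l) * B * (r + M * time (suc l))
          ≤⟨ +-monoʳ-≤ (4 * E * G * (2 ^ j * A′ ^ l)) step ⟩
        4 * E * G * (2 ^ j * A′ ^ l) + E * G * (2 * 2 ^ j * A′ ^ suc l)
          ≤⟨ finish (2 ^ j * A′ ^ l) ⟩
        4 * E * G * (2 ^ j * A′ ^ suc l) ∎
        where
        lem5 : ∀ E G J a → 4 * E * G * (J * a) + E * G * (2 * J * ((2 * E + 1) * a)) ≡ 4 * E * E * G * (J * a) + 6 * E * G * (J * a)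
        lem5 = solve-∀
        lem6 : ∀ E G J a → 4 * E * G * (J * ((2 * E + 1) * a)) ≡ 4 * E * E * G * (J * a) + (4 * E * E * G * (J * a) + 4 * E * G * (J * a))
        lem6 = solve-∀
        lem7 : ∀ b G x → 6 * suc b * G * x + (4 * b * suc b * G * x + 2 * suc b * G * x) ≡ 4 * suc b * suc b * G * x + 4 * suc b * G * x
        lem7 = solve-∀
        finish : ∀ x → 4 * E * G * (2 ^ j * A′ ^ l) + E * G * (2 * 2 ^ j * A′ ^ suc l) ≤ 4 * E * G * (2 ^ j * A′ ^ suc l)
        finish _ = begin
          4 * E * G * (2 ^ j * A′ ^ l) + E * G * (2 * 2 ^ j * A′ ^ suc l) ≡⟨ lem5 E G (2 ^ j) (A′ ^ l) ⟩
          4 * E * E * G * (2 ^ j * A′ ^ l) + 6 * E * G * (2 ^ j * A′ ^ l)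
            ≤⟨ +-monoʳ-≤ (4 * E * E * G * (2 ^ j * A′ ^ l)) (≤-trans (m≤m+n _ _) (≤-reflexive (lem7 (B * suc M) G (2 ^ j * A′ ^ l)))) ⟩
          4 * E * E * G * (2 ^ j * A′ ^ l) + (4 * E * E * G * (2 ^ j * A′ ^ l) + 4 * E * G * (2 ^ j * A′ ^ l))
            ≡⟨ sym (lem6 E G (2 ^ j) (A′ ^ l)) ⟩
          4 * E * G * (2 ^ j * A′ ^ suc l) ∎

    TR : ℕ
    TR = time R

    time≤TR : ∀ {l} → l ≤ R → time l ≤ TR
    time≤TR le = *-monoʳ-≤ G (^-monoʳ-≤ growth {{subst NonZero (+-comm 2 (4 * E)) _}} le)

    r≤TR : r ≤ TR
    r≤TR = ≤-trans r≤G (G≤time R)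

    1≤TR : 1 ≤ TR
    1≤TR = ≤-trans (s≤s z≤n) (≤-trans suc-T₀≤G (G≤time R))

    computes-active : ∀ l S → l ≤ R → Computes I (activeP l S) (Sem.active l S) (TR + l * (suc M * TR))
    computes-active zero S le = computes-≤ I (≤-trans r≤TR (≤-reflexive (sym (+-identityʳ TR)))) (computes-heavy S)
    computes-active (suc l) S le = computes-≤ I (≤-reflexive (lem TR (suc M * TR) (l * (suc M * TR)))) (computes->>= I (computes-active l S (<⇒≤ le))
      (computes-map I (Sem.active l S ∧_) (computes-≤ I (+-mono-≤ r≤TR (*-monoʳ-≤ M (time≤TR (<⇒≤ le))))
        (computes-accepts S (τ l S) (computes-alive l)))))
      where
      lem : ∀ T x y → T + y + x ≡ T + (x + y)
      lem = solve-∀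

    computes-joinedBefore : ∀ j S → j ≤ R → Computes I (joinedBeforeP j S) (Sem.joinedBefore j S) (j * (TR + R * (suc M * TR)))
    computes-joinedBefore zero    S le = computes-ret I false
    computes-joinedBefore (suc j) S le = computes-≤ I (≤-reflexive (+-comm (j * (TR + R * (suc M * TR))) _)) (computes->>= I (computes-joinedBefore j S (<⇒≤ le))
      (computes-map I (λ c → Sem.joinedBefore j S ∨ (coin j S ∧ c))
        (computes-≤ I (+-monoʳ-≤ TR (*-monoˡ-≤ (suc M * TR) le)) (computes-active (suc j) S le))))

    computes-final : ∀ S → Computes I (finalP S) (Sem.final S) (s + s * TR)
    computes-final S = computes->>= I (computes-elems S) (computes-map I (λ xs → 2 ^ i ≤ᵇ length xs)
      (computes-≤ I (*-monoˡ-≤ TR (setSize I S)) (computes-filter I (computes-alive R) (elemsOf I S))))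

    TR*polynomial : TR * polynomial ≡ factor * suc T₀
    TR*polynomial = lem base (suc T₀) (growth ^ R) polynomial
      where
      lem : ∀ b T g p → b * T * g * p ≡ b * g * p * T
      lem = solve-∀

    computes-chosen : ∀ S → Computes I (chosenP S) (Sem.chosen S) (factor * suc T₀)
    computes-chosen S = computes-≤ I bound (computes->>= I (computes-joinedBefore R S ≤-refl)
      (computes-map I (Sem.joinedBefore R S ∨_) (computes-final S)))
      where
      open ≤-Reasoning
      lem : ∀ T R M s → R * (T + R * (suc M * T)) + (s * T + s * T) ≡ T * (R * (1 + R * suc M) + 2 * s)
      lem = solve-∀
      lem2 : ∀ t ts x s → 1 + t + ts + x + s ≡ 1 + t + ts + (x + s)
      lem2 = solve-∀
      bound : R * (TR + R * (suc M * TR)) + (s + s * TR) ≤ factor * suc T₀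
      bound = begin
        R * (TR + R * (suc M * TR)) + (s + s * TR)
          ≤⟨ +-monoʳ-≤ (R * (TR + R * (suc M * TR))) (+-monoˡ-≤ (s * TR) (≤-trans (≤-reflexive (sym (*-identityʳ s))) (*-monoʳ-≤ s 1≤TR))) ⟩
        R * (TR + R * (suc M * TR)) + (s * TR + s * TR)   ≡⟨ lem TR R M s ⟩
        TR * (R * (1 + R * suc M) + 2 * s)
          ≤⟨ *-monoʳ-≤ TR (≤-trans (m≤n+m _ (1 + t + 2 * (t * s))) (≤-reflexive (sym (lem2 t (2 * (t * s)) (R * (1 + R * suc M)) (2 * s))))) ⟩
        TR * polynomial ≡⟨ TR*polynomial ⟩
        factor * suc T₀ ∎

    computes-next : ∀ e → Computes I (nextP e) (Sem.next e) (factor * suc T₀)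
    computes-next e = computes-≤ I bound (computes->>= I (computes-alive R e) (computes->>= I (computes-sets e)
      (computes-map I (λ xs → Sem.alive R e ∧ null xs)
        (computes-≤ I (*-monoˡ-≤ (s + s * TR) (elemFreq I e)) (computes-filter I computes-final (setsOf I e))))))
      where
      open ≤-Reasoning
      lem : ∀ T t s → T + (t * T + t * (s * T + s * T)) ≡ T * (1 + t + 2 * (t * s))
      lem = solve-∀
      bound : TR + (t + t * (s + s * TR)) ≤ factor * suc T₀
      bound = begin
        TR + (t + t * (s + s * TR))
          ≤⟨ +-monoʳ-≤ TR (+-mono-≤ (≤-trans (≤-reflexive (sym (*-identityʳ t))) (*-monoʳ-≤ t 1≤TR))
               (*-monoʳ-≤ t (+-monoˡ-≤ (s * TR) (≤-trans (≤-reflexive (sym (*-identityʳ s))) (*-monoʳ-≤ s 1≤TR))))) ⟩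
        TR + (t * TR + t * (s * TR + s * TR))   ≡⟨ lem TR t s ⟩
        TR * (1 + t + 2 * (t * s)) ≤⟨ *-monoʳ-≤ TR (≤-trans (m≤m+n _ _) (m≤m+n _ (2 * s))) ⟩
        TR * polynomial ≡⟨ TR*polynomial ⟩
        factor * suc T₀ ∎

-- Rounded logarithms and parameters

≤2^⌈log2⌉ : ∀ n (a : Acc _<_ n) → n ≤ 2 ^ ⌈log2⌉ n a
≤2^⌈log2⌉ zero          a        = z≤n
≤2^⌈log2⌉ (suc zero)    a        = ≤-refl
≤2^⌈log2⌉ (suc (suc n)) (acc rs) = begin
  suc (suc n) ≤⟨ s≤s (s≤s (≤-trans (≤-reflexive (sym (⌊n/2⌋+⌈n/2⌉≡n n))) (+-monoˡ-≤ ⌈ n /2⌉ (⌊n/2⌋≤⌈n/2⌉ n)))) ⟩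
  suc (suc (⌈ n /2⌉ + ⌈ n /2⌉)) ≡⟨ lem ⌈ n /2⌉ ⟩
  2 * suc ⌈ n /2⌉ ≤⟨ *-monoʳ-≤ 2 (≤2^⌈log2⌉ (suc ⌈ n /2⌉) (rs (⌈n/2⌉<n n))) ⟩
  2 ^ ⌈log2⌉ (suc (suc n)) (acc rs)   ∎
  where
  open ≤-Reasoning
  lem : ∀ h → suc (suc (h + h)) ≡ 2 * suc h
  lem = solve-∀

-- For the argument y = 2 + n the bound is 2(y - 1). The weaker 2y would not survive the upward
-- rounding of y/2 in the induction.
2^⌈log2⌉≤ : ∀ n (a : Acc _<_ (2 + n)) → 2 ^ ⌈log2⌉ (2 + n) a ≤ 2 * suc n
2^⌈log2⌉≤ zero    (acc rs) = ≤-refl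
2^⌈log2⌉≤ (suc n) (acc rs) = begin
  2 * 2 ^ ⌈log2⌉ (2 + ⌊ n /2⌋) (rs (⌈n/2⌉<n (suc n)))  ≤⟨ *-monoʳ-≤ 2 (2^⌈log2⌉≤ ⌊ n /2⌋ (rs (⌈n/2⌉<n (suc n)))) ⟩
  2 * (2 * suc ⌊ n /2⌋) ≡⟨ cong (2 *_) (lem ⌊ n /2⌋) ⟩
  2 * suc (suc (⌊ n /2⌋ + ⌊ n /2⌋))
    ≤⟨ *-monoʳ-≤ 2 (s≤s (s≤s (≤-trans (+-monoʳ-≤ ⌊ n /2⌋ (⌊n/2⌋≤⌈n/2⌉ n)) (≤-reflexive (⌊n/2⌋+⌈n/2⌉≡n n))))) ⟩
  2 * suc (suc n) ∎
  where
  open ≤-Reasoning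
  lem : ∀ h → 2 * suc h ≡ suc (suc (h + h))
  lem = solve-∀

+2≤2^lg : ∀ x → x + 2 ≤ 2 ^ lg x
+2≤2^lg x = ≤2^⌈log2⌉ (x + 2) (<-wellFounded (x + 2))

2^lg≤ : ∀ x → 2 ^ lg x ≤ (x + 2) ^ 2
2^lg≤ x = begin
  2 ^ lg x ≡⟨ cong (λ y → 2 ^ ⌈log₂ y ⌉) (+-comm x 2) ⟩
  2 ^ ⌈log₂ 2 + x ⌉ ≤⟨ 2^⌈log2⌉≤ x (<-wellFounded (2 + x)) ⟩
  2 * suc x ≤⟨ m≤m+n _ (2 + 2 * x + x * x) ⟩
  2 * suc x + (2 + 2 * x + x * x) ≡⟨ lem x ⟩
  (x + 2) ^ 2 ∎
  where
  open ≤-Reasoning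
  lem : ∀ x → 2 * suc x + (2 + 2 * x + x * x) ≡ (x + 2) * ((x + 2) * 1)
  lem = solve-∀

n<2^n : ∀ n → n < 2 ^ n
n<2^n zero    = s≤s z≤n
n<2^n (suc n) = begin
  suc (suc n) ≤⟨ s≤s (n<2^n n) ⟩
  suc (2 ^ n) ≤⟨ +-monoˡ-≤ (2 ^ n) (m^n>0 2 n) ⟩
  2 ^ n + 2 ^ n   ≡⟨ cong (2 ^ n +_) (sym (+-identityʳ (2 ^ n))) ⟩
  2 ^ suc n ∎
  where open ≤-Reasoning

1≤lg : ∀ x → 1 ≤ lg x
1≤lg x with lg x | +2≤2^lg x
... | suc l | _ = s≤s z≤n
... | zero  | h = ⊥-elim (1+n≰n (≤-trans (m≤n+m 2 x) h))

-- Queries of the whole run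

module RunP (n m s t R B k : ℕ) where

  module StP (i : ℕ) (UP : Fin n → Comp n m Bool) (θ : Vec (Out (power (gateSpace (bitSpace (suc i)) k) m)) R) (κ : Vec (Out (power (bitSpace R) m)) R) =
    StageP s t R B k i UP (coinAt m R κ) (testAt m R (gateSpace (bitSpace (suc i)) k) θ)

  pickedP : ∀ L → (Fin n → Comp n m Bool) → Out (runSpace m R k L) → Fin m → Comp n m Bool
  pickedP zero    UP ω             S = ret false
  pickedP (suc i) UP ((θ , κ) , ω) S = StP.chosenP i UP θ κ S >>= λ b → pickedP i (StP.nextP i UP θ κ) ω S >>= λ c → ret (b ∨ c)

  elemsP : Fin m → Comp n m (List (Fin n))
  elemsP S = collect (askElem S) s 0

  setsP : Fin n → Comp n m (List (Fin m))
  setsP e = collect (askSet e) t 0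

  -- The fallback needs the answers for all sets around an element. Rerunning the selection on the
  -- same tape keeps them consistent.
  orphanP : ∀ L → Out (runSpace m R k L) → Fin m → Fin n → Comp n m Bool
  orphanP L ω S e = setsP e >>= λ Ss → filterP (pickedP L (λ _ → ret true) ω) Ss >>= λ xs → ret (null xs ∧ isFirst S Ss)

  coverP : ∀ L → Out (runSpace m R k L) → Fin m → Comp n m Bool
  coverP L ω S = pickedP L (λ _ → ret true) ω S >>= λ b → elemsP S >>= λ es → filterP (orphanP L ω S) es >>= λ ys → ret (b ∨ not (null ys))

  open Rates s t R B k

  rate : ℕ
  rate = 2 * factor + 1

  module _ (I : Instance n m s t) where
    open Run I R B k

    -- Each scale queries the previous one as its oracle, so costs multiply over the scales. `rate`
    -- is twice `factor`, plus one, to absorb both the choice at the current scale and the additive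
    -- one in `suc T₀`.
    computes-picked : ∀ L UP U T₀ → (∀ e → Computes I (UP e) (U e) T₀) → ∀ ω S →
      Computes I (pickedP L UP ω S) (picked L U ω S) (rate ^ L * suc T₀)
    computes-picked zero    UP U T₀ oracle ω             S = computes-≤ I z≤n (computes-ret I false)
    computes-picked (suc i) UP U T₀ oracle ((θ , κ) , ω) S = computes-≤ I bound
      (computes->>= I {f = λ b → pickedP i (StP.nextP i UP θ κ) ω S >>= λ c → ret (b ∨ c)} (StP.Cost.computes-chosen i UP θ κ I U T₀ oracle S)
        (computes-map I (An.St.chosen i U θ κ S ∨_)
          (computes-picked i (StP.nextP i UP θ κ) (An.St.next i U θ κ) (factor * suc T₀) (StP.Cost.computes-next i UP θ κ I U T₀ oracle) ω S)))
      where
      open ≤-Reasoning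
      lem : ∀ x T z → suc z * suc (x * suc T) + x * suc T + (z * (x * suc T) + suc z * T) ≡ (2 * x + 1) * suc z * suc T
      lem = solve-∀
      bound : factor * suc T₀ + rate ^ i * suc (factor * suc T₀) ≤ rate ^ suc i * suc T₀
      bound with rate ^ i | m^n>0 rate {{subst NonZero (+-comm 1 (2 * factor)) _}} i
      ... | suc z | _ = begin
        factor * suc T₀ + suc z * suc (factor * suc T₀)  ≡⟨ +-comm (factor * suc T₀) _ ⟩
        suc z * suc (factor * suc T₀) + factor * suc T₀  ≤⟨ m≤m+n _ _ ⟩
        suc z * suc (factor * suc T₀) + factor * suc T₀ + (z * (factor * suc T₀) + suc z * T₀) ≡⟨ lem factor T₀ z ⟩
        rate * suc z * suc T₀ ∎

    computes-cover : ∀ L ω S → Computes I (coverP L ω S) (cover L ω S) ((1 + s + 2 * (s * t)) * rate ^ L)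
    computes-cover L ω S = computes-≤ I bound (computes->>= I (main S) (computes->>= I (computes-collect I s 0 (elemsOf I S) (computes-elem I S) (setSize I S))
      (computes-map I (λ ys → picked L (λ _ → true) ω S ∨ not (null ys))
        (computes-≤ I (*-monoˡ-≤ (t + t * J) (setSize I S)) (computes-filter I orphan (elemsOf I S))))))
      where
      open ≤-Reasoning
      J : ℕ
      J = rate ^ L * 1
      main : ∀ S → Computes I (pickedP L (λ _ → ret true) ω S) (picked L (λ _ → true) ω S) J
      main = computes-picked L (λ _ → ret true) (λ _ → true) 0 (λ e → computes-ret I true) ω
      orphan : ∀ e → Computes I (orphanP L ω S e) (uncovered L (λ _ → true) ω e ∧ isFirst S (setsOf I e)) (t + t * J)
      orphan e = computes->>= I (computes-collect I t 0 (setsOf I e) (computes-set I e) (elemFreq I e))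
        (computes-map I (λ xs → null xs ∧ isFirst S (setsOf I e))
          (computes-≤ I (*-monoˡ-≤ J (elemFreq I e)) (computes-filter I main (setsOf I e))))
      lem : ∀ s t j → suc j * 1 + (s + s * (t + t * (suc j * 1))) + (j * s + j * (s * t)) ≡ (1 + s + 2 * (s * t)) * suc j
      lem = solve-∀
      bound : J + (s + s * (t + t * J)) ≤ (1 + s + 2 * (s * t)) * rate ^ L
      bound with rate ^ L | m^n>0 rate {{subst NonZero (+-comm 1 (2 * factor)) _}} L
      ... | suc j | _ = ≤-trans (m≤m+n _ _) (≤-reflexive (lem s t j))

-- Choice of parameters and the resulting query bound

leaves≡ : ∀ k → leaves k ≡ 2 * 4 ^ k
leaves≡ zero    = refl
leaves≡ (suc k) = trans (cong (4 *_) (leaves≡ k)) (lem (4 ^ k))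
  where
  lem : ∀ x → 4 * (2 * x) ≡ 2 * (4 * x)
  lem = solve-∀

module Parameters (s t : ℕ) where
  -- `R` makes 2^R at least t. `B` makes 2^B at least 2^(lg s) R², as the union bound over pairs of
  -- rounds requires. The extra one in `k` doubles the exponent 2^(lglg t), so that 2^(2^k) exceeds
  -- 2Rt, whose logarithm is about 2 lg t at most.
  R B k : ℕ
  R = lg t
  B = lg s + 2 * lg t
  k = suc (lglg t)
  open Rates s t R B k

  x y e M : ℕ
  x = s + 2
  y = t + 2
  e = lglg s + lglg t
  M = leaves k

  open ≤-Reasoning

  2≤e : 2 ≤ e
  2≤e = +-mono-≤ (1≤lg (lg s)) (1≤lg (lg t))

  instance
    y≢0 : NonZero y
    y≢0 = subst NonZero (+-comm 2 t) _
    x≢0 : NonZero x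
    x≢0 = subst NonZero (+-comm 2 s) _

  t≤2^R : t ≤ 2 ^ R
  t≤2^R = ≤-trans (m≤m+n t 2) (+2≤2^lg t)

  s<2^lg : s < 2 ^ lg s
  s<2^lg = <-≤-trans (≤-trans (n≤1+n (suc s)) (≤-reflexive (+-comm 2 s))) (+2≤2^lg s)

  test-error : 2 * (R * t) ≤ 2 ^ (2 ^ k)
  test-error = begin
    2 * (R * t) ≤⟨ *-monoʳ-≤ 2 (*-mono-≤ (<⇒≤ (n<2^n R)) t≤2^R) ⟩
    2 ^ suc zero * (2 ^ R * 2 ^ R) ≡⟨ cong (2 *_) (sym (^-distribˡ-+-* 2 R R)) ⟩
    2 ^ suc (R + R) ≤⟨ ^-monoʳ-≤ 2 (begin
      suc (R + R) ≤⟨ m≤m+n _ 3 ⟩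
      suc (R + R) + 3 ≡⟨ lem R ⟩
      2 * (R + 2) ≤⟨ *-monoʳ-≤ 2 (+2≤2^lg (lg t)) ⟩
      2 ^ k ∎) ⟩
    2 ^ (2 ^ k) ∎
    where
    lem : ∀ R → suc (R + R) + 3 ≡ 2 * (R + 2)
    lem = solve-∀

  overflow-error : ∀ i → i < lg s → 2 ^ i * (R * R) ≤ 2 ^ B
  overflow-error i i<L = begin
    2 ^ i * (R * R) ≤⟨ *-mono-≤ (^-monoʳ-≤ 2 (<⇒≤ i<L)) (*-mono-≤ (<⇒≤ (n<2^n R)) (<⇒≤ (n<2^n R))) ⟩
    2 ^ lg s * (2 ^ R * 2 ^ R)    ≡⟨ cong (2 ^ lg s *_) (sym (^-distribˡ-+-* 2 R R)) ⟩
    2 ^ lg s * 2 ^ (R + R) ≡⟨ sym (^-distribˡ-+-* 2 (lg s) (R + R)) ⟩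
    2 ^ (lg s + (R + R)) ≡⟨ cong (λ r → 2 ^ (lg s + (R + r))) (sym (+-identityʳ R)) ⟩
    2 ^ B ∎

  y^-mono : ∀ {p q} → p ≤ q → y ^ p ≤ y ^ q
  y^-mono = ^-monoʳ-≤ y

  2^≤y^ : ∀ p → 2 ^ p ≤ y ^ p
  2^≤y^ p = ^-monoˡ-≤ p (m≤n+m 2 t)

  -- As e ≥ 2, additive constants in exponents can be absorbed into multiples of `e`.
  e-multiple : ∀ p q → p ≤ 2 * q → p ≤ q * e
  e-multiple p q h = ≤-trans h (≤-trans (≤-reflexive (*-comm 2 q)) (*-monoʳ-≤ q 2≤e))

  M≤2^ : M ≤ 2 ^ (4 * e)
  M≤2^ = begin
    M ≡⟨ leaves≡ k ⟩
    2 * 4 ^ k ≡⟨ cong (2 *_) (^-*-assoc 2 2 k) ⟩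
    2 ^ suc (2 * k) ≤⟨ ^-monoʳ-≤ 2 (begin
      suc (2 * suc (lglg t)) ≡⟨ lem (lglg t) ⟩
      3 + 2 * lglg t ≤⟨ +-mono-≤ (e-multiple 3 2 (n≤1+n 3)) (*-monoʳ-≤ 2 (m≤n+m (lglg t) (lglg s))) ⟩
      2 * e + 2 * e ≡⟨ sym (*-distribʳ-+ e 2 2) ⟩
      4 * e ∎) ⟩
    2 ^ (4 * e) ∎
    where
    lem : ∀ b → suc (2 * suc b) ≡ 3 + 2 * b
    lem = solve-∀

  M≤y^ : M ≤ y ^ (4 * e)
  M≤y^ = ≤-trans M≤2^ (2^≤y^ (4 * e))

  2≤M : 2 ≤ M
  2≤M = ≤-trans (m≤m*n 2 (4 ^ k) {{m^n≢0 4 k}}) (≤-reflexive (sym (leaves≡ k)))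

  lg-s≤ : lg s ≤ 2 ^ e
  lg-s≤ = ≤-trans (≤-trans (m≤m+n (lg s) 2) (+2≤2^lg (lg s))) (^-monoʳ-≤ 2 (m≤m+n (lglg s) (lglg t)))

  R≤ : R ≤ 2 ^ e
  R≤ = ≤-trans (≤-trans (m≤m+n R 2) (+2≤2^lg (lg t))) (^-monoʳ-≤ 2 (m≤n+m (lglg t) (lglg s)))

  growth≤ : growth ≤ 2 ^ (10 * e)
  growth≤ = begin
    4 * suc (B * suc M) + 2 ≤⟨ +-monoˡ-≤ 2 (*-monoʳ-≤ 4 (s≤s (*-mono-≤ (+-mono-≤ lg-s≤ (*-monoʳ-≤ 2 R≤)) (s≤s M≤2^)))) ⟩
    4 * suc ((2 ^ e + 2 * 2 ^ e) * suc (2 ^ (4 * e))) + 2 ≤⟨ crude (2 ^ e) (2 ^ (4 * e)) (m^n>0 2 e) (m^n>0 2 (4 * e)) ⟩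
    2 ^ 5 * (2 ^ e * 2 ^ (4 * e)) ≡⟨ cong (2 ^ 5 *_) (sym (^-distribˡ-+-* 2 e (4 * e))) ⟩
    2 ^ 5 * 2 ^ (5 * e) ≡⟨ sym (^-distribˡ-+-* 2 5 (5 * e)) ⟩
    2 ^ (5 + 5 * e) ≤⟨ ^-monoʳ-≤ 2 (≤-trans (+-monoˡ-≤ (5 * e) (e-multiple 5 5 (m≤m+n 5 5))) (≤-reflexive (sym (*-distribʳ-+ e 5 5)))) ⟩
    2 ^ (10 * e) ∎
    where
    lem : ∀ a b → 4 * suc ((suc a + 2 * suc a) * suc (suc b)) + 2 + (20 * (a * b) + 8 * a + 20 * b + 2) ≡ 32 * (suc a * suc b)
    lem = solve-∀
    crude : ∀ a b → 1 ≤ a → 1 ≤ b → 4 * suc ((a + 2 * a) * suc b) + 2 ≤ 32 * (a * b)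
    crude (suc a) (suc b) _ _ = ≤-trans (m≤m+n _ _) (≤-reflexive (lem a b))

  -- Here the loglog exponent arises: `growth` is polylogarithmic, at most 2^(10e), and raising it
  -- to the power lg t gives (2^(lg t))^(10e). The exponent doubles because rounding is accounted
  -- for by 2^(lg t) ≤ (t + 2)².
  growth^R≤ : growth ^ R ≤ y ^ (20 * e)
  growth^R≤ = begin
    growth ^ R ≤⟨ ^-monoˡ-≤ R growth≤ ⟩
    (2 ^ (10 * e)) ^ R ≡⟨ trans (^-*-assoc 2 (10 * e) R) (trans (cong (2 ^_) (*-comm (10 * e) R)) (sym (^-*-assoc 2 R (10 * e)))) ⟩
    (2 ^ R) ^ (10 * e) ≤⟨ ^-monoˡ-≤ (10 * e) (2^lg≤ t) ⟩
    (y ^ 2) ^ (10 * e) ≡⟨ trans (^-*-assoc y 2 (10 * e)) (cong (y ^_) (sym (*-assoc 2 10 e))) ⟩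
    y ^ (20 * e) ∎

  base≤ : base ≤ x * y ^ (6 * e)
  base≤ = begin
    1 + s + t * (1 + 2 * s + M) ≤⟨ crude s t M 2≤M ⟩
    x * (y ^ 3 * M) ≤⟨ *-monoʳ-≤ x (*-mono-≤ (y^-mono (e-multiple 3 2 (n≤1+n 3))) M≤y^) ⟩
    x * (y ^ (2 * e) * y ^ (4 * e))  ≡⟨ cong (x *_) (trans (sym (^-distribˡ-+-* y (2 * e) (4 * e))) (cong (y ^_) (sym (*-distribʳ-+ e 2 4)))) ⟩
    x * y ^ (6 * e) ∎
    where
    lem : ∀ s t p → 1 + s + t * (1 + 2 * s + suc p) + (15 + 16 * p + 22 * t + 23 * t * p + 12 * t * t + 12 * t * t * p + 2 * t * t * t + 2 * t * t * t * p + 7 * s + 8 * s * p + 10 * s * t + 12 * s * t * p + 6 * s * t * t + 6 * s * t * t * p + 1 * s * t * t * t + 1 * s * t * t * t * p)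
        ≡ (s + 2) * ((t + 2) * ((t + 2) * ((t + 2) * 1)) * suc p)
    lem = solve-∀
    crude : ∀ s t M → 2 ≤ M → 1 + s + t * (1 + 2 * s + M) ≤ (s + 2) * ((t + 2) ^ 3 * M)
    crude s t (suc p) _ = ≤-trans (m≤m+n _ _) (≤-reflexive (lem s t p))

  polynomial≤ : polynomial ≤ x * y ^ (11 * e)
  polynomial≤ = begin
    1 + t + 2 * (t * s) + R * (1 + R * suc M) + 2 * s
      ≡⟨ lem t s (R * (1 + R * suc M)) ⟩
    (1 + t) * (1 + 2 * s) + R * (1 + R * suc M)
      ≤⟨ +-mono-≤ (*-mono-≤ small-t small-s) (*-mono-≤ R≤y (begin
           1 + R * suc M ≤⟨ +-mono-≤ (≤-trans (1≤lg t) (≤-trans (m≤m*n R M {{M≢0}}) ≤-refl)) (*-monoʳ-≤ R (+-monoˡ-≤ M (≤-trans (n≤1+n 1) 2≤M))) ⟩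
           R * M + R * (M + M) ≡⟨ lem2 R M ⟩
           3 * (R * M) ≤⟨ *-mono-≤ 3≤y^ (*-mono-≤ R≤y M≤y^) ⟩
           y ^ (2 * e) * (y ^ e * y ^ (4 * e)) ∎)) ⟩
    y * (2 * x) + y ^ e * (y ^ (2 * e) * (y ^ e * y ^ (4 * e)))
      ≤⟨ +-mono-≤ (≤-trans (≤-reflexive (lem3 x y)) (*-mono-≤ (≤-refl {x}) (*-mono-≤ 2≤y (≤-reflexive (sym (*-identityʳ y))))))
                  (≤-trans (≤-reflexive (collect-powers)) (m≤n*m (y ^ (8 * e)) x)) ⟩
    x * y ^ 2 + x * y ^ (8 * e)
      ≤⟨ +-monoˡ-≤ (x * y ^ (8 * e)) (*-monoʳ-≤ x (y^-mono (e-multiple 2 8 (m≤m+n 2 14)))) ⟩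
    x * y ^ (8 * e) + x * y ^ (8 * e) ≡⟨ lem4 (x * y ^ (8 * e)) ⟩
    2 * (x * y ^ (8 * e)) ≤⟨ *-monoˡ-≤ (x * y ^ (8 * e)) (≤-trans (n≤1+n 2) 3≤y^) ⟩
    y ^ (2 * e) * (x * y ^ (8 * e)) ≡⟨ trans (lem5 (y ^ (2 * e)) x (y ^ (8 * e))) (cong (x *_) (trans (sym (^-distribˡ-+-* y (2 * e) (8 * e))) (cong (y ^_) (sym (*-distribʳ-+ e 2 8))))) ⟩
    x * y ^ (10 * e) ≤⟨ *-monoʳ-≤ x (y^-mono (*-monoˡ-≤ e (n≤1+n 10))) ⟩
    x * y ^ (11 * e) ∎
    where
    lem : ∀ t s r → 1 + t + 2 * (t * s) + r + 2 * s ≡ (1 + t) * (1 + 2 * s) + r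
    lem = solve-∀
    lem2 : ∀ R M → R * M + R * (M + M) ≡ 3 * (R * M)
    lem2 = solve-∀
    lem3 : ∀ x y → y * (2 * x) ≡ x * (2 * y)
    lem3 = solve-∀
    lem4 : ∀ z → z + z ≡ 2 * z
    lem4 = solve-∀
    lem5 : ∀ a x b → a * (x * b) ≡ x * (a * b)
    lem5 = solve-∀
    M≢0 : NonZero M
    M≢0 = >-nonZero (≤-trans (n≤1+n 1) 2≤M)
    2≤y : 2 ≤ y
    2≤y = m≤n+m 2 t
    small-t : 1 + t ≤ y
    small-t = ≤-trans (n≤1+n (1 + t)) (≤-reflexive (+-comm 2 t))
    small-s : 1 + 2 * s ≤ 2 * x
    small-s = ≤-trans (m≤m+n (1 + 2 * s) 3) (≤-reflexive (lem6 s))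
      where
      lem6 : ∀ s → 1 + 2 * s + 3 ≡ 2 * (s + 2)
      lem6 = solve-∀
    R≤y : R ≤ y ^ e
    R≤y = ≤-trans R≤ (2^≤y^ e)
    3≤y^ : 3 ≤ y ^ (2 * e)
    3≤y^ = ≤-trans (n≤1+n 3) (≤-trans (*-mono-≤ 2≤y (*-mono-≤ 2≤y (≤-refl {1}))) (y^-mono (e-multiple 2 2 (m≤m+n 2 2))))
    collect-powers : y ^ e * (y ^ (2 * e) * (y ^ e * y ^ (4 * e))) ≡ y ^ (8 * e)
    collect-powers = trans (cong (λ w → y ^ e * (y ^ (2 * e) * w)) (sym (^-distribˡ-+-* y e (4 * e))))
      (trans (cong (y ^ e *_) (sym (^-distribˡ-+-* y (2 * e) (e + 4 * e))))
        (trans (sym (^-distribˡ-+-* y e (2 * e + (e + 4 * e)))) (cong (y ^_) (lem7 e))))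
      where
      lem7 : ∀ e → e + (2 * e + (e + 4 * e)) ≡ 8 * e
      lem7 = solve-∀

  -- The exponents of `base`, `growth ^ R` and `polynomial` add up to 6 + 20 + 11 = 37; two more
  -- multiples of `e` absorb the constant 3.
  rate≤ : 2 * factor + 1 ≤ x ^ 2 * y ^ (39 * e)
  rate≤ = begin
    2 * factor + 1 ≤⟨ +-mono-≤ (*-monoʳ-≤ 2 factor≤) (m^n>0 (x * (x * 1)) {{m*n≢0 x (x * 1) {{x≢0}} {{m*n≢0 x 1}}}} 1) ⟩
    2 * (x * (x * 1) * w) + x * (x * 1) * 1  ≤⟨ +-monoʳ-≤ (2 * (x * (x * 1) * w)) (*-monoʳ-≤ (x * (x * 1)) (m^n>0 y (37 * e))) ⟩
    2 * (x * (x * 1) * w) + x * (x * 1) * w  ≡⟨ lem (x * (x * 1)) w ⟩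
    x ^ 2 * (3 * w) ≤⟨ *-monoʳ-≤ (x ^ 2) (*-monoˡ-≤ w 3≤y^) ⟩
    x ^ 2 * (y ^ (2 * e) * w) ≡⟨ cong (x ^ 2 *_) (trans (sym (^-distribˡ-+-* y (2 * e) (37 * e))) (cong (y ^_) (sym (*-distribʳ-+ e 2 37)))) ⟩
    x ^ 2 * y ^ (39 * e) ∎
    where
    w : ℕ
    w = y ^ (37 * e)
    lem : ∀ a w → 2 * (a * w) + a * w ≡ a * (3 * w)
    lem = solve-∀
    lem2 : ∀ x a b c → x * a * b * (x * c) ≡ x * (x * 1) * (a * (b * c))
    lem2 = solve-∀
    3≤y^ : 3 ≤ y ^ (2 * e)
    3≤y^ = ≤-trans (n≤1+n 3) (≤-trans (*-mono-≤ (m≤n+m 2 t) (*-mono-≤ (m≤n+m 2 t) (≤-refl {1}))) (y^-mono (e-multiple 2 2 (m≤m+n 2 2))))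
    factor≤ : factor ≤ x * (x * 1) * w
    factor≤ = begin
      base * growth ^ R * polynomial ≤⟨ *-mono-≤ (*-mono-≤ base≤ growth^R≤) polynomial≤ ⟩
      x * y ^ (6 * e) * y ^ (20 * e) * (x * y ^ (11 * e)) ≡⟨ lem2 x (y ^ (6 * e)) (y ^ (20 * e)) (y ^ (11 * e)) ⟩
      x * (x * 1) * (y ^ (6 * e) * (y ^ (20 * e) * y ^ (11 * e)))
        ≡⟨ cong (x * (x * 1) *_) (trans (cong (y ^ (6 * e) *_) (sym (^-distribˡ-+-* y (20 * e) (11 * e))))
             (trans (sym (^-distribˡ-+-* y (6 * e) (20 * e + 11 * e))) (cong (y ^_) (lem3 e)))) ⟩
      x * (x * 1) * w ∎
      where
      lem3 : ∀ e → 6 * e + (20 * e + 11 * e) ≡ 37 * e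
      lem3 = solve-∀

  -- The computation yields exponents of at most 3 lg s and 40 (lg s) e. They are raised to 52, the
  -- constant in the bound on the cover size, so that one constant serves both bounds.
  query-bound : (1 + s + 2 * (s * t)) * (2 * factor + 1) ^ lg s ≤ x ^ (52 * lg s) * y ^ (52 * lg s * e)
  query-bound = begin
    (1 + s + 2 * (s * t)) * (2 * factor + 1) ^ L   ≤⟨ *-mono-≤ outer (^-monoˡ-≤ L rate≤) ⟩
    x * y ^ 2 * (x ^ 2 * y ^ (39 * e)) ^ L ≡⟨ cong (x * y ^ 2 *_) (trans (^-distribʳ-* L (x ^ 2) (y ^ (39 * e))) (cong₂ _*_ (^-*-assoc x 2 L) (^-*-assoc y (39 * e) L))) ⟩
    x * y ^ 2 * (x ^ (2 * L) * y ^ (39 * e * L))   ≡⟨ lem x (y ^ 2) (x ^ (2 * L)) (y ^ (39 * e * L)) ⟩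
    x ^ suc (2 * L) * (y ^ 2 * y ^ (39 * e * L))   ≡⟨ cong (x ^ suc (2 * L) *_) (sym (^-distribˡ-+-* y 2 (39 * e * L))) ⟩
    x ^ suc (2 * L) * y ^ (2 + 39 * e * L) ≤⟨ *-mono-≤ (^-monoʳ-≤ x x-exponent) (y^-mono y-exponent) ⟩
    x ^ (52 * L) * y ^ (52 * L * e) ∎
    where
    L : ℕ
    L = lg s
    lem : ∀ x y a b → x * y * (a * b) ≡ x * a * (y * b)
    lem = solve-∀
    outer : 1 + s + 2 * (s * t) ≤ x * y ^ 2
    outer = ≤-trans (m≤m+n _ _) (≤-reflexive (lem2 s t))
      where
      lem2 : ∀ s t → 1 + s + 2 * (s * t) + (7 + 8 * t + 2 * t * t + 3 * s + 2 * s * t + s * t * t) ≡ (s + 2) * ((t + 2) * ((t + 2) * 1))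
      lem2 = solve-∀
    x-exponent : suc (2 * L) ≤ 52 * L
    x-exponent = ≤-trans (+-monoˡ-≤ (2 * L) (1≤lg s)) (*-monoˡ-≤ L (m≤m+n 3 49))
    y-exponent : 2 + 39 * e * L ≤ 52 * L * e
    y-exponent = begin
      2 + 39 * e * L ≤⟨ +-monoˡ-≤ (39 * e * L) (≤-trans 2≤e (≤-trans (≤-reflexive (sym (*-identityʳ e))) (*-monoʳ-≤ e (1≤lg s)))) ⟩
      e * L + 39 * e * L    ≤⟨ m≤m+n _ (12 * L * e) ⟩
      e * L + 39 * e * L + 12 * L * e ≡⟨ lem3 e L ⟩
      52 * L * e ∎
      where
      lem3 : ∀ e L → e * L + 39 * e * L + 12 * L * e ≡ 52 * L * e
      lem3 = solve-∀

-- The algorithm and its guarantees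

setCoverLCA : LCA
setCoverLCA = record
  { tapeLen = λ n m s t → bits (runSpace m (Parameters.R s t) (Parameters.k s t) (lg s))
  ; algo    = λ n m s t r S → RunP.coverP n m s t (Parameters.R s t) (Parameters.B s t) (Parameters.k s t) (lg s)
                (decode (runSpace m (Parameters.R s t) (Parameters.k s t) (lg s)) r) S answer
  }

module Correctness {n m s t : ℕ} (I : Instance n m s t) where
  open Parameters s t using (R; B; k)
  open Run I R B k
  open ≤-Reasoning
  L len : ℕ
  L = lg s
  Ω : Space
  Ω = runSpace m R k L
  len = bits Ω

  computes : ∀ r S → Computes I (RunP.coverP n m s t R B k L (decode Ω r) S) (cover L (decode Ω r) S) _
  computes r S = RunP.computes-cover n m s t R B k I L (decode Ω r) S
  answers : ∀ r S → inCover setCoverLCA I r S ≡ cover L (decode Ω r) S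
  answers r S = proj₁ (computes r S answer)

  few-queries : ∀ (r : Vec Bool len) S → queries I (algo setCoverLCA n m s t r S) ≤ (s + 2) ^ (52 * L) * (t + 2) ^ (52 * L * (lglg s + lglg t))
  few-queries r S = ≤-trans (proj₂ (computes r S answer)) (≤-trans (≤-reflexive (+-identityʳ _)) (Parameters.query-bound s t))

  is-cover : ∀ r → IsSetCover I (inCover setCoverLCA I r)
  is-cover r e = let (S , e∈S , h) = cover-covers L (decode Ω r) e in S , e∈S , trans (answers r S) h

  light : Light L (λ _ → true)
  light S = ≤-<-trans (length-filter (λ _ → T? true) (elemsOf I S)) (≤-<-trans (setSize I S) (Parameters.s<2^lg s t))

  small : (x : FractionalCover I) →
    toℚ (sumTapes len (λ r → coverSize (inCover setCoverLCA I r))) ℚ.≤ toℚ (2 ^ len) ℚ.* toℚ (52 * L) ℚ.* fracValue x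
  small x = let (D , V , lower , upper) = fracValue-ℕ x in
    subst (λ c → toℚ (sumTapes len (λ r → coverSize (inCover setCoverLCA I r))) ℚ.≤ c ℚ.* fracValue x) (toℚ-* (2 ^ len) (52 * L))
      (upper (sumTapes len (λ r → coverSize (inCover setCoverLCA I r))) (2 ^ len * (52 * L)) (begin
        D * sumTapes len (λ r → coverSize (inCover setCoverLCA I r))
          ≡⟨ cong (D *_) (trans (sumTapes≡∑ len _) (trans
               (∑-cong (tapes len) (λ r → ∑-cong (allFin m) (λ S → cong 𝟙 (answers r S)))) (sym (∑-outs Ω _)))) ⟩
        D * ∑ (outs Ω) (λ ω → coverSize (cover L ω))
          ≤⟨ *-monoʳ-≤ D (∑-mono (outs Ω) (λ ω → cover-cost L ω light)) ⟩
        D * ∑ (outs Ω) (runCost L (λ _ → true))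
          ≤⟨ runCost-≤ D V lower (Parameters.t≤2^R s t) (Parameters.test-error s t) L (λ _ → true) light (Parameters.overflow-error s t) ⟩
        52 * L * V * size Ω
          ≡⟨ cong (52 * L * V *_) (size≡2^ Ω) ⟩
        52 * L * V * 2 ^ len
          ≡⟨ lem (52 * L) V (2 ^ len) ⟩
        2 ^ len * (52 * L) * V ∎))
    where
    lem : ∀ a V z → a * V * z ≡ z * a * V
    lem = solve-∀

theorem1p1 : Σ ℕ λ c → Σ LCA λ A →
    ∀ (n m s t : ℕ) (I : Instance n m s t) →
    ((r : Vec Bool (tapeLen A n m s t)) (S : Fin m) →
    queries I (algo A n m s t r S)
    ≤ (s + 2) ^ (c * lg s) * (t + 2) ^ (c * lg s * (lglg s + lglg t)))
    × ((r : Vec Bool (tapeLen A n m s t)) → IsSetCover I (inCover A I r))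
    × ((x : FractionalCover I) →
    toℚ (sumTapes (tapeLen A n m s t) (λ r → coverSize (inCover A I r)))
    ℚ.≤ toℚ (2 ^ tapeLen A n m s t) ℚ.* toℚ (c * lg s) ℚ.* fracValue x)
theorem1p1 = 52 , setCoverLCA , λ n m s t I →
  Correctness.few-queries I , Correctness.is-cover I , Correctness.small I
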